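{- Let $\Gamma$ be a finite connected vertex-transitive cubic graph. Then either $\Gamma$ is a split Praeger--Xu graph, or $|\mathrm{Aut}(\Gamma)|\le 2|V\Gamma|^2$.
   Context: Graphs are finite, simple and undirected; cubic means regular of valency $3$; $V\Gamma$ is the vertex set. Praeger--Xu graphs: for integers $r\ge 3$, $s\ge 1$, let $\vec{\mathrm{C}}(r,s)$ be the digraph with vertex set $\mathbb{Z}_r\times\{0,1\}^s$, whose vertices are written $(x;\epsilon_0\epsilon_1\cdots\epsilon_{s-1})$, such that for every string $h$ in $\{0,1\}$ of length $s-1$ and every $\epsilon\in\{0,1\}$ the out-neighbours of $(x;\epsilon h)$ are $(x+1;h0)$ and $(x+1;h1)$. The split Praeger--Xu graph $\mathrm{s}\mathrm{C}(r,s)$ (for $r\ge 3$, $1\le s\le r-1$) is the cubic graph with vertices $v^+,v^-$ for each vertex $v$ of $\vec{\mathrm{C}}(r,s)$, with edges $\{v^+,v^-\}$ for each $v$, and $\{u^+,v^-\}$ for each arc $(u,v)$ of $\vec{\mathrm{C}}(r,s)$. "$\Gamma$ is a split Praeger--Xu graph" means $\Gamma\cong \mathrm{s}\mathrm{C}(r,s)$ for some such $r,s$. -}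

module Defs where

open import Data.Bool using (Bool)
open import Data.Empty using (⊥)
open import Data.Fin using (Fin; toℕ)
import Data.Fin.Properties as Fin
open import Data.Nat using (ℕ; suc; _≤_; _∸_)
open import Data.Nat.DivMod using (_mod_)
open import Data.Product using (Σ; ∃-syntax; _×_; _,_; proj₁)
open import Data.Sign using (Sign; +; -)
open import Data.Sum using (_⊎_)
open import Data.Vec using (Vec; []; _∷_; _∷ʳ_)
open import Function.Bundles using (Inverse; _↔_; _⇔_)
open import Level using (Level; 0ℓ) renaming (suc to lsuc)
open import Relation.Binary using (Rel; Symmetric; Setoid)
open import Relation.Binary.Construct.Closure.ReflexiveTransitive using (Star)
import Relation.Binary.Construct.On as On
open import Relation.Binary.PropositionalEquality as ≡ using (_≡_; refl)
open import Relation.Nullary using (¬_)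

private
  variable
    a ℓ : Level

-- Cardinality is defined for setoids because automorphisms are compared
-- pointwise, and neighbours of a vertex only by their underlying vertex.
HasSize : Setoid a ℓ → ℕ → Set _
HasSize S n = Inverse S (Fin.≡-setoid n)

record Graph : Set (lsuc 0ℓ) where
  infix 4 _~_
  field
    Vertex   : Set
    _~_      : Rel Vertex 0ℓ
    ~-sym    : Symmetric _~_
    ~-irrefl : ∀ v → ¬ (v ~ v)

  vertices : Setoid 0ℓ 0ℓ
  vertices = ≡.setoid Vertex

  neighbours : Vertex → Setoid 0ℓ 0ℓ
  neighbours v = On.setoid vertices (proj₁ {B = v ~_})

open Graph

infix 4 _≅_

record _≅_ (Γ Δ : Graph) : Set where
  field
    bijection : Vertex Γ ↔ Vertex Δ

  open Inverse bijection public using (to; from)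

  field
    ~-⇔ : ∀ u v → (_~_ Γ u v) ⇔ (_~_ Δ (to u) (to v))

Aut : Graph → Setoid 0ℓ 0ℓ
Aut Γ = record
  { Carrier       = Γ ≅ Γ
  ; _≈_           = λ f g → ∀ v → _≅_.to f v ≡ _≅_.to g v
  ; isEquivalence = record
    { refl  = λ v → refl
    ; sym   = λ p v → ≡.sym (p v)
    ; trans = λ p q v → ≡.trans (p v) (q v)
    }
  }

-- Includes nonemptiness: the null graph is not counted as connected.
Connected : Graph → Set
Connected Γ = Vertex Γ × (∀ u v → Star (_~_ Γ) u v)

VertexTransitive : Graph → Set
VertexTransitive Γ = ∀ u v → Σ (Γ ≅ Γ) λ f → _≅_.to f u ≡ v

Regular : ℕ → Graph → Set
Regular d Γ = ∀ v → HasSize (neighbours Γ v) d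

Cubic : Graph → Set
Cubic = Regular 3

-- Fin r, with the successor below, plays the role of ℤ/rℤ.
sucMod : ∀ {r} → Fin r → Fin r
sucMod {suc r} x = suc (toℕ x) mod suc r

PXVertex : ℕ → ℕ → Set
PXVertex r s = Fin r × Vec Bool s

-- There is an arc from (x ; εh) to (x + 1 ; hε′) for all x, ε, h, ε′.
-- The case s = 0 is junk, and is excluded wherever the digraph is used.
PXArc : ∀ {r s} → Rel (PXVertex r s) 0ℓ
PXArc (x , [])    _       = ⊥
PXArc (x , ε ∷ h) (y , w) = y ≡ sucMod x × ∃[ ε′ ] w ≡ h ∷ʳ ε′

SplitPXVertex : ℕ → ℕ → Set
SplitPXVertex r s = PXVertex r s × Sign

SplitPXAdj : ∀ {r s} → Rel (SplitPXVertex r s) 0ℓ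
SplitPXAdj (u , +) (v , -) = u ≡ v ⊎ PXArc u v
SplitPXAdj (v , -) (u , +) = u ≡ v ⊎ PXArc u v
SplitPXAdj (_ , +) (_ , +) = ⊥
SplitPXAdj (_ , -) (_ , -) = ⊥

splitPX : ℕ → ℕ → Graph
splitPX r s = record
  { Vertex   = SplitPXVertex r s
  ; _~_      = SplitPXAdj
  ; ~-sym    = λ {u} {v} → adj-sym u v
  ; ~-irrefl = adj-irrefl
  }
  where
  adj-sym : ∀ (u v : SplitPXVertex r s) → SplitPXAdj u v → SplitPXAdj v u
  adj-sym (_ , +) (_ , -) e = e
  adj-sym (_ , -) (_ , +) e = e

  adj-irrefl : ∀ (v : SplitPXVertex r s) → ¬ SplitPXAdj v v
  adj-irrefl (_ , +) ()
  adj-irrefl (_ , -) ()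

IsSplitPraegerXu : Graph → Set
IsSplitPraegerXu Γ =
  ∃[ r ] ∃[ s ] (3 ≤ r × 1 ≤ s × s ≤ r ∸ 1 × Γ ≅ splitPX r s)

{-# OPTIONS --safe #-}

-- Let G be the automorphism group of Γ, acting on the vertex set V.  If G_v fixes the three
-- neighbours of v, then G_v = 1.  Otherwise G acts transitively on a digraph D of valency two with
-- an arc-reversing involution: if G_v is transitive on the neighbours of v, the vertices of D are
-- the darts of Γ and its walks are the non-backtracking walks of Γ; if G_v fixes exactly one
-- neighbour v′ of v, the vertices of D are those of Γ, and v → w when w ≠ v is adjacent to v′.  For
-- the largest t such that G is transitive on the t-arcs of D, G is even regular on them.
--
-- In the first case, the t-arcs are counted.  If the non-backtracking walks of length t in Γ are
-- determined by their ends, then G embeds into V × V × Bool.  Otherwise let m + 2 be the least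
-- length of two distinct walks with the same ends.  Then t = m + 2 and there are no short odd
-- cycles, so the walks of length m + 1 which start at v or at a given neighbour of v have distinct
-- ends; again G embeds into V × V × Bool.
--
-- In the second case, if the t-arcs are determined by their ends, then G embeds into V × V.
-- Otherwise there is 1 ≤ s < t such that s-arcs, but not (s + 1)-arcs, are determined by their
-- ends.  The vertices reached from a given vertex by s-arcs form a layer of size 2^s; the layers
-- partition one half of D, are permuted cyclically by the arcs, and the group K preserving a layer
-- has order 2^(s+t).  As K is a 2-group, some nonconstant 2-colouring of the layer is preserved by
-- K up to complement, and pulling it back along arcs we may assume that it distinguishes the two
-- out-neighbours of every vertex.  Hence an element of K which fixes two vertices of a layer swaps
-- the out-neighbours of both or of neither.  It follows that an automorphism fixing an s-arc fixes
-- the layers of its vertices pointwise, and from this that vertices having one descendant in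
-- common at distance s - 1 have all of them in common.  So each layer splits into two halves
-- according to the ancestors at distance s - 1, and these halves provide the s bits of a vertex of
-- the Praeger–Xu digraph.
module Submission where

open import Defs
open import Data.Bool using (Bool; true; false; not; _∧_; _xor_)
import Data.Bool.Properties as Bool
open import Data.Empty using (⊥)
open import Data.Fin
  using (Fin; zero; suc; toℕ; combine; remQuot; punchIn; punchOut; funToFin; finToFun)
import Data.Fin.Properties as Fin
open import Data.Nat using (ℕ; zero; suc; _+_; _*_; _^_; _∸_; _≤_; _<_; z≤n; s≤s)
open import Data.Nat.Divisibility using (_∣_; divides; ∣m+n∣m⇒∣n; ∣m∣n⇒∣m+n; _∣0; ∣1⇒≡1)
open import Data.Nat.DivMod using (_%_; m<n⇒m%n≡m; n%n≡0; m%n<n)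
open import Data.Nat.Primality using (prime[2]; euclidsLemma)
import Data.Nat.Properties as ℕ
open import Data.Product using (∃; ∃-syntax; Σ-syntax; _×_; _,_; proj₁; proj₂)
import Data.Sign as Sign
open import Data.Sum using (_⊎_; inj₁; inj₂)
open import Data.Vec using (Vec; []; _∷_; _∷ʳ_; _++_; splitAt; replicate; head; lookup; tabulate)
import Data.Vec.Properties as Vec
open import Function using (_∘_; _⇔_; mk⇔; _↔_; mk↔ₛ′; Equivalence; Inverse)
open import Function.Construct.Composition using (_⇔-∘_)
open import Level using (0ℓ)
open import Relation.Binary using (Setoid)
open import Relation.Binary.Construct.Closure.ReflexiveTransitive as Star using (Star; _◅_)
open import Relation.Binary.Definitions using (tri<; tri≈; tri>)
open import Relation.Binary.PropositionalEquality
open import Relation.Nullary using (¬_; Dec; yes; no; does; contradiction)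
open import Relation.Nullary.Decidable
  using (map′; ¬?; _×-dec_; _→-dec_; decidable-stable; dec-true; dec-false)

-- Finite types

Searchable : Set → Set₁
Searchable A = ∀ {P : A → Set} → (∀ a → Dec (P a)) → Dec (∃ P)

search-Bool : Searchable Bool
search-Bool P? with P? true | P? false
... | yes p | _     = yes (true , p)
... | no _  | yes q = yes (false , q)
... | no ¬p | no ¬q = no λ { (true , p) → ¬p p ; (false , q) → ¬q q }

search-Vec : ∀ {A} → Searchable A → ∀ m → Searchable (Vec A m)
search-Vec S zero    P? = map′ (λ p → [] , p) (λ { ([] , p) → p }) (P? [])
search-Vec S (suc m) P? =
  map′ (λ { (a , as , p) → a ∷ as , p }) (λ { (a ∷ as , p) → a , as , p })
       (S λ a → search-Vec S m λ as → P? (a ∷ as))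

search-× : ∀ {A B} → Searchable A → Searchable B → Searchable (A × B)
search-× S T P? =
  map′ (λ { (a , b , p) → (a , b) , p }) (λ { ((a , b) , p) → a , b , p })
       (S λ a → T λ b → P? (a , b))

search-retract : ∀ {A B} (f : A → B) (g : B → A) → (∀ b → f (g b) ≡ b) →
                 Searchable A → Searchable B
search-retract f g fg S {P} P? =
  map′ (λ { (a , p) → f a , p }) (λ { (b , p) → g b , subst P (sym (fg b)) p })
       (S λ a → P? (f a))

search-∀ : ∀ {A} → Searchable A → {P : A → Set} → (∀ a → Dec (P a)) → Dec (∀ a → P a)
search-∀ S P? with S (λ a → ¬? (P? a))
... | yes (a , ¬p) = no λ f → ¬p (f a)
... | no ¬∃        = yes λ a → decidable-stable (P? a) λ ¬p → ¬∃ (a , ¬p)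

least : {P : ℕ → Set} → (∀ n → Dec (P n)) → ∀ n → P n → ∃[ m ] (P m × (∀ k → k < m → ¬ P k))
least {P} P? n p = go n zero (λ _ ()) (subst P (sym (ℕ.+-identityʳ n)) p)
  where
  go : ∀ d m → (∀ k → k < m → ¬ P k) → P (d + m) → ∃[ m ] (P m × (∀ k → k < m → ¬ P k))
  go d m below p with P? m
  ... | yes q = m , q , below
  go zero    m below p | no ¬q = contradiction p ¬q
  go (suc d) m below p | no ¬q =
    go d (suc m) below′ (subst P (sym (ℕ.+-suc d m)) p)
    where
    below′ : ∀ k → k < suc m → ¬ P k
    below′ k (s≤s k≤m) with ℕ.m≤n⇒m<n∨m≡n k≤m
    ... | inj₁ k<m  = below k k<m
    ... | inj₂ refl = ¬q

-- If `j` were missed, `punchOut` at `j` would turn `f` into an injection from `Fin (suc n)` to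
-- `Fin n`.
injective⇒surjective : ∀ {n} (f : Fin n → Fin n) → (∀ {i j} → f i ≡ f j → i ≡ j) →
                       ∀ j → ∃[ i ] f i ≡ j
injective⇒surjective {n} f inj j with Fin.any? (λ i → f i Fin.≟ j)
... | yes p = p
injective⇒surjective {suc n} f inj j | no ¬p = contradiction bound ℕ.1+n≰n
  where
  j≢f : ∀ i → j ≢ f i
  j≢f i eq = ¬p (i , sym eq)
  bound : suc n ≤ n
  bound = Fin.injective⇒≤ {f = λ i → punchOut (j≢f i)}
            (λ {i} {k} eq → inj (Fin.punchOut-injective (j≢f i) (j≢f k) eq))

bit→Fin : Bool → Fin 2
bit→Fin false = zero
bit→Fin true  = suc zero

Fin→bit : Fin 2 → Bool
Fin→bit zero    = false
Fin→bit (suc _) = true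

bit→Fin→bit : ∀ b → Fin→bit (bit→Fin b) ≡ b
bit→Fin→bit false = refl
bit→Fin→bit true  = refl

Fin→bit→Fin : ∀ i → bit→Fin (Fin→bit i) ≡ i
Fin→bit→Fin zero       = refl
Fin→bit→Fin (suc zero) = refl

bit→Fin-injective : ∀ {b c} → bit→Fin b ≡ bit→Fin c → b ≡ c
bit→Fin-injective {b} {c} eq = trans (sym (bit→Fin→bit b)) (trans (cong Fin→bit eq) (bit→Fin→bit c))

abstract
  word→Fin : ∀ {m} → Vec Bool m → Fin (2 ^ m)
  word→Fin []      = zero
  word→Fin (b ∷ e) = combine (bit→Fin b) (word→Fin e)

  Fin→word : ∀ m → Fin (2 ^ m) → Vec Bool m
  Fin→word zero    i = []
  Fin→word (suc m) i =
    Fin→bit (proj₁ (remQuot {2} (2 ^ m) i)) ∷ Fin→word m (proj₂ (remQuot {2} (2 ^ m) i))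

  Fin→word→Fin : ∀ m i → word→Fin (Fin→word m i) ≡ i
  Fin→word→Fin zero    zero = refl
  Fin→word→Fin (suc m) i    = trans
    (cong₂ combine (Fin→bit→Fin (proj₁ (remQuot {2} (2 ^ m) i)))
                   (Fin→word→Fin m (proj₂ (remQuot {2} (2 ^ m) i))))
    (Fin.combine-remQuot {2} (2 ^ m) i)

  word→Fin→word : ∀ {m} (e : Vec Bool m) → Fin→word m (word→Fin e) ≡ e
  word→Fin→word []              = refl
  word→Fin→word {suc m} (b ∷ e) = cong₂ _∷_
    (trans (cong (Fin→bit ∘ proj₁) (Fin.remQuot-combine {2} {2 ^ m} (bit→Fin b) (word→Fin e)))
           (bit→Fin→bit b))
    (trans (cong (Fin→word m ∘ proj₂) (Fin.remQuot-combine {2} {2 ^ m} (bit→Fin b) (word→Fin e)))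
           (word→Fin→word e))

word→Fin-injective : ∀ {m} {e f : Vec Bool m} → word→Fin e ≡ word→Fin f → e ≡ f
word→Fin-injective {m} {e} {f} eq =
  trans (sym (word→Fin→word e)) (trans (cong (Fin→word m) eq) (word→Fin→word f))

Fin→word-injective : ∀ {m} {i j : Fin (2 ^ m)} → Fin→word m i ≡ Fin→word m j → i ≡ j
Fin→word-injective {m} {i} {j} eq =
  trans (sym (Fin→word→Fin m i)) (trans (cong word→Fin eq) (Fin→word→Fin m j))

injective⇒surjective-word : ∀ {m} (f : Vec Bool m → Vec Bool m) →
  (∀ {e e′} → f e ≡ f e′ → e ≡ e′) → ∀ w → ∃[ e ] f e ≡ w
injective⇒surjective-word {m} f inj w
  with i , eq ← injective⇒surjective (word→Fin ∘ f ∘ Fin→word m)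
                  (Fin→word-injective ∘ inj ∘ word→Fin-injective) (word→Fin w)
  = Fin→word m i , word→Fin-injective eq

snoc-view : ∀ {m} (e : Vec Bool (suc m)) → Σ[ f ∈ Vec Bool m ] ∃[ b ] e ≡ f ∷ʳ b
snoc-view (b ∷ [])    = [] , b , refl
snoc-view (b ∷ c ∷ e) with f , d , eq ← snoc-view (c ∷ e) = b ∷ f , d , cong (b ∷_) eq

n<2^n : ∀ n → n < 2 ^ n
n<2^n zero    = s≤s z≤n
n<2^n (suc n) = ℕ.≤-trans (s≤s (n<2^n n))
  (ℕ.≤-trans (ℕ.+-monoˡ-≤ (2 ^ n) (ℕ.m^n>0 2 n))
             (ℕ.≤-reflexive (cong (2 ^ n +_) (sym (ℕ.+-identityʳ (2 ^ n))))))

-- Counting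

open import Algebra.Properties.CommutativeMonoid.Sum ℕ.+-0-commutativeMonoid
  using (sum; sum-cong-≗; ∑-comm; ∑-distrib-+)

indicator : Bool → ℕ
indicator false = 0
indicator true  = 1

count : ∀ {n} → (Fin n → Bool) → ℕ
count p = sum (λ i → indicator (p i))

nth : ∀ {n} (p : Fin n → Bool) → Fin (count p) → Fin n
nth {suc n} p i with p zero
nth {suc n} p zero    | true  = zero
nth {suc n} p (suc i) | true  = suc (nth (p ∘ suc) i)
nth {suc n} p i       | false = suc (nth (p ∘ suc) i)

nth-holds : ∀ {n} (p : Fin n → Bool) i → p (nth p i) ≡ true
nth-holds {suc n} p i with p zero in eq
nth-holds {suc n} p zero    | true  = eq
nth-holds {suc n} p (suc i) | true  = nth-holds (p ∘ suc) i
nth-holds {suc n} p i       | false = nth-holds (p ∘ suc) i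

nth-injective : ∀ {n} (p : Fin n → Bool) {i j} → nth p i ≡ nth p j → i ≡ j
nth-injective {suc n} p {i} {j} eq with p zero
nth-injective {suc n} p {zero}  {zero}  eq | true  = refl
nth-injective {suc n} p {suc i} {suc j} eq | true  =
  cong suc (nth-injective (p ∘ suc) (Fin.suc-injective eq))
nth-injective {suc n} p {i}     {j}     eq | false = nth-injective (p ∘ suc) (Fin.suc-injective eq)

nth-surjective : ∀ {n} (p : Fin n → Bool) j → p j ≡ true → ∃[ i ] nth p i ≡ j
nth-surjective {suc n} p j pj with p zero in eq
nth-surjective {suc n} p zero    pj | true  = zero , refl
nth-surjective {suc n} p (suc j) pj | true  with i , e ← nth-surjective (p ∘ suc) j pj =
  suc i , cong suc e
nth-surjective {suc n} p zero    pj | false = contradiction (trans (sym eq) pj) λ ()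
nth-surjective {suc n} p (suc j) pj | false with i , e ← nth-surjective (p ∘ suc) j pj =
  i , cong suc e

count-injection : ∀ {m n} (p : Fin m → Bool) (q : Fin n → Bool) (f : Fin m → Fin n) →
  (∀ {i j} → f i ≡ f j → i ≡ j) → (∀ i → p i ≡ true → q (f i) ≡ true) → count p ≤ count q
count-injection p q f inj pres = Fin.injective⇒≤ {f = λ i → proj₁ (img i)} λ {i} {j} eq →
  nth-injective p (inj (trans (sym (proj₂ (img i))) (trans (cong (nth q) eq) (proj₂ (img j)))))
  where
  img : ∀ i → ∃[ k ] nth q k ≡ f (nth p i)
  img i = nth-surjective q (f (nth p i)) (pres _ (nth-holds p i))

sum-const : ∀ n c → sum {n} (λ _ → c) ≡ n * c
sum-const zero    c = refl
sum-const (suc n) c = cong (c +_) (sum-const n c)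

sum-*ʳ : ∀ {n} (f : Fin n → ℕ) c → sum (λ i → f i * c) ≡ sum f * c
sum-*ʳ {zero}  f c = refl
sum-*ʳ {suc n} f c =
  trans (cong (f zero * c +_) (sum-*ʳ (f ∘ suc) c)) (sym (ℕ.*-distribʳ-+ c (f zero) _))

count-≟ : ∀ {n} (j : Fin n) → count (λ i → does (j Fin.≟ i)) ≡ 1
count-≟ {suc n} zero    = cong suc (trans (sum-const n 0) (ℕ.*-zeroʳ n))
count-≟ {suc n} (suc j) = count-≟ j

count-none : ∀ {n} (p : Fin n → Bool) → (∀ i → p i ≡ false) → count p ≡ 0
count-none {n} p none =
  trans (sum-cong-≗ λ i → cong indicator (none i)) (trans (sum-const n 0) (ℕ.*-zeroʳ n))

count≤ : ∀ {n} (p : Fin n → Bool) → count p ≤ n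
count≤ p = Fin.injective⇒≤ {f = nth p} (nth-injective p)

does-true : ∀ {A : Set} (A? : Dec A) → does A? ≡ true → A
does-true (yes a) _ = a

does-false : ∀ {A : Set} (A? : Dec A) → does A? ≡ false → ¬ A
does-false (no ¬a) _ = ¬a

-- The image of `f` is a decidable subset of `Fin N`, which `nth` enumerates; a class of `S` is
-- numbered by the position of its image.
injection⇒HasSize : (S : Setoid 0ℓ 0ℓ) → let open Setoid S using (Carrier; _≈_) in
  ∀ N (f : Carrier → Fin N) → (∀ {x y} → x ≈ y → f x ≡ f y) → (∀ {x y} → f x ≡ f y → x ≈ y) →
  (∀ j → Dec (∃[ x ] f x ≡ j)) → ∃[ k ] (HasSize S k × k ≤ N)
injection⇒HasSize S N f f-cong f-inj image? = count p , inverse , count≤ p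
  where
  open Setoid S using (Carrier; _≈_)
  p : Fin N → Bool
  p j = does (image? j)
  index : ∀ x → ∃[ i ] nth p i ≡ f x
  index x = nth-surjective p (f x) (dec-true (image? (f x)) (x , refl))
  preimage : ∀ i → ∃[ x ] f x ≡ nth p i
  preimage i = does-true (image? (nth p i)) (nth-holds p i)
  index-cong : ∀ {x y} → x ≈ y → proj₁ (index x) ≡ proj₁ (index y)
  index-cong {x} {y} x≈y = nth-injective p
    (trans (proj₂ (index x)) (trans (f-cong x≈y) (sym (proj₂ (index y)))))
  inverse : HasSize S (count p)
  inverse = record
    { to        = λ x → proj₁ (index x)
    ; from      = λ i → proj₁ (preimage i)
    ; to-cong   = index-cong
    ; from-cong = λ { refl → Setoid.refl S }
    ; inverse   =
        (λ {i} {x} x≈ → nth-injective p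
          (trans (proj₂ (index x)) (trans (f-cong x≈) (proj₂ (preimage i)))))
      , (λ {x} {i} i≡ → f-inj
          (trans (proj₂ (preimage i)) (trans (cong (nth p) i≡) (proj₂ (index x)))))
    }

-- Orbits of groups of order 2 ^ m

-- By Euclid's lemma 2 divides `a` or `q`; in the second case a factor 2 is cancelled from `q` and
-- from the power.
odd-divisor-of-2^ : ∀ m a q → a * q ≡ 2 ^ m → a ≡ 1 ⊎ 2 ∣ a
odd-divisor-of-2^ zero    a q eq = inj₁ (ℕ.m*n≡1⇒m≡1 a q eq)
odd-divisor-of-2^ (suc m) a q eq
  with euclidsLemma a q prime[2] (divides (2 ^ m) (trans eq (ℕ.*-comm 2 (2 ^ m))))
... | inj₁ 2∣a = inj₂ 2∣a
... | inj₂ (divides q′ refl) = odd-divisor-of-2^ m a q′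
  (ℕ.*-cancelʳ-≡ (a * q′) (2 ^ m) 2
    (trans (ℕ.*-assoc a q′ 2) (trans eq (ℕ.*-comm 2 (2 ^ m)))))

module TwoGroupAction {m M : ℕ}
  (act : Fin (2 ^ m) → Fin M → Fin M)
  (e : Fin (2 ^ m)) (act-e : ∀ x → act e x ≡ x)
  (_∙_ : Fin (2 ^ m) → Fin (2 ^ m) → Fin (2 ^ m))
  (act-∙ : ∀ i j x → act (i ∙ j) x ≡ act i (act j x))
  (∙-cancelˡ : ∀ i {j k} → i ∙ j ≡ i ∙ k → j ≡ k)
  (inv : Fin (2 ^ m) → Fin (2 ^ m)) (act-inv : ∀ i x → act (inv i) (act i x) ≡ x)
  where

  private
    fibre : Fin M → Fin M → ℕ
    fibre x y = count (λ i → does (act i x Fin.≟ y))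

    orbit? : ∀ x y → Dec (∃[ i ] act i x ≡ y)
    orbit? x y = Fin.any? (λ i → act i x Fin.≟ y)

    orbit : Fin M → Fin M → Bool
    orbit x y = does (orbit? x y)

    -- Left multiplication by `k` injects one fibre into the other. Applied to `k` and to `inv k`,
    -- this shows that all nonempty fibres have the same size.
    fibre-mono : ∀ x y k → fibre x y ≤ fibre x (act k y)
    fibre-mono x y k = count-injection _ _ (k ∙_) (∙-cancelˡ k) λ i eq →
      dec-true (act (k ∙ i) x Fin.≟ act k y)
        (trans (act-∙ k i x) (cong (act k) (does-true (act i x Fin.≟ y) eq)))

    fibre-const : ∀ x y → fibre x y ≡ indicator (orbit x y) * fibre x x
    fibre-const x y with orbit? x y
    ... | yes (k , refl) = trans
      (ℕ.≤-antisym (subst (λ z → fibre x (act k x) ≤ fibre x z) (act-inv k x)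
                          (fibre-mono x (act k x) (inv k)))
                   (fibre-mono x x k))
      (sym (ℕ.*-identityˡ _))
    ... | no ¬o = count-none _ λ i → dec-false (act i x Fin.≟ y) (λ eq → ¬o (i , eq))

    -- Both sides count the pairs of an element `i` and a point `y` with `act i x ≡ y`; `fibre x x`
    -- is the order of the stabiliser.
    orbit-stabiliser : ∀ x → count (orbit x) * fibre x x ≡ 2 ^ m
    orbit-stabiliser x = begin
      count (orbit x) * fibre x x
        ≡⟨ sum-*ʳ {M} (λ y → indicator (orbit x y)) (fibre x x) ⟨
      sum (λ y → indicator (orbit x y) * fibre x x)
        ≡⟨ sum-cong-≗ (λ y → sym (fibre-const x y)) ⟩
      sum (λ y → sum (λ i → hits i y))
        ≡⟨ ∑-comm hits ⟨
      sum (λ i → count (λ y → does (act i x Fin.≟ y)))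
        ≡⟨ sum-cong-≗ (λ i → count-≟ (act i x)) ⟩
      sum {2 ^ m} (λ _ → 1)
        ≡⟨ sum-const (2 ^ m) 1 ⟩
      2 ^ m * 1
        ≡⟨ ℕ.*-identityʳ (2 ^ m) ⟩
      2 ^ m ∎
      where
      open ≡-Reasoning
      hits : Fin (2 ^ m) → Fin M → ℕ
      hits i y = indicator (does (act i x Fin.≟ y))

    orbit-self : ∀ x → orbit x x ≡ true
    orbit-self x = dec-true (orbit? x x) (e , act-e x)

    orbit-act : ∀ x i → orbit x (act i x) ≡ true
    orbit-act x i = dec-true (orbit? x (act i x)) (i , refl)

    singleton-orbit : ∀ x → count (orbit x) ≡ 1 → ∀ i → act i x ≡ x
    singleton-orbit x eq i
      with j , ej ← nth-surjective (orbit x) (act i x) (orbit-act x i)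
         | k , ek ← nth-surjective (orbit x) x (orbit-self x)
      = trans (sym ej) (trans (cong (nth (orbit x)) (all-equal eq j k)) ek)
      where
      all-equal : ∀ {n} → n ≡ 1 → (j k : Fin n) → j ≡ k
      all-equal refl zero zero = refl

    orbit-even : ∀ x → ¬ (∀ i → act i x ≡ x) → 2 ∣ count (orbit x)
    orbit-even x moved with odd-divisor-of-2^ m _ _ (orbit-stabiliser x)
    ... | inj₁ one  = contradiction (singleton-orbit x one) moved
    ... | inj₂ even = even

    -- Induction on the bound `n`: splitting off the orbit of a point of `p`, which is even because
    -- the point is moved, leaves a smaller invariant set.
    even-without-fixed : ∀ n (p : Fin M → Bool) → count p ≤ n →
      (∀ i x → p x ≡ true → p (act i x) ≡ true) →
      (∀ x → p x ≡ true → ¬ (∀ i → act i x ≡ x)) → 2 ∣ count p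
    even-without-fixed n p bound closed moved with count p in size
    ... | zero = 2 ∣0
    even-without-fixed (suc n) p (s≤s bound) closed moved | suc c =
      subst (2 ∣_) (trans (sym split) size)
        (∣m∣n⇒∣m+n (orbit-even x (moved x px))
          (even-without-fixed n rest rest≤ rest-closed
            (λ y ry → moved y (proj₁ (in-rest y ry)))))
      where
      x : Fin M
      x = nth p (subst Fin (sym size) zero)
      px : p x ≡ true
      px = nth-holds p _
      rest : Fin M → Bool
      rest y = p y ∧ not (orbit x y)
      orbit⊆p : ∀ y → orbit x y ≡ true → p y ≡ true
      orbit⊆p y o with k , refl ← does-true (orbit? x y) o = closed k x px
      split-at : ∀ y → indicator (p y) ≡ indicator (orbit x y) + indicator (rest y)
      split-at y with orbit x y in o | p y in q
      ... | true  | true  = refl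
      ... | true  | false = contradiction (trans (sym q) (orbit⊆p y o)) λ ()
      ... | false | true  = refl
      ... | false | false = refl
      split : count p ≡ count (orbit x) + count rest
      split = trans (sum-cong-≗ split-at)
        (∑-distrib-+ (λ y → indicator (orbit x y)) (λ y → indicator (rest y)))
      orbit≥1 : 1 ≤ count (orbit x)
      orbit≥1 = inhabited (proj₁ (nth-surjective (orbit x) x (orbit-self x)))
        where
        inhabited : ∀ {n} → Fin n → 1 ≤ n
        inhabited {suc _} _ = s≤s z≤n
      rest≤ : count rest ≤ n
      rest≤ = ℕ.≤-trans (ℕ.≤-pred (ℕ.≤-trans (ℕ.+-monoˡ-≤ (count rest) orbit≥1)
        (ℕ.≤-reflexive (trans (sym split) size)))) bound
      in-rest : ∀ y → rest y ≡ true → p y ≡ true × ¬ (∃[ i ] act i x ≡ y)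
      in-rest y ry =
          ∧-true₁ (p y) ry
        , does-false (orbit? x y) (∧-true₂ (p y) ry)
        where
        ∧-true₁ : ∀ a {b} → a ∧ b ≡ true → a ≡ true
        ∧-true₁ true _ = refl
        ∧-true₂ : ∀ a {b} → a ∧ not b ≡ true → b ≡ false
        ∧-true₂ true {false} _ = refl
      rest-closed : ∀ i y → rest y ≡ true → rest (act i y) ≡ true
      rest-closed i y ry with in-rest y ry
      ... | py , ¬o = cong₂ (λ a b → a ∧ not b) (closed i y py)
        (dec-false (orbit? x (act i y)) λ { (k , eq) →
          ¬o (inv i ∙ k , trans (act-∙ (inv i) k x) (trans (cong (act (inv i)) eq) (act-inv i y))) })

  -- The complement of `x` is invariant and of odd size, so it cannot consist of orbits of even size
  -- only.
  another-fixed-point : 2 ∣ M → ∀ x → (∀ i → act i x ≡ x) → ∃[ y ] (y ≢ x × (∀ i → act i y ≡ y))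
  another-fixed-point 2∣M x fixed
    with Fin.any? (λ y → ¬? (y Fin.≟ x) ×-dec Fin.all? (λ i → act i y Fin.≟ y))
  ... | yes found = found
  ... | no none = contradiction (∣1⇒≡1 2∣1) λ ()
    where
    other : Fin M → Bool
    other y = not (does (x Fin.≟ y))
    other⇒≢ : ∀ y → other y ≡ true → y ≢ x
    other⇒≢ y oy refl with x Fin.≟ x
    ... | yes _ = contradiction oy λ ()
    ... | no x≢x = x≢x refl
    ≢⇒other : ∀ y → y ≢ x → other y ≡ true
    ≢⇒other y y≢x = cong not (dec-false (x Fin.≟ y) (y≢x ∘ sym))
    closed : ∀ i y → other y ≡ true → other (act i y) ≡ true
    closed i y oy = ≢⇒other _ λ eq → other⇒≢ y oy
      (trans (sym (act-inv i y))
        (trans (cong (act (inv i)) (trans eq (sym (fixed i)))) (act-inv i x)))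
    2∣other : 2 ∣ count other
    2∣other = even-without-fixed M other (count≤ other) closed
      λ y oy fy → none (y , other⇒≢ y oy , fy)
    total : count other + 1 ≡ M
    total = begin
      count other + 1                             ≡⟨ cong (count other +_) (count-≟ x) ⟨
      count other + count (λ y → does (x Fin.≟ y)) ≡⟨ ∑-distrib-+ {M} _ _ ⟨
      sum (λ y → indicator (other y) + indicator (does (x Fin.≟ y)))
                                                  ≡⟨ sum-cong-≗ (λ y → one (does (x Fin.≟ y))) ⟩
      sum {M} (λ _ → 1)                           ≡⟨ sum-const M 1 ⟩
      M * 1                                       ≡⟨ ℕ.*-identityʳ M ⟩
      M                                           ∎
      where
      open ≡-Reasoning
      one : ∀ b → indicator (not b) + indicator b ≡ 1
      one true  = refl
      one false = refl
    2∣1 : 2 ∣ 1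
    2∣1 = ∣m+n∣m⇒∣n (subst (2 ∣_) (sym total) 2∣M) 2∣other

-- Colourings preserved up to complement

module Colouring {m : ℕ} {n : ℕ}
  (σ : Fin (2 ^ m) → Fin (suc (suc n)) → Fin (suc (suc n)))
  (e : Fin (2 ^ m)) (σ-e : ∀ u → σ e u ≡ u)
  (_∙_ : Fin (2 ^ m) → Fin (2 ^ m) → Fin (2 ^ m))
  (σ-∙ : ∀ i j u → σ (i ∙ j) u ≡ σ i (σ j u))
  (∙-cancelʳ : ∀ i {j k} → j ∙ i ≡ k ∙ i → j ≡ k)
  (inv : Fin (2 ^ m) → Fin (2 ^ m)) (σ-inv : ∀ i u → σ i (σ (inv i) u) ≡ u)
  where

  private
    Colour : Set
    Colour = Vec Bool (suc n)

    -- Colourings are taken up to complement: the colour of 0 is normalised to false.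
    colour : Colour → Fin (suc (suc n)) → Bool
    colour w = lookup (false ∷ w)

    -- The colouring is pulled back along `σ i` and, if necessary, complemented so that `zero` again
    -- has the colour `false`.
    shift : Fin (2 ^ m) → Colour → Colour
    shift i w = tabulate λ k → colour w (σ i (suc k)) xor colour w (σ i zero)

    colour-shift : ∀ i w u → colour (shift i w) u ≡ colour w (σ i u) xor colour w (σ i zero)
    colour-shift i w zero    = sym (Bool.xor-same (colour w (σ i zero)))
    colour-shift i w (suc k) =
      Vec.lookup∘tabulate (λ k → colour w (σ i (suc k)) xor colour w (σ i zero)) k

    colour-ext : ∀ {v w} → (∀ u → colour v u ≡ colour w u) → v ≡ w
    colour-ext {v} {w} eq = begin
      v                    ≡⟨ Vec.tabulate∘lookup v ⟨
      tabulate (lookup v)  ≡⟨ Vec.tabulate-cong (eq ∘ suc) ⟩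
      tabulate (lookup w)  ≡⟨ Vec.tabulate∘lookup w ⟩
      w                    ∎
      where open ≡-Reasoning

    xor-cancel : ∀ a b c → (a xor c) xor (b xor c) ≡ a xor b
    xor-cancel true  true  true  = refl
    xor-cancel true  true  false = refl
    xor-cancel true  false true  = refl
    xor-cancel true  false false = refl
    xor-cancel false true  true  = refl
    xor-cancel false true  false = refl
    xor-cancel false false true  = refl
    xor-cancel false false false = refl

    shift-shift : ∀ i j w u →
      colour (shift i (shift j w)) u ≡ colour w (σ j (σ i u)) xor colour w (σ j (σ i zero))
    shift-shift i j w u = trans (colour-shift i (shift j w) u)
      (trans (cong₂ _xor_ (colour-shift j w (σ i u)) (colour-shift j w (σ i zero)))
             (xor-cancel (colour w (σ j (σ i u))) _ (colour w (σ j zero))))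

    shift-∙ : ∀ i j w → shift (j ∙ i) w ≡ shift i (shift j w)
    shift-∙ i j w = colour-ext λ u → trans (colour-shift (j ∙ i) w u)
      (trans (cong₂ (λ a b → colour w a xor colour w b) (σ-∙ j i u) (σ-∙ j i zero))
             (sym (shift-shift i j w u)))

    shift-fix : ∀ i w → (∀ u → σ i u ≡ u) → shift i w ≡ w
    shift-fix i w fix = colour-ext λ u → trans (colour-shift i w u)
      (trans (cong₂ (λ a b → colour w a xor colour w b) (fix u) (fix zero))
             (Bool.xor-identityʳ (colour w u)))

    shift-inv : ∀ i w → shift (inv i) (shift i w) ≡ w
    shift-inv i w = colour-ext λ u → trans (shift-shift (inv i) i w u)
      (trans (cong₂ (λ a b → colour w a xor colour w b) (σ-inv i u) (σ-inv i zero))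
             (Bool.xor-identityʳ (colour w u)))

    enc : Colour → Fin (2 ^ suc n)
    enc = word→Fin

    dec : Fin (2 ^ suc n) → Colour
    dec = Fin→word (suc n)

    act : Fin (2 ^ m) → Fin (2 ^ suc n) → Fin (2 ^ suc n)
    act i x = enc (shift i (dec x))

    dec-act : ∀ i x → dec (act i x) ≡ shift i (dec x)
    dec-act i x = word→Fin→word (shift i (dec x))

    module A = TwoGroupAction {m} {2 ^ suc n} act
      e (λ x → trans (cong enc (shift-fix e (dec x) σ-e)) (Fin→word→Fin (suc n) x))
      -- Pulling back reverses products, so it is the opposite group that acts; its left
      -- cancellation is `∙-cancelʳ`.
      (λ i j → j ∙ i)
      (λ i j x → cong enc (trans (shift-∙ i j (dec x)) (cong (shift i) (sym (dec-act j x)))))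
      ∙-cancelʳ
      inv
      (λ i x → trans (cong enc (trans (cong (shift (inv i)) (dec-act i x)) (shift-inv i (dec x))))
                     (Fin→word→Fin (suc n) x))

    blank : Colour
    blank = replicate (suc n) false

    colour-blank : ∀ u → colour blank u ≡ false
    colour-blank zero    = refl
    colour-blank (suc k) = Vec.lookup-replicate k false

    blank-fixed : ∀ i → act i (enc blank) ≡ enc blank
    blank-fixed i = cong enc (trans (cong (shift i) (word→Fin→word blank))
      (colour-ext λ u → trans (colour-shift i blank u)
        (trans (cong₂ _xor_ (colour-blank (σ i u)) (colour-blank (σ i zero)))
               (sym (colour-blank u)))))

    nonblank : ∀ {k} (w : Vec Bool k) → w ≢ replicate k false → ∃[ j ] lookup w j ≡ true
    nonblank []          ≢ = contradiction refl ≢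
    nonblank (true  ∷ w) ≢ = zero , refl
    nonblank (false ∷ w) ≢ with j , eq ← nonblank w (≢ ∘ cong (false ∷_)) = suc j , eq

  -- The number `2 ^ suc n` of colourings up to complement is even and `blank` is fixed, so some
  -- other colouring is fixed too. Being fixed up to complement means that colour differences are
  -- preserved.
  semi-invariant-colouring : Σ[ c ∈ (Fin (suc (suc n)) → Bool) ]
    ((∃[ u ] ∃[ v ] c u ≢ c v) × (∀ i u v → c (σ i u) xor c (σ i v) ≡ c u xor c v))
  semi-invariant-colouring
    with x , x≢ , fixed ← A.another-fixed-point (divides (2 ^ n) (ℕ.*-comm 2 (2 ^ n))) (enc blank)
      blank-fixed
    with k , ck ← nonblank (dec x) (λ eq → x≢ (trans (sym (Fin→word→Fin (suc n) x)) (cong enc eq)))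
    = colour (dec x) , (zero , suc k , λ eq → contradiction (trans eq ck) λ ())
    , λ i u v → trans (sym (xor-cancel (colour (dec x) (σ i u)) _ (colour (dec x) (σ i zero))))
        (cong₂ _xor_ (step i u) (step i v))
    where
    step : ∀ i u → colour (dec x) (σ i u) xor colour (dec x) (σ i zero) ≡ colour (dec x) u
    step i u = trans (sym (colour-shift i (dec x) u))
      (cong (λ w → colour w u) (trans (sym (dec-act i x)) (cong dec (fixed i))))

-- Transitive digraphs of valency two with an arc-reversing involution

-- The common setting of both cases: `X` will consist of the vertices or of the darts of the graph.
-- Elements of `G` are compared through their action, so `encode` is injective only up to pointwise
-- equality, and `search-G` asks for predicates respecting it. Connectedness is stated as an
-- induction principle.
record System : Set₁ where
  infixr 7 _·_
  field
    X   : Set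
    G   : Set
    -- The labels of the out-neighbours are arbitrary: automorphisms need not respect them.
    out : X → Bool → X
    rev : X → X
    _·_ : G → X → X
    ε   : G
    _∙_ : G → G → G
    _⁻¹ : G → G

    out-distinct : ∀ x → out x true ≢ out x false
    rev-rev      : ∀ x → rev (rev x) ≡ x
    rev-out      : ∀ x b → ∃[ c ] out (rev (out x b)) c ≡ rev x
    connected    : ∀ {P : X → Set} → (∀ x b → P x → P (out x b)) → (∀ x → P x → P (rev x)) →
                   ∀ x y → P x → P y

    ε-act   : ∀ x → ε · x ≡ x
    ∙-act   : ∀ g h x → (g ∙ h) · x ≡ g · (h · x)
    ⁻¹-act  : ∀ g x → g ⁻¹ · (g · x) ≡ x
    act-out : ∀ g x b → ∃[ c ] g · out x b ≡ out (g · x) c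
    act-rev : ∀ g x → g · rev x ≡ rev (g · x)
    transitive : ∀ x y → ∃[ g ] g · x ≡ y

    #X          : ℕ
    index       : X → Fin #X
    index-inj   : ∀ {x y} → index x ≡ index y → x ≡ y
    #G          : ℕ
    encode      : G → Fin #G
    encode-inj  : ∀ {g h} → encode g ≡ encode h → ∀ x → g · x ≡ h · x
    search-G    : ∀ {P : G → Set} → (∀ {g h} → (∀ x → g · x ≡ h · x) → P g → P h) →
                  (∀ g → Dec (P g)) → Dec (∃ P)

-- Walks and arc-transitivity

module Arcs (S : System) where
  open System S

  infix 4 _≟_ _⟶_

  _≟_ : (x y : X) → Dec (x ≡ y)
  x ≟ y = map′ index-inj (cong index) (index x Fin.≟ index y)

  act-⁻¹ : ∀ g x → g · (g ⁻¹ · x) ≡ x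
  act-⁻¹ g x = begin
    g · (g ⁻¹ · x)                       ≡⟨ ⁻¹-act (g ⁻¹) _ ⟨
    (g ⁻¹) ⁻¹ · (g ⁻¹ · (g · (g ⁻¹ · x))) ≡⟨ cong ((g ⁻¹) ⁻¹ ·_) (⁻¹-act g _) ⟩
    (g ⁻¹) ⁻¹ · (g ⁻¹ · x)               ≡⟨ ⁻¹-act (g ⁻¹) x ⟩
    x                                    ∎
    where open ≡-Reasoning

  act-injective : ∀ g {x y} → g · x ≡ g · y → x ≡ y
  act-injective g {x} {y} eq = trans (sym (⁻¹-act g x)) (trans (cong (g ⁻¹ ·_) eq) (⁻¹-act g y))

  ⁻¹-moves : ∀ g {x y} → g · x ≡ y → g ⁻¹ · y ≡ x
  ⁻¹-moves g refl = ⁻¹-act g _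

  ∙-moves : ∀ g h {x y z} → h · x ≡ y → g · y ≡ z → (g ∙ h) · x ≡ z
  ∙-moves g h {x} refl eq = trans (∙-act g h x) eq

  out-injective : ∀ x {b c} → out x b ≡ out x c → b ≡ c
  out-injective x {true}  {true}  eq = refl
  out-injective x {true}  {false} eq = contradiction eq (out-distinct x)
  out-injective x {false} {true}  eq = contradiction (sym eq) (out-distinct x)
  out-injective x {false} {false} eq = refl

  _⟶_ : X → X → Set
  x ⟶ y = ∃[ b ] out x b ≡ y

  ⟶-act : ∀ g {x y} → x ⟶ y → (g · x) ⟶ (g · y)
  ⟶-act g {x} (b , refl) with c , eq ← act-out g x b = c , sym eq

  ⟶-rev : ∀ {x y} → x ⟶ y → rev y ⟶ rev x
  ⟶-rev {x} (b , refl) = rev-out x b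

  rev-injective : ∀ {x y} → rev x ≡ rev y → x ≡ y
  rev-injective {x} {y} eq = trans (sym (rev-rev x)) (trans (cong rev eq) (rev-rev y))

  ⟶-unrev : ∀ {x y} → rev y ⟶ rev x → x ⟶ y
  ⟶-unrev {x} {y} p = subst₂ _⟶_ (rev-rev x) (rev-rev y) (⟶-rev p)

  predecessor : ∀ x → ∃[ y ] y ⟶ x
  predecessor x = rev (out (rev x) true) , ⟶-unrev (true , sym (rev-rev _))

  two-outs : ∀ {x y z w} → x ⟶ y → x ⟶ z → x ⟶ w → y ≢ z → w ≡ y ⊎ w ≡ z
  two-outs (true  , refl) (true  , refl) _              y≢z = contradiction refl y≢z
  two-outs (false , refl) (false , refl) _              y≢z = contradiction refl y≢z
  two-outs (true  , refl) (false , refl) (true  , refl) _   = inj₁ refl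
  two-outs (true  , refl) (false , refl) (false , refl) _   = inj₂ refl
  two-outs (false , refl) (true  , refl) (true  , refl) _   = inj₂ refl
  two-outs (false , refl) (true  , refl) (false , refl) _   = inj₁ refl

  two-ins : ∀ {x y z w} → y ⟶ x → z ⟶ x → w ⟶ x → y ≢ z → w ≡ y ⊎ w ≡ z
  two-ins p q r y≢z with two-outs (⟶-rev p) (⟶-rev q) (⟶-rev r) (y≢z ∘ rev-injective)
  ... | inj₁ eq = inj₁ (rev-injective eq)
  ... | inj₂ eq = inj₂ (rev-injective eq)

  fix-sibling : ∀ g {x y z} → g · x ≡ x → x ⟶ y → x ⟶ z → g · y ≡ y → g · z ≡ z
  fix-sibling g {x} {y} {z} gx p q gy with y ≟ z
  ... | yes refl = gy
  ... | no y≢z with two-outs p q (subst (_⟶ (g · z)) gx (⟶-act g q)) y≢z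
  ... | inj₁ gz≡y = contradiction (act-injective g (trans gy (sym gz≡y))) y≢z
  ... | inj₂ gz≡z = gz≡z

  walk : ∀ {m} → X → Vec Bool m → X
  walk x []      = x
  walk x (b ∷ e) = walk (out x b) e

  walk-∷ʳ : ∀ {m} x (e : Vec Bool m) b → walk x (e ∷ʳ b) ≡ out (walk x e) b
  walk-∷ʳ x []      b = refl
  walk-∷ʳ x (c ∷ e) b = walk-∷ʳ (out x c) e b

  -- Automorphisms act on walks, but not letter by letter on their words. The action is therefore a
  -- relation between words, functional in both directions.
  data Maps (g : G) : ∀ {m} → X → Vec Bool m → X → Vec Bool m → Set where
    [_] : ∀ {x y} → g · x ≡ y → Maps g x [] y []
    _∷_ : ∀ {x y m b c} {e f : Vec Bool m} → g · x ≡ y → Maps g (out x b) e (out y c) f →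
          Maps g x (b ∷ e) y (c ∷ f)

  module _ {g : G} where
    maps-start : ∀ {m x y} {e f : Vec Bool m} → Maps g x e y f → g · x ≡ y
    maps-start [ p ]   = p
    maps-start (p ∷ _) = p

    maps-end : ∀ {m x y} {e f : Vec Bool m} → Maps g x e y f → g · walk x e ≡ walk y f
    maps-end [ p ]    = p
    maps-end (_ ∷ ps) = maps-end ps

    maps-⁻¹ : ∀ {m x y} {e f : Vec Bool m} → Maps g x e y f → Maps (g ⁻¹) y f x e
    maps-⁻¹ [ p ]    = [ ⁻¹-moves g p ]
    maps-⁻¹ (p ∷ ps) = ⁻¹-moves g p ∷ maps-⁻¹ ps

    maps-∙ : ∀ {h m x y z} {e f k : Vec Bool m} → Maps g x e y f → Maps h y f z k →
             Maps (h ∙ g) x e z k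
    maps-∙ {h} [ p ]    [ q ]    = [ ∙-moves h g p q ]
    maps-∙ {h} (p ∷ ps) (q ∷ qs) = ∙-moves h g p q ∷ maps-∙ ps qs

    maps-resp : ∀ {h m x y} {e f : Vec Bool m} → (∀ x → g · x ≡ h · x) →
                Maps g x e y f → Maps h x e y f
    maps-resp eq [ p ]    = [ trans (sym (eq _)) p ]
    maps-resp eq (p ∷ ps) = trans (sym (eq _)) p ∷ maps-resp eq ps

    maps-functional : ∀ {m x y} {e f f′ : Vec Bool m} → Maps g x e y f → Maps g x e y f′ → f ≡ f′
    maps-functional [ _ ] [ _ ] = refl
    maps-functional {y = y} (_ ∷ ps) (_ ∷ qs)
      with refl ← out-injective y (trans (sym (maps-start ps)) (maps-start qs))
      = cong (_ ∷_) (maps-functional ps qs)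

    maps-∷ʳ : ∀ {m x y b c} {e f : Vec Bool m} → Maps g x e y f →
              g · out (walk x e) b ≡ out (walk y f) c → Maps g x (e ∷ʳ b) y (f ∷ʳ c)
    maps-∷ʳ [ p ]    q = p ∷ [ q ]
    maps-∷ʳ (p ∷ ps) q = p ∷ maps-∷ʳ ps q

    maps-init : ∀ {m x y b c} (e f : Vec Bool m) → Maps g x (e ∷ʳ b) y (f ∷ʳ c) → Maps g x e y f
    maps-init []      []      (p ∷ _)  = [ p ]
    maps-init (_ ∷ e) (_ ∷ f) (p ∷ ps) = p ∷ maps-init e f ps

    maps-last : ∀ {m x y b c} (e f : Vec Bool m) → Maps g x (e ∷ʳ b) y (f ∷ʳ c) →
                g · out (walk x e) b ≡ out (walk y f) c
    maps-last []      []      (_ ∷ [ q ]) = q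
    maps-last (_ ∷ e) (_ ∷ f) (_ ∷ ps)    = maps-last e f ps

  maps-exists : ∀ g {m} {x y} (e : Vec Bool m) → g · x ≡ y → ∃[ f ] Maps g x e y f
  maps-exists g []      p = [] , [ p ]
  maps-exists g {x = x} (b ∷ e) refl
    with c , q ← act-out g x b
    with f , ps ← maps-exists g e q
    = c ∷ f , refl ∷ ps

  maps? : ∀ g {m} x (e : Vec Bool m) y f → Dec (Maps g x e y f)
  maps? g x []      y []      = map′ [_] maps-start (g · x ≟ y)
  maps? g x (b ∷ e) y (c ∷ f) =
    map′ (λ (p , ps) → p ∷ ps) (λ { (p ∷ ps) → p , ps })
         ((g · x ≟ y) ×-dec maps? g (out x b) e (out y c) f)

  Fix : ∀ {m} → G → X → Vec Bool m → Set
  Fix g x e = Maps g x e x e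

  fix-all : ∀ {g m} x (e : Vec Bool m) → (∀ y → g · y ≡ y) → Fix g x e
  fix-all x []      h = [ h x ]
  fix-all x (b ∷ e) h = h x ∷ fix-all (out x b) e h

  reverse-word : ∀ {m} → X → Vec Bool m → Vec Bool m
  reverse-word x []      = []
  reverse-word x (b ∷ e) = reverse-word (out x b) e ∷ʳ proj₁ (rev-out x b)

  walk-reverse : ∀ {m} x (e : Vec Bool m) → walk (rev (walk x e)) (reverse-word x e) ≡ rev x
  walk-reverse x []      = refl
  walk-reverse x (b ∷ e) = begin
    walk (rev (walk (out x b) e)) (reverse-word (out x b) e ∷ʳ c)
      ≡⟨ walk-∷ʳ _ (reverse-word (out x b) e) c ⟩
    out (walk (rev (walk (out x b) e)) (reverse-word (out x b) e)) c
      ≡⟨ cong (λ y → out y c) (walk-reverse (out x b) e) ⟩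
    out (rev (out x b)) c
      ≡⟨ proj₂ (rev-out x b) ⟩
    rev x ∎
    where
    open ≡-Reasoning
    c : Bool
    c = proj₁ (rev-out x b)

  act-rev-fix : ∀ g {x} → g · x ≡ x → g · rev x ≡ rev x
  act-rev-fix g {x} eq = trans (act-rev g x) (cong rev eq)

  fix-reverse : ∀ {g m} x (e : Vec Bool m) → Fix g x e → Fix g (rev (walk x e)) (reverse-word x e)
  fix-reverse {g} x []      [ p ]    = [ act-rev-fix g p ]
  fix-reverse {g} x (b ∷ e) (p ∷ ps) = maps-∷ʳ (fix-reverse (out x b) e ps)
    (subst (λ z → g · z ≡ z)
       (trans (sym (proj₂ (rev-out x b)))
              (cong (λ y → out y (proj₁ (rev-out x b))) (sym (walk-reverse (out x b) e))))
       (act-rev-fix g p))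

  ArcTransitive : ℕ → Set
  ArcTransitive t = ∀ x y (e f : Vec Bool t) → ∃[ g ] Maps g x e y f

  Semiregular : ℕ → Set
  Semiregular t = ∀ g x (e : Vec Bool t) → Fix g x e → ∀ y → g · y ≡ y

  EndsDetermine : ℕ → Set
  EndsDetermine m = ∀ x (e f : Vec Bool m) → walk x e ≡ walk x f → e ≡ f

  Twins : ℕ → Set
  Twins m = ∀ x (e : Vec Bool m) → ∃[ f ] (f ≢ e × walk x f ≡ walk x e)

  arcTransitive-0 : ArcTransitive 0
  arcTransitive-0 x y [] [] with g , p ← transitive x y = g , [ p ]

  arcTransitive-pred : ∀ {t} → ArcTransitive (suc t) → ArcTransitive t
  arcTransitive-pred AT x y e f with g , p ← AT x y (e ∷ʳ true) (f ∷ʳ true) = g , maps-init e f p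

  arcTransitive-≤ : ∀ {s t} → s ≤ t → ArcTransitive t → ArcTransitive s
  arcTransitive-≤ s≤t AT with ℕ.m≤n⇒m<n∨m≡n s≤t
  ... | inj₂ refl = AT
  arcTransitive-≤ {t = suc t} s≤t AT | inj₁ (s≤s s≤t′) =
    arcTransitive-≤ s≤t′ (arcTransitive-pred AT)

  -- The given automorphism fixes a `t`-arc and swaps the two arcs extending it. Any longer arc can
  -- be carried to one of these two and then, turning if necessary, to the one which ends with
  -- `true`.
  arcTransitive-suc : ∀ {t} → ArcTransitive t → ∀ x (e : Vec Bool t) →
    ∃[ g ] (Fix g x e × g · out (walk x e) true ≡ out (walk x e) false) → ArcTransitive (suc t)
  arcTransitive-suc {t} AT x e (s , fix , swap) y z f k = go (snoc-view f) (snoc-view k)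
    where
    swap′ : s · out (walk x e) false ≡ out (walk x e) true
    swap′ with act-out s (walk x e) false
    ... | true  , eq = trans eq (cong (λ w → out w true) (maps-end fix))
    ... | false , eq = contradiction
      (act-injective s (trans swap (sym (trans eq (cong (λ w → out w false) (maps-end fix))))))
      (out-distinct (walk x e))
    turn : ∀ b c → ∃[ g ] Maps g x (e ∷ʳ b) x (e ∷ʳ c)
    turn true  true  = ε , fix-all x (e ∷ʳ true) ε-act
    turn true  false = s , maps-∷ʳ fix swap
    turn false true  = s , maps-∷ʳ fix swap′
    turn false false = ε , fix-all x (e ∷ʳ false) ε-act
    to-base : ∀ y (f : Vec Bool t) b → ∃[ g ] Maps g y (f ∷ʳ b) x (e ∷ʳ true)
    to-base y f b with g , p ← AT y x f e with c , q ← act-out g (walk y f) b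
      with h , r ← turn c true
      = h ∙ g , maps-∙ (maps-∷ʳ p (trans q (cong (λ w → out w c) (maps-end p)))) r
    go : ∃[ u ] ∃[ b ] f ≡ u ∷ʳ b → ∃[ u ] ∃[ b ] k ≡ u ∷ʳ b → ∃[ g ] Maps g y f z k
    go (u , b , refl) (v , c , refl)
      with g , p ← to-base y u b
      with h , q ← to-base z v c
      = (h ⁻¹) ∙ g , maps-∙ p (maps-⁻¹ q)

  StabiliserFixesOuts : ℕ → Set
  StabiliserFixesOuts t =
    ∀ g x (e : Vec Bool t) → Fix g x e → ∀ b → g · out (walk x e) b ≡ out (walk x e) b

  -- If an automorphism fixes a t-arc ending at x, it fixes all walks from x,
  -- and hence, reversing one of them, also a t-arc ending at the reverse of x.
  stabiliserFixesOuts⇒semiregular : ∀ {t} → StabiliserFixesOuts t → Semiregular t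
  stabiliserFixesOuts⇒semiregular {t} SF g x e fix y =
    start (connected {Ends} (λ z b E → forward E b) backward (walk x e) y (x , e , refl , fix))
    where
    Ends : X → Set
    Ends z = ∃[ u ] ∃[ f ] (walk {t} u f ≡ z × Fix g u f)
    start : ∀ {z} → Ends z → g · z ≡ z
    start (u , f , refl , fix) = maps-end fix
    forward : ∀ {z} → Ends z → ∀ b → Ends (out z b)
    forward (u , f , refl , fix) b = tail (f ∷ʳ b) (walk-∷ʳ u f b) (maps-∷ʳ fix (SF g u f fix b))
      where
      tail : ∀ {z} (k : Vec Bool (suc t)) → walk u k ≡ z → Fix g u k → Ends z
      tail (c ∷ k) eq (_ ∷ fix) = out u c , k , eq , fix
    fixes-walks : ∀ {m z} → Ends z → (k : Vec Bool m) → Fix g z k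
    fixes-walks E []      = [ start E ]
    fixes-walks E (b ∷ k) = start E ∷ fixes-walks (forward E b) k
    backward : ∀ z → Ends z → Ends (rev z)
    backward z E = rev (walk z k) , reverse-word z k , walk-reverse z k ,
      fix-reverse z k (fixes-walks E k)
      where
      k : Vec Bool t
      k = replicate t true

  -- Starting from 0, `t` is raised as long as some automorphism fixing a base `t`-arc swaps the
  -- out-neighbours of its end. The fuel `d` runs out at `t = #G` at the latest, where
  -- arc-transitivity would provide `2 ^ #G` different elements.
  arcRegular : X → ∃[ t ] (ArcTransitive t × Semiregular t)
  arcRegular x₀ = go #G 0 (ℕ.+-identityʳ #G) arcTransitive-0
    where
    bound : ¬ ArcTransitive #G
    bound AT = contradiction (Fin.injective⇒≤ {f = code} code-inj) (ℕ.<⇒≱ (n<2^n #G))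
      where
      base : Vec Bool #G
      base = replicate #G true
      elt : Vec Bool #G → G
      elt e = proj₁ (AT x₀ x₀ base e)
      code : Fin (2 ^ #G) → Fin #G
      code i = encode (elt (Fin→word #G i))
      code-inj : ∀ {i j} → code i ≡ code j → i ≡ j
      code-inj {i} {j} eq = Fin→word-injective (maps-functional
        (maps-resp (encode-inj eq) (proj₂ (AT x₀ x₀ base (Fin→word #G i))))
        (proj₂ (AT x₀ x₀ base (Fin→word #G j))))
    go : ∀ d t → d + t ≡ #G → ArcTransitive t → ∃[ t ] (ArcTransitive t × Semiregular t)
    go d t eq AT
      with search-G {λ g → Fix g x₀ e₀ × g · out z₀ true ≡ out z₀ false}
             (λ eq (p , q) → maps-resp eq p , trans (sym (eq _)) q)
             (λ g → maps? g x₀ e₀ x₀ e₀ ×-dec (g · out z₀ true ≟ out z₀ false))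
      where
      e₀ : Vec Bool t
      e₀ = replicate t true
      z₀ : X
      z₀ = walk x₀ e₀
    go zero    t refl AT | yes s = contradiction AT bound
    go (suc d) t eq   AT | yes s =
      go d (suc t) (trans (ℕ.+-suc d t) eq) (arcTransitive-suc AT x₀ _ s)
    ... | no ¬s = t , AT , stabiliserFixesOuts⇒semiregular fixes
      where
      e₀ : Vec Bool t
      e₀ = replicate t true
      z₀ : X
      z₀ = walk x₀ e₀
      fixes₀ : ∀ g → Fix g x₀ e₀ → ∀ b → g · out z₀ b ≡ out z₀ b
      fixes₀ g fix b = fix-sibling g (maps-end fix) (true , refl) (b , refl) fixes-true
        where
        fixes-true : g · out z₀ true ≡ out z₀ true
        fixes-true with act-out g z₀ true
        ... | true  , eq = trans eq (cong (λ w → out w true) (maps-end fix))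
        ... | false , eq =
          contradiction (g , fix , trans eq (cong (λ w → out w false) (maps-end fix))) ¬s
      -- Any `t`-arc is carried to the base arc by some `h`, and its stabiliser by conjugation with
      -- `h`.
      fixes : StabiliserFixesOuts t
      fixes g x e fix b with h , p ← AT x x₀ e e₀ with c , q ← act-out h (walk x e) b =
        act-injective h (trans (sym conj) (trans back (sym q′)))
        where
        q′ : h · out (walk x e) b ≡ out z₀ c
        q′ = trans q (cong (λ w → out w c) (maps-end p))
        k : G
        k = h ∙ (g ∙ (h ⁻¹))
        fix′ : Fix k x₀ e₀
        fix′ = maps-∙ (maps-∙ (maps-⁻¹ p) fix) p
        back : k · out z₀ c ≡ out z₀ c
        back = fixes₀ k fix′ c
        conj : k · out z₀ c ≡ h · (g · out (walk x e) b)
        conj = trans (∙-act h _ _) (cong (h ·_)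
          (trans (∙-act g _ _) (cong (g ·_) (⁻¹-moves h q′))))

-- Reachability by walks of given length, and layers

module Reachability (S : System) where
  open System S
  open Arcs S

  R : ℕ → X → X → Set
  R m x y = ∃[ e ] walk {m} x e ≡ y

  R-cons : ∀ {m x y z} → x ⟶ y → R m y z → R (suc m) x z
  R-cons (b , refl) (e , eq) = b ∷ e , eq

  R-uncons : ∀ {m x z} → R (suc m) x z → ∃[ y ] (x ⟶ y × R m y z)
  R-uncons (b ∷ e , eq) = _ , (b , refl) , e , eq

  R-snoc : ∀ {m x y z} → R m x y → y ⟶ z → R (suc m) x z
  R-snoc {x = x} (e , refl) (b , refl) = e ∷ʳ b , walk-∷ʳ x e b

  R-unsnoc : ∀ {m x z} → R (suc m) x z → ∃[ y ] (R m x y × y ⟶ z)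
  R-unsnoc {zero}  {x} (b ∷ [] , eq)     = x , ([] , refl) , b , eq
  R-unsnoc {suc m} {x} (b ∷ e , eq) with y , (f , eq′) , p ← R-unsnoc (e , eq) =
    y , (b ∷ f , eq′) , p

  R-trans : ∀ {j m x y z} → R j x y → R m y z → R (j + m) x z
  R-trans ([]    , refl) q = q
  R-trans (b ∷ e , eq)   q = R-cons (b , refl) (R-trans (e , eq) q)

  R-split : ∀ j {m x z} → R (j + m) x z → ∃[ y ] (R j x y × R m y z)
  R-split zero    {x = x} p = x , ([] , refl) , p
  R-split (suc j) p with y , s , q ← R-uncons p with z , q₁ , q₂ ← R-split j q =
    z , R-cons s q₁ , q₂

  R-act : ∀ g {m x y} → R m x y → R m (g · x) (g · y)
  R-act g (e , refl) with f , p ← maps-exists g e refl = f , sym (maps-end p)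

  R-rev : ∀ {m x y} → R m x y → R m (rev y) (rev x)
  R-rev {x = x} (e , refl) = reverse-word x e , walk-reverse x e

  R-unrev : ∀ {m x y} → R m (rev y) (rev x) → R m x y
  R-unrev {m} {x} {y} p = subst₂ (R m) (rev-rev x) (rev-rev y) (R-rev p)

  R? : ∀ m x y → Dec (R m x y)
  R? m x y = search-Vec search-Bool m (λ e → walk x e ≟ y)

  ancestor : ∀ m x → ∃[ p ] R m p x
  ancestor m x = rev (walk (rev x) e) , R-unrev (e , sym (rev-rev _))
    where
    e : Vec Bool m
    e = replicate m true

  descendant : ∀ m x → ∃[ p ] R m x p
  descendant m x = walk x (replicate m true) , replicate m true , refl

-- In the Praeger–Xu digraph with parameters r and s, walks of length s are determined by their
-- ends, and walks of length s + 1 come in pairs with the same ends.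
module Layers (S : System) (s′ t : ℕ) (s<t : suc s′ < t) (AT : Arcs.ArcTransitive S t)
  (unique : Arcs.EndsDetermine S (suc s′)) (twin : Arcs.Twins S (suc (suc s′))) where

  open System S
  open Arcs S
  open Reachability S public

  s : ℕ
  s = suc s′

  s≤t : s ≤ t
  s≤t = ℕ.<⇒≤ s<t

  -- A twin of the walk from `v` through `u` to `w` enters `w` by another vertex, since walks of
  -- length `s` are determined by their ends. As `w` has only two in-neighbours, both are reached
  -- from `v`.
  R-closed-siblings : ∀ {v u w y} → R s v u → u ⟶ w → y ⟶ w → R s v y
  R-closed-siblings {v} {w = w} {y} (e , refl) (b , refl) y⟶w
    with f , f≢ , eq ← twin v (e ∷ʳ b)
    with f′ , c , refl ← snoc-view f
    with two-ins (b , refl) (c , trans (sym (walk-∷ʳ v f′ c)) (trans eq (walk-∷ʳ v e b))) y⟶w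
      distinct
    where
    distinct : walk v e ≢ walk v f′
    distinct eq′ with refl ← unique v e f′ eq′ =
      f≢ (cong (e ∷ʳ_) (out-injective (walk v e)
        (trans (sym (walk-∷ʳ v e c)) (trans eq (walk-∷ʳ v e b)))))
  ... | inj₁ refl = e , refl
  ... | inj₂ refl = f′ , refl

  R-closed-siblings⁺ : ∀ j {v u w y} → R (j + s) v u → u ⟶ w → y ⟶ w → R (j + s) v y
  R-closed-siblings⁺ zero    p q r = R-closed-siblings p q r
  R-closed-siblings⁺ (suc j) p q r with x , a , p′ ← R-uncons p =
    R-cons a (R-closed-siblings⁺ j p′ q r)

  -- Both walks to `w` are retraced one arc at a time; `R-closed-siblings⁺` keeps the vertices of
  -- the second within reach of `p`.
  R-ancestor : ∀ j {p y w} → R (j + s) p w → R j y w → R s p y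
  R-ancestor zero    p ([] , refl) = p
  R-ancestor (suc j) p q
    with u , p′ , a ← R-unsnoc p
       | y , q′ , b ← R-unsnoc q
    = R-ancestor j (R-closed-siblings⁺ j p′ a b) q′

  -- The 2^s ancestors of w at distance s are all among the 2^s descendants
  -- of p at distance s, so the two sets coincide.
  R-link : ∀ {p u w} → R s p u → R (s + s) p w → R s u w
  R-link {p} {u} {w} (e , refl) q = link (injective⇒surjective-word label label-inj e)
    where
    labelled : ∀ i → R s p (rev (walk (rev w) i))
    labelled i = R-ancestor s q (R-unrev (i , sym (rev-rev _)))
    label : Vec Bool s → Vec Bool s
    label i = proj₁ (labelled i)
    label-inj : ∀ {i j} → label i ≡ label j → i ≡ j
    label-inj {i} {j} eq = unique (rev w) i j (rev-injective
      (trans (sym (proj₂ (labelled i))) (trans (cong (walk p) eq) (proj₂ (labelled j)))))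
    link : ∃[ i ] label i ≡ e → R s (walk p e) w
    link (i , eq) = R-unrev (i , trans (sym (rev-rev _))
      (cong rev (trans (sym (proj₂ (labelled i))) (cong (walk p) eq))))

  -- An ancestor `v` of `u′` at distance `s` reaches `w` and `w′` in `s + s` steps. By `R-ancestor`
  -- it reaches `u` in `s` steps, and `R-link` joins `u` to `w′`. This is what makes `Lay`
  -- transitive.
  R-rectangle : ∀ {u u′ w w′} → R s u′ w → R s u′ w′ → R s u w → R s u w′
  R-rectangle {u′ = u′} p q r with v , a ← ancestor s u′ =
    R-link (R-ancestor s (R-trans a p) r) (R-trans a q)

  -- In the Praeger–Xu digraph, Lay u v holds when u and v agree in ℤ/rℤ.
  Lay : X → X → Set
  Lay u v = ∃[ w ] (R s u w × R s v w)

  Lay-refl : ∀ {u} → Lay u u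
  Lay-refl {u} with w , p ← descendant s u = w , p , p

  Lay-sym : ∀ {u v} → Lay u v → Lay v u
  Lay-sym (w , p , q) = w , q , p

  Lay-desc : ∀ {u v w} → Lay u v → R s u w → R s v w
  Lay-desc (z , p , q) r = R-rectangle p r q

  Lay-trans : ∀ {u v w} → Lay u v → Lay v w → Lay u w
  Lay-trans l (z , p , q) = z , Lay-desc (Lay-sym l) p , q

  common-ancestor⇒Lay : ∀ {p u v} → R s p u → R s p v → Lay u v
  common-ancestor⇒Lay {p} {u} a b with w , c ← descendant s u = w , c , R-link b (R-trans a c)

  Lay-anc : ∀ {p u v} → Lay u v → R s p u → R s p v
  Lay-anc (w , a , b) p = R-ancestor s (R-trans p a) b

  Lay⇒common-ancestor : ∀ {u v} → Lay u v → ∃[ p ] (R s p u × R s p v)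
  Lay⇒common-ancestor {u} l with p , a ← ancestor s u = p , a , Lay-anc l a

  Lay-rev : ∀ {u v} → Lay u v → Lay (rev u) (rev v)
  Lay-rev l with p , a , b ← Lay⇒common-ancestor l = rev p , R-rev a , R-rev b

  Lay-act : ∀ g {u v} → Lay u v → Lay (g · u) (g · v)
  Lay-act g (w , a , b) = g · w , R-act g a , R-act g b

  Lay? : ∀ u v → Dec (Lay u v)
  Lay? u v with w , p ← descendant s u =
    map′ (λ q → w , p , q) (λ l → Lay-desc l p) (R? s v w)

  -- Twins start with different letters, as otherwise their tails would be different walks of length
  -- `s` with the same ends. So `z` is reached through either out-neighbour of `x`.
  R-any-first : ∀ {x y z} → x ⟶ y → R (suc s) x z → R s y z
  R-any-first {x} (b , refl) (c ∷ e , eq) with c Bool.≟ b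
  ... | yes refl = e , eq
  ... | no c≢b with twin x (c ∷ e)
  ... | d ∷ f , f≢ , eq′ with d Bool.≟ b
  ... | yes refl = f , trans eq′ eq
  ... | no d≢b with refl ← trans (Bool.¬-not d≢b) (sym (Bool.¬-not c≢b))
    = contradiction (cong (d ∷_) (unique (out x d) f e eq′)) f≢

  Lay-out : ∀ {x y u v} → Lay x y → x ⟶ u → y ⟶ v → Lay u v
  Lay-out l p q
    with z , r ← descendant s _
    with y , r₁ , r₂ ← R-unsnoc (R-cons p r)
    = z , r , R-any-first q (R-snoc (Lay-desc l r₁) r₂)

  Lay-in : ∀ {x y u v} → Lay u v → x ⟶ u → y ⟶ v → Lay x y
  Lay-in {x} {y} l p q = subst₂ Lay (rev-rev x) (rev-rev y)
    (Lay-rev (Lay-out (Lay-rev l) (⟶-rev p) (⟶-rev q)))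

  Lay-walk : ∀ m {x y u v} → Lay x y → R m x u → R m y v → Lay u v
  Lay-walk zero    l ([] , refl)    ([] , refl)    = l
  Lay-walk (suc m) l (b ∷ e , eq)   (c ∷ f , eq′)  =
    Lay-walk m (Lay-out l (b , refl) (c , refl)) (e , eq) (f , eq′)

  layer-transitive : ∀ {u v} → Lay u v → ∃[ g ] g · u ≡ v
  layer-transitive l with p , (e , refl) , (f , refl) ← Lay⇒common-ancestor l
    with g , maps ← arcTransitive-≤ s≤t AT p p e f = g , maps-end maps

  fix-ends⇒Fix : ∀ g x (e : Vec Bool s) → g · x ≡ x → g · walk x e ≡ walk x e → Fix g x e
  fix-ends⇒Fix g x e gx ge with f , p ← maps-exists g e gx
    with refl ← unique x f e (trans (sym (maps-end p)) ge) = p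

  module Cycle (a₀ : X) where

    a : ℕ → X
    a zero    = a₀
    a (suc i) = out (a i) true

    a-step : ∀ i → a i ⟶ a (suc i)
    a-step i = true , refl

    R-a : ∀ m k → R m (a k) (a (m + k))
    R-a zero    k = [] , refl
    R-a (suc m) k = R-snoc (R-a m k) (a-step (m + k))

    walk-a : ∀ m k → walk (a k) (replicate m true) ≡ a (m + k)
    walk-a zero    k = refl
    walk-a (suc m) k = trans (walk-a m (suc k)) (cong a (ℕ.+-suc m k))

    fixed-a : ∀ {g} m k → Fix g (a k) (replicate m true) → ∀ i → i ≤ m → g · a (i + k) ≡ a (i + k)
    fixed-a m k fix zero _ = maps-start fix
    fixed-a {g} (suc m) k (_ ∷ fix) (suc i) (s≤s i≤m) =
      subst (λ j → g · a j ≡ a j) (ℕ.+-suc i k) (fixed-a m (suc k) fix i i≤m)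

    Lay-cancel : ∀ i {j k} → Lay (a (i + j)) (a (i + k)) → Lay (a j) (a k)
    Lay-cancel zero    l = l
    Lay-cancel (suc i) {j} {k} l = Lay-cancel i {j} {k} (Lay-in l (a-step (i + j)) (a-step (i + k)))

    <⇒+suc : ∀ {i j} → i < j → ∃[ d ] i + suc d ≡ j
    <⇒+suc {i} {j} i<j = j ∸ suc i , trans (ℕ.+-suc i _) (ℕ.m+[n∸m]≡n i<j)

    Lay-difference : ∀ {i j} → i < j → Lay (a i) (a j) →
      ∃[ d ] (i + suc d ≡ j × Lay (a 0) (a (suc d)))
    Lay-difference {i} i<j l with d , refl ← <⇒+suc i<j =
      d , refl , Lay-cancel i (subst (λ k → Lay (a k) (a (i + suc d))) (sym (ℕ.+-identityʳ i)) l)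

    abstract
      recurrence : ∃[ d ] Lay (a 0) (a (suc d))
      recurrence
        with i , j , i<j , eq ← Fin.pigeonhole (ℕ.n<1+n #X) (λ i → index (a (toℕ i)))
        with d , _ , l ← Lay-difference i<j (subst (Lay (a (toℕ i))) (index-inj eq) Lay-refl)
        = d , l

      minimal : ∃[ d ] (Lay (a 0) (a (suc d)) × (∀ k → k < d → ¬ Lay (a 0) (a (suc k))))
      minimal = least (λ d → Lay? (a 0) (a (suc d))) (proj₁ recurrence) (proj₂ recurrence)

    -- The least period of the layers along the ray; `minimal` yields its predecessor, which makes
    -- the period positive.
    r′ r : ℕ
    r′ = proj₁ minimal
    r  = suc r′

    Lay-period : Lay (a 0) (a r)
    Lay-period = proj₁ (proj₂ minimal)

    below-period : ∀ {k} → k < r′ → ¬ Lay (a 0) (a (suc k))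
    below-period {k} = proj₂ (proj₂ minimal) k

    Lay-a-unique : ∀ {i j} → i < r → j < r → Lay (a i) (a j) → i ≡ j
    Lay-a-unique {i} {j} i<r j<r l with ℕ.<-cmp i j
    ... | tri≈ _ eq _ = eq
    ... | tri< i<j _ _ with d , refl , l₀ ← Lay-difference i<j l =
      contradiction l₀ (below-period (ℕ.≤-pred (ℕ.≤-trans (s≤s (ℕ.m≤n+m (suc d) i)) j<r)))
    ... | tri> _ _ j<i with d , refl , l₀ ← Lay-difference j<i (Lay-sym l) =
      contradiction l₀ (below-period (ℕ.≤-pred (ℕ.≤-trans (s≤s (ℕ.m≤n+m (suc d) j)) i<r)))

    Lay-sucMod : ∀ (j : Fin r) {x y} → Lay (a (toℕ j)) x → x ⟶ y → Lay (a (toℕ (sucMod j))) y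
    Lay-sucMod j {x} {y} l p =
      subst (λ k → Lay (a k) y) (sym (Fin.toℕ-fromℕ< (m%n<n (suc (toℕ j)) r)))
                           (go (ℕ.m≤n⇒m<n∨m≡n (Fin.toℕ<n j)))
      where
      l′ : Lay (a (suc (toℕ j))) y
      l′ = Lay-out l (a-step (toℕ j)) p
      go : suc (toℕ j) < r ⊎ suc (toℕ j) ≡ r → Lay (a (suc (toℕ j) % r)) y
      go (inj₁ <r) = subst (λ k → Lay (a k) y) (sym (m<n⇒m%n≡m <r)) l′
      go (inj₂ eq) = subst (λ k → Lay (a (k % r)) y) (sym eq)
        (subst (λ k → Lay (a k) y) (sym (n%n≡0 r))
          (Lay-trans Lay-period (subst (λ k → Lay (a k) y) eq l′)))

    layer-of-a : ∀ i → ∃[ j ] Lay (a (toℕ {r} j)) (a i)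
    layer-of-a zero    = zero , Lay-refl
    layer-of-a (suc i) with j , l ← layer-of-a i = sucMod j , Lay-sucMod j l (a-step i)

    -- One of the two halves of the digraph: the union of the layers met by the ray.
    Component : X → Set
    Component x = ∃[ i ] Lay (a i) x

    layer : ∀ {x} → Component x → ∃[ j ] Lay (a (toℕ {r} j)) x
    layer (i , l) with j , l′ ← layer-of-a i = j , Lay-trans l′ l

    component-Lay : ∀ {x y} → Component x → Lay x y → Component y
    component-Lay (i , l) l′ = i , Lay-trans l l′

    component-out : ∀ {x y} → x ⟶ y → Component x → Component y
    component-out p (i , l) = suc i , Lay-out l (a-step i) p

    component-in : ∀ {x y} → x ⟶ y → Component y → Component x
    -- By periodicity, the layer before that of `a 0` is that of `a r′`.
    component-in p (zero  , l) = r′ , Lay-in (Lay-trans (Lay-sym Lay-period) l) (a-step r′) p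
    component-in p (suc i , l) = i , Lay-in l (a-step i) p

    component-total : ∀ x → Component x ⊎ Component (rev x)
    component-total x =
      connected {λ x → Component x ⊎ Component (rev x)} step turn a₀ x (inj₁ (0 , Lay-refl))
      where
      step : ∀ x b → Component x ⊎ Component (rev x) → Component (out x b) ⊎
        Component (rev (out x b))
      step x b (inj₁ c) = inj₁ (component-out (b , refl) c)
      step x b (inj₂ c) = inj₂ (component-in (⟶-rev (b , refl)) c)
      turn : ∀ x → Component x ⊎ Component (rev x) → Component (rev x) ⊎ Component (rev (rev x))
      turn x (inj₁ c) = inj₂ (subst Component (sym (rev-rev x)) c)
      turn x (inj₂ c) = inj₁ c

    -- A nontrivial automorphism fixing a₀, …, a_{t-1} fixes a vertex in each of the first t
    -- layers.  If these were all the layers, it would fix the s-walk from a_{t-1} to a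
    -- fixed vertex, hence both out-neighbours of a_{t-1}.
    t<r : t < r
    t<r = ℕ.≰⇒> λ r≤t → go t s<t AT r≤t
      where
      go : ∀ t → s < t → ArcTransitive t → ¬ r ≤ t
      go (suc k) _ AT r≤t
        with g , maps ← AT (a 0) (a 0) (replicate k true ∷ʳ true) (replicate k true ∷ʳ false)
        with j , l ← layer-of-a (s + k)
        = out-distinct (a k) (trans (sym fixed-true) swap)
        where
        fixed : ∀ i → i ≤ k → g · a i ≡ a i
        fixed i i≤k = subst (λ j → g · a j ≡ a j) (ℕ.+-identityʳ i)
          (fixed-a k 0 (maps-init (replicate k true) (replicate k true) maps) i i≤k)
        swap : g · out (a k) true ≡ out (a k) false
        swap = subst (λ z → g · out z true ≡ out z false)
          (trans (walk-a k 0) (cong a (ℕ.+-identityʳ k)))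
          (maps-last (replicate k true) (replicate k true) maps)
        fixed-walk : ∃[ e ] Fix g (a k) e
        fixed-walk with e , eq ← Lay-anc (Lay-sym l) (R-a s k) = e ,
          fix-ends⇒Fix g (a k) e (fixed k ℕ.≤-refl)
            (subst (λ z → g · z ≡ z) (sym eq)
              (fixed (toℕ j) (ℕ.≤-pred (ℕ.≤-trans (Fin.toℕ<n j) r≤t))))
        fixed-true : g · out (a k) true ≡ out (a k) true
        fixed-true with b ∷ e , _ ∷ fix ← fixed-walk =
          fix-sibling g (fixed k ℕ.≤-refl) (b , refl) (true , refl) (maps-start fix)

    s+2≤r : suc (suc s) ≤ r
    s+2≤r = ℕ.≤-trans (s≤s s<t) t<r

    -- An automorphism taking a₀ to a₁ moves every layer of the component to the next one, while
    -- the reverse of a₁ comes just before the reverse of a₀.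
    rev-a₀∉ : ¬ Component (rev (a 0))
    rev-a₀∉ (m , l) with g , eq ← transitive (a 0) (a 1) =
      below-period (ℕ.≤-pred (ℕ.≤-trans (s≤s (s≤s (s≤s z≤n))) s+2≤r))
        (Lay-cancel m (subst₂ (λ i j → Lay (a i) (a j)) (sym (ℕ.+-identityʳ m)) (ℕ.+-comm 2 m)
          (Lay-trans l (Lay-sym l₂))))
      where
      R₁ : R m (a 1) (g · a m)
      R₁ = subst₂ (λ y j → R m y (g · a j)) eq (ℕ.+-identityʳ m) (R-act g (R-a m 0))
      l₁ : Lay (a (suc m)) (rev (a 1))
      l₁ = Lay-trans
        (Lay-walk m Lay-refl (subst (R m (a 1)) (cong a (ℕ.+-comm m 1)) (R-a m 1)) R₁)
        (subst (Lay (g · a m)) (trans (act-rev g (a 0)) (cong rev eq)) (Lay-act g l))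
      l₂ : Lay (a (suc (suc m))) (rev (a 0))
      l₂ = Lay-out l₁ (a-step (suc m)) (⟶-rev (a-step 0))

    -- Reversed arcs lead from `rev (a (suc i))` to `rev (a i)`, so membership in the component
    -- descends to `rev (a 0)`.
    component-disjoint : ∀ {x} → Component x → ¬ Component (rev x)
    component-disjoint (i , l) c = rev-a₀∉ (back i (component-Lay c (Lay-rev (Lay-sym l))))
      where
      back : ∀ i → Component (rev (a i)) → Component (rev (a 0))
      back zero    c = c
      back (suc i) c = back i (component-out (⟶-rev (a-step i)) c)

-- Colourings of layers and rigidity

abstract
  -- The size is exhibited as `suc (suc n)` because `Colouring` is about sets with at least two
  -- points.
  enumerate-words : ∀ k → ∃[ n ] Σ[ v ∈ (Fin (suc (suc n)) → Vec Bool (suc k)) ]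
    (∀ {i j : Fin (suc (suc n))} → v i ≡ v j → i ≡ j) × (∀ (e : Vec Bool (suc k)) → ∃[ i ] v i ≡ e)
  enumerate-words k = 2 ^ suc k ∸ 2 , subst Enumeration (sym (ℕ.m+[n∸m]≡n 2≤)) enumeration
    where
    Enumeration : ℕ → Set
    Enumeration n =
      Σ[ v ∈ (Fin n → Vec Bool (suc k)) ]
        (∀ {i j : Fin n} → v i ≡ v j → i ≡ j) × (∀ (e : Vec Bool (suc k)) → ∃[ i ] v i ≡ e)
    enumeration : Enumeration (2 ^ suc k)
    enumeration = Fin→word (suc k) , Fin→word-injective , λ e → word→Fin e , word→Fin→word e
    2≤ : 2 ≤ 2 ^ suc k
    2≤ = ℕ.≤-trans (s≤s (s≤s z≤n)) (n<2^n (suc k))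

xor-≡ : ∀ {a b} → a xor b ≡ false → a ≡ b
xor-≡ {true}  {true}  _ = refl
xor-≡ {false} {false} _ = refl

≡-xor : ∀ {a b} → a ≡ b → a xor b ≡ false
≡-xor {a} refl = Bool.xor-same a

module Rigidity (S : System) (s′ t : ℕ) (s<t : suc s′ < t)
  (AT : Arcs.ArcTransitive S t) (reg : Arcs.Semiregular S t)
  (unique : Arcs.EndsDetermine S (suc s′)) (twin : Arcs.Twins S (suc (suc s′))) where

  open System S
  open Arcs S
  open Layers S s′ t s<t AT unique twin public

  SemiInvariant : X → (X → Bool) → Set
  SemiInvariant v c = ∀ g → Lay v (g · v) → ∀ {u w} → Lay v u → Lay v w →
    c (g · u) xor c (g · w) ≡ c u xor c w

  Lay-preserve : ∀ g {u v} → Lay u (g · u) → Lay v u → Lay v (g · v)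
  Lay-preserve g l k = Lay-trans k (Lay-trans l (Lay-act g (Lay-sym k)))

  -- The automorphisms preserving the layer of v₀ correspond to the images of a t-arc starting
  -- at v₀, so there are 2^(s+t) of them.
  module LayerGroup (p : X) where
    private
      base : Vec Bool t
      base = replicate t true

      v₀ : X
      v₀ = walk p (replicate s true)

      R-v₀ : R s p v₀
      R-v₀ = replicate s true , refl

      abstract
        -- The first `s` letters prescribe the image of `v₀` in its layer, the remaining `t` the
        -- image of the arc from there.
        element : ∀ (w : Vec Bool (s + t)) →
          ∃[ g ] ∃[ e ] ∃[ f ] (w ≡ e ++ f × Maps g v₀ base (walk p e) f)
        element w with e , f , eq ← splitAt s w with g , maps ← AT v₀ (walk p e) base f =
          g , e , f , eq , maps

      el : Fin (2 ^ (s + t)) → G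
      el i = proj₁ (element (Fin→word (s + t) i))

      el-maps : ∀ i → ∃[ e ] ∃[ f ] (Fin→word (s + t) i ≡ e ++ f × Maps (el i) v₀ base (walk p e) f)
      el-maps i = proj₂ (element (Fin→word (s + t) i))

      el-preserves : ∀ i {u} → R s p u → R s p (el i · u)
      el-preserves i {u} r with e , f , _ , maps ← el-maps i =
        Lay-anc (Lay-trans (common-ancestor⇒Lay (e , sym (maps-start maps))
                                                (e , sym (maps-start maps)))
                           (Lay-act (el i) (common-ancestor⇒Lay R-v₀ r)))
                (e , sym (maps-start maps))

      el-injective : ∀ {i j} → (∀ x → el i · x ≡ el j · x) → i ≡ j
      el-injective {i} {j} eq = Fin→word-injective {s + t}
        (same (el-maps i) (el-maps j) eq)
        where
        same : ∀ {v w g h} →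
          ∃[ e ] ∃[ f ] (v ≡ e ++ f × Maps g v₀ base (walk p e) f) →
          ∃[ e ] ∃[ f ] (w ≡ e ++ f × Maps h v₀ base (walk p e) f) →
          (∀ x → g · x ≡ h · x) → v ≡ w
        same (e , f , refl , m) (e′ , f′ , refl , m′) eq
          with refl ← unique p e e′ (trans (sym (maps-start m)) (trans (eq v₀) (maps-start m′)))
          = cong (e ++_) (maps-functional (maps-resp eq m) m′)

      code : ∀ g → R s p (g · v₀) → ∃[ i ] (∀ x → el i · x ≡ g · x)
      code g (e , eq) with f , m ← maps-exists g base (sym eq) =
        word→Fin (e ++ f) , agree
          (subst (Element (el (word→Fin (e ++ f)))) (word→Fin→word (e ++ f))
            (el-maps (word→Fin (e ++ f))))
        where
        Element : G → Vec Bool (s + t) → Set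
        Element h w = ∃[ e ] ∃[ f ] (w ≡ e ++ f × Maps h v₀ base (walk p e) f)
        agree : ∀ {h} → Element h (e ++ f) → ∀ x → h · x ≡ g · x
        agree {h} (e′ , f′ , eq′ , m′) x
          with refl , refl ← Vec.++-injective e e′ eq′
          = act-injective (g ⁻¹) (trans (sym (∙-act (g ⁻¹) h x))
              (trans (reg ((g ⁻¹) ∙ h) v₀ base (maps-∙ m′ (maps-⁻¹ m)) x) (sym (⁻¹-act g x))))

      words : ∃[ n ] Σ[ v ∈ (Fin (suc (suc n)) → Vec Bool s) ]
        (∀ {i j : Fin (suc (suc n))} → v i ≡ v j → i ≡ j) × (∀ (e : Vec Bool s) → ∃[ i ] v i ≡ e)
      words = enumerate-words s′

      N : ℕ
      N = suc (suc (proj₁ words))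

      vert : Fin N → X
      vert j = walk p (proj₁ (proj₂ words) j)

      R-vert : ∀ j → R s p (vert j)
      R-vert j = proj₁ (proj₂ words) j , refl

      vert-injective : ∀ {i j} → vert i ≡ vert j → i ≡ j
      vert-injective {i} {j} eq = proj₁ (proj₂ (proj₂ words))
        (unique p (proj₁ (proj₂ words) i) (proj₁ (proj₂ words) j) eq)

      vert-surjective : ∀ {u} → R s p u → ∃[ j ] vert j ≡ u
      vert-surjective (e , refl) with j , eq ← proj₂ (proj₂ (proj₂ words)) e = j , cong (walk p) eq

      σ : Fin (2 ^ (s + t)) → Fin N → Fin N
      σ i j = proj₁ (vert-surjective (el-preserves i (R-vert j)))

      vert-σ : ∀ i j → vert (σ i j) ≡ el i · vert j
      vert-σ i j = proj₂ (vert-surjective (el-preserves i (R-vert j)))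

      unit : ∃[ i ] (∀ x → el i · x ≡ ε · x)
      unit = code ε (subst (R s p) (sym (ε-act v₀)) R-v₀)

      product : ∀ i j → ∃[ k ] (∀ x → el k · x ≡ (el i ∙ el j) · x)
      product i j = code (el i ∙ el j)
        (subst (R s p) (sym (∙-act _ _ v₀)) (el-preserves i (el-preserves j R-v₀)))

      inverse : ∀ i → ∃[ k ] (∀ x → el k · x ≡ (el i ⁻¹) · x)
      inverse i = code (el i ⁻¹) (Lay-anc
        (Lay-preserve (el i ⁻¹) (subst (Lay (el i · v₀)) (sym (⁻¹-act (el i) v₀)) (Lay-sym l)) l)
          R-v₀)
        where
        l : Lay v₀ (el i · v₀)
        l = common-ancestor⇒Lay R-v₀ (el-preserves i R-v₀)

      open ≡-Reasoning

      module C = Colouring {s + t} {proj₁ words} σ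
        (proj₁ unit)
        (λ j → vert-injective (trans (vert-σ _ j) (trans (proj₂ unit (vert j)) (ε-act (vert j)))))
        (λ i j → proj₁ (product i j))
        (λ i j u → vert-injective (begin
          vert (σ (proj₁ (product i j)) u)    ≡⟨ vert-σ _ u ⟩
          el (proj₁ (product i j)) · vert u   ≡⟨ proj₂ (product i j) (vert u) ⟩
          (el i ∙ el j) · vert u              ≡⟨ ∙-act (el i) (el j) (vert u) ⟩
          el i · (el j · vert u)              ≡⟨ cong (el i ·_) (vert-σ j u) ⟨
          el i · vert (σ j u)                 ≡⟨ vert-σ i (σ j u) ⟨
          vert (σ i (σ j u))                  ∎))
        (λ i {j} {k} eq → el-injective λ x →
          subst (λ x → el j · x ≡ el k · x) (act-⁻¹ (el i) x) (begin
          el j · (el i · (el i ⁻¹ · x))            ≡⟨ ∙-act (el j) (el i) _ ⟨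
          (el j ∙ el i) · (el i ⁻¹ · x)            ≡⟨ proj₂ (product j i) _ ⟨
          el (proj₁ (product j i)) · (el i ⁻¹ · x) ≡⟨ cong (λ m → el m · (el i ⁻¹ · x)) eq ⟩
          el (proj₁ (product k i)) · (el i ⁻¹ · x) ≡⟨ proj₂ (product k i) _ ⟩
          (el k ∙ el i) · (el i ⁻¹ · x)            ≡⟨ ∙-act (el k) (el i) _ ⟩
          el k · (el i · (el i ⁻¹ · x))            ∎))
        (λ i → proj₁ (inverse i))
        (λ i u → vert-injective (begin
          vert (σ i (σ (proj₁ (inverse i)) u))    ≡⟨ vert-σ i (σ (proj₁ (inverse i)) u) ⟩
          el i · vert (σ (proj₁ (inverse i)) u)   ≡⟨ cong (el i ·_) (vert-σ _ u) ⟩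
          el i · (el (proj₁ (inverse i)) · vert u) ≡⟨ cong (el i ·_) (proj₂ (inverse i) (vert u)) ⟩
          el i · (el i ⁻¹ · vert u)               ≡⟨ act-⁻¹ (el i) (vert u) ⟩
          vert u                                  ∎))

      extend : (Fin N → Bool) → X → Bool
      extend c u with R? s p u
      ... | yes r = c (proj₁ (vert-surjective r))
      -- A default off the layer; `SemiInvariant` evaluates the colouring on the layer only.
      ... | no _  = false

      extend-vert : ∀ c j → extend c (vert j) ≡ c j
      extend-vert c j with R? s p (vert j)
      ... | yes r = cong c (vert-injective (proj₂ (vert-surjective r)))
      ... | no ¬r = contradiction (R-vert j) ¬r

      extend-invariant : ∀ c → (∀ i u v → c (σ i u) xor c (σ i v) ≡ c u xor c v) →
        SemiInvariant v₀ (extend c)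
      extend-invariant c c-inv g l {u} {w} lu lw =
        go (code g (Lay-anc l R-v₀)) (vert-surjective (Lay-anc lu R-v₀))
          (vert-surjective (Lay-anc lw R-v₀))
        where
        moved : ∀ {k} → (∀ x → el k · x ≡ g · x) → ∀ j → extend c (g · vert j) ≡ c (σ k j)
        moved {k} k≗g j = trans (cong (extend c) (trans (sym (k≗g (vert j))) (sym (vert-σ k j))))
                                (extend-vert c (σ k j))
        go : ∃[ k ] (∀ x → el k · x ≡ g · x) → ∃[ j ] vert j ≡ u → ∃[ j ] vert j ≡ w →
          extend c (g · u) xor extend c (g · w) ≡ extend c u xor extend c w
        go (k , k≗g) (j , refl) (j′ , refl) = trans (cong₂ _xor_ (moved k≗g j) (moved k≗g j′))
          (trans (c-inv k j j′) (sym (cong₂ _xor_ (extend-vert c j) (extend-vert c j′))))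

    abstract
      colouring : ∃[ v ] Σ[ c ∈ (X → Bool) ] (SemiInvariant v c ×
        Σ[ e ∈ Vec Bool s ] Σ[ f ∈ Vec Bool s ] (Lay v (walk p e) × c (walk p e) ≢ c (walk p f)))
      colouring = go C.semi-invariant-colouring
        where
        go : Σ[ c ∈ (Fin N → Bool) ]
               ((∃[ u ] ∃[ v ] c u ≢ c v) × (∀ i u v → c (σ i u) xor c (σ i v) ≡ c u xor c v)) →
          ∃[ v ] Σ[ c ∈ (X → Bool) ] (SemiInvariant v c ×
            Σ[ e ∈ Vec Bool s ] Σ[ f ∈ Vec Bool s ] (Lay v (walk p e) ×
              c (walk p e) ≢ c (walk p f)))
        go (c , (i , j , ci≢cj) , c-inv) =
          v₀ , extend c , extend-invariant c c-inv , proj₁ (R-vert i) , proj₁ (R-vert j) ,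
          common-ancestor⇒Lay R-v₀ (R-vert i) ,
          λ eq → ci≢cj (trans (sym (extend-vert c i)) (trans eq (extend-vert c j)))

  -- The vertices `q` are those of the preceding layer, whose out-neighbours both lie in the layer
  -- of `v`.
  Separating : X → Set
  Separating v =
    ∃[ c ] (SemiInvariant v c × (∀ q → Lay v (out q true) → c (out q true) ≢ c (out q false)))

  separates : ∀ {v q x y} (sep : Separating v) → q ⟶ x → q ⟶ y → Lay v x → x ≢ y →
    proj₁ sep x ≢ proj₁ sep y
  separates {q = q} (c , _ , sep) (true  , refl) (true  , refl) l x≢y = contradiction refl x≢y
  separates {q = q} (c , _ , sep) (true  , refl) (false , refl) l x≢y = sep q l
  separates {q = q} (c , _ , sep) (false , refl) (true  , refl) l x≢y =
    sep q (Lay-trans l (Lay-out Lay-refl (false , refl) (true , refl))) ∘ sym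
  separates {q = q} (c , _ , sep) (false , refl) (false , refl) l x≢y = contradiction refl x≢y

  -- A semi-invariant colouring which takes equal values on the two out-neighbours of one, hence
  -- of every vertex of the preceding layer can be pulled back to that layer.
  separating-or-constant : ∀ m v c → SemiInvariant v c → ∃ Separating ⊎
    (∀ q (e f : Vec Bool m) → Lay v (walk q e) → c (walk q e) ≡ c (walk q f))
  separating-or-constant zero    v c inv = inj₂ λ { q [] [] _ → refl }
  separating-or-constant (suc m) v c inv with q₀ , q₀⟶v ← predecessor v = split
    where
    image : ∀ g q b → c (g · out q true) xor c (g · out q false) ≡
                      c (out (g · q) true) xor c (out (g · q) false)
    image g q b with act-out g q true | act-out g q false
    ... | true  , e₁ | true  , e₂ =
      contradiction (act-injective g (trans e₁ (sym e₂))) (out-distinct q)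
    ... | true  , e₁ | false , e₂ = cong₂ (λ y z → c y xor c z) e₁ e₂
    ... | false , e₁ | true  , e₂ =
      trans (cong₂ (λ y z → c y xor c z) e₁ e₂) (Bool.xor-comm _ (c (out (g · q) true)))
    ... | false , e₁ | false , e₂ =
      contradiction (act-injective g (trans e₁ (sym e₂))) (out-distinct q)

    -- The group preserving the layer is transitive on the preceding one, so the two out-neighbours
    -- differ in colour for all of its vertices or for none.
    same-difference : ∀ {q q′ b b′} → Lay v (out q b) → Lay v (out q′ b′) →
      c (out q true) xor c (out q false) ≡ c (out q′ true) xor c (out q′ false)
    same-difference {q} {q′} {b} {b′} l l′
      with g , refl ← layer-transitive (Lay-in (Lay-trans (Lay-sym l) l′) (b , refl) (b′ , refl))
      = trans (sym (inv g preserved (lay true) (lay false))) (image g q true)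
      where
      lay : ∀ d → Lay v (out q d)
      lay d = Lay-trans l (Lay-out Lay-refl (b , refl) (d , refl))
      preserved : Lay v (g · v)
      preserved = Lay-preserve g
        (Lay-trans (Lay-sym l) (Lay-trans l′ (Lay-out Lay-refl (b′ , refl) (⟶-act g (b , refl))))) l

    split : ∃ Separating ⊎
      (∀ q (e f : Vec Bool (suc m)) → Lay v (walk q e) → c (walk q e) ≡ c (walk q f))
    split with c (out q₀ true) xor c (out q₀ false) in diff
    ... | true = inj₁ (v , c , inv , λ q l eq →
      contradiction (trans (sym (≡-xor eq)) (trans (same-difference l v∈) diff)) λ ())
      where
      v∈ : Lay v (out q₀ (proj₁ q₀⟶v))
      v∈ = subst (Lay v) (sym (proj₂ q₀⟶v)) Lay-refl
    ... | false = pull (separating-or-constant m q₀ (λ q → c (out q true)) inv′)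
      where
      v∈ : Lay v (out q₀ (proj₁ q₀⟶v))
      v∈ = subst (Lay v) (sym (proj₂ q₀⟶v)) Lay-refl
      equal : ∀ {q} b b′ → Lay v (out q b) → c (out q b) ≡ c (out q b′)
      equal {q} b b′ l = go b b′ (xor-≡ {c (out q true)} (trans (same-difference l v∈) diff))
        where
        go : ∀ b b′ → c (out q true) ≡ c (out q false) → c (out q b) ≡ c (out q b′)
        go true  true  eq = refl
        go true  false eq = eq
        go false true  eq = sym eq
        go false false eq = refl
      lay : ∀ {q} → Lay q₀ q → ∀ b → Lay v (out q b)
      lay l b = Lay-out l q₀⟶v (b , refl)
      inv′ : SemiInvariant q₀ (λ q → c (out q true))
      inv′ g l {u} {w} lu lw = trans (cong₂ _xor_ (moved lu) (moved lw))
        (inv g (Lay-out l q₀⟶v (⟶-act g q₀⟶v)) (lay lu true) (lay lw true))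
        where
        moved : ∀ {u} → Lay q₀ u → c (out (g · u) true) ≡ c (g · out u true)
        moved {u} lu with b , eq ← act-out g u true =
          trans (equal true b (lay (Lay-trans l (Lay-act g lu)) true)) (cong c (sym eq))
      pull : ∃ Separating ⊎
        (∀ q (e f : Vec Bool m) → Lay q₀ (walk q e) →
          c (out (walk q e) true) ≡ c (out (walk q f) true)) →
        ∃ Separating ⊎ (∀ q (e f : Vec Bool (suc m)) → Lay v (walk q e) →
          c (walk q e) ≡ c (walk q f))
      pull (inj₁ sep) = inj₁ sep
      pull (inj₂ const) = inj₂ λ q e f l → go q (snoc-view e) (snoc-view f) l
        where
        go : ∀ q {e f} → ∃[ e′ ] ∃[ b ] e ≡ e′ ∷ʳ b → ∃[ f′ ] ∃[ b ] f ≡ f′ ∷ʳ b →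
             Lay v (walk q e) → c (walk q e) ≡ c (walk q f)
        go q (e′ , b , refl) (f′ , b′ , refl) l rewrite walk-∷ʳ q e′ b | walk-∷ʳ q f′ b′ =
          trans (equal b true l) (trans (const q e′ f′ (Lay-in l q₀⟶v (b , refl)))
            (equal true b′ (lay (Lay-trans (Lay-in l q₀⟶v (b , refl))
              (Lay-walk m Lay-refl (e′ , refl) (f′ , refl))) true)))

  -- If `s` pull-backs never met a separating colouring, the colour would be constant on the
  -- descendants of `p` at distance `s`; these form the layer which `colouring` colours in a
  -- nonconstant way.
  separating-somewhere : X → ∃ Separating
  separating-somewhere p = go (LayerGroup.colouring p)
    where
    go : ∃[ v ] Σ[ c ∈ (X → Bool) ] (SemiInvariant v c ×
           Σ[ e ∈ Vec Bool s ] Σ[ f ∈ Vec Bool s ] (Lay v (walk p e) ×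
             c (walk p e) ≢ c (walk p f))) → ∃ Separating
    go (v , c , inv , e , f , l , ≢) = choose (separating-or-constant s v c inv)
      where
      choose : ∃ Separating ⊎
        (∀ q (e f : Vec Bool s) → Lay v (walk q e) → c (walk q e) ≡ c (walk q f)) →
        ∃ Separating
      choose (inj₁ sep)   = sep
      choose (inj₂ const) = contradiction (const p e f l) ≢

  separating-transfer : ∀ {v} w → Separating v → Separating w
  separating-transfer {v} w sep@(c , inv , _) with g , refl ← transitive v w =
    (λ x → c (g ⁻¹ · x)) , inv′ , λ q l →
      separates sep (⟶-act (g ⁻¹) (true , refl)) (⟶-act (g ⁻¹) (false , refl))
      (pull-back l) (out-distinct q ∘ act-injective (g ⁻¹))
    where
    pull-back : ∀ {u} → Lay (g · v) u → Lay v (g ⁻¹ · u)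
    pull-back {u} l = subst (λ z → Lay z (g ⁻¹ · u)) (⁻¹-act g v) (Lay-act (g ⁻¹) l)
    inv′ : SemiInvariant (g · v) (λ x → c (g ⁻¹ · x))
    inv′ h l {u} {u′} lu lu′ = trans (cong₂ (λ y z → c y xor c z) (conj u) (conj u′))
      (inv k (subst (Lay v) (trans (conj (g · v)) (cong (k ·_) (⁻¹-act g v))) (pull-back l))
        (pull-back lu) (pull-back lu′))
      where
      k : G
      k = (g ⁻¹) ∙ (h ∙ g)
      conj : ∀ u → g ⁻¹ · (h · u) ≡ k · (g ⁻¹ · u)
      conj u = sym (trans (∙-act _ _ _) (cong (g ⁻¹ ·_)
        (trans (∙-act _ _ _) (cong (h ·_) (act-⁻¹ g u)))))

  abstract
    separating : ∀ v → Separating v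
    separating v = separating-transfer v (proj₂ (separating-somewhere v))

  -- `g` preserves the colour difference of `u` and `u′` and fixes `u`, so `g · u′` has the colour
  -- of `u′`. Both are out-neighbours of the fixed vertex `q′`, and the colouring would separate
  -- them if they were different.
  fixes-outs-uniformly : ∀ g {q q′ u u′} → Lay q q′ → g · q ≡ q → g · q′ ≡ q′ →
    q ⟶ u → g · u ≡ u → q′ ⟶ u′ → g · u′ ≡ u′
  fixes-outs-uniformly g {q} {q′} {u} {u′} l gq gq′ p gu p′
    with sep@(c , inv , _) ← separating u
    with g · u′ ≟ u′
  ... | yes eq = eq
  ... | no ≢ = contradiction same
        (separates sep (subst (_⟶ (g · u′)) gq′ (⟶-act g p′)) p′
          (Lay-trans preserved (Lay-act g (Lay-out l p p′))) ≢)
    where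
    preserved : Lay u (g · u)
    preserved = subst (Lay u) (sym gu) Lay-refl
    xor-cancelˡ : ∀ a {b d} → a xor b ≡ a xor d → b ≡ d
    xor-cancelˡ true  eq = Bool.not-injective eq
    xor-cancelˡ false eq = eq
    same : c (g · u′) ≡ c u′
    same = xor-cancelˡ (c u) (trans (cong (λ z → c z xor c (g · u′)) (sym gu))
      (inv g preserved Lay-refl (Lay-out l p p′)))

  fixes-walks-uniformly : ∀ g {m q q′} (e f : Vec Bool m) → Lay q q′ → Fix g q e → g · q′ ≡ q′ →
    Fix g q′ f
  fixes-walks-uniformly g []      []      l _          gq′ = [ gq′ ]
  fixes-walks-uniformly g (b ∷ e) (c ∷ f) l (gq ∷ fix) gq′ = gq′ ∷
    fixes-walks-uniformly g e f (Lay-out l (b , refl) (c , refl)) fix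
      (fixes-outs-uniformly g l gq gq′ (b , refl) (maps-start fix) (c , refl))

  -- `q′` also reaches the end of the fixed walk. Reversal gives two walks from one vertex; as the
  -- first is fixed, so is the second, and with it `rev q′`.
  fixes-layer-start : ∀ g {q q′} (e : Vec Bool s) → Fix g q e → Lay q q′ → g · q′ ≡ q′
  fixes-layer-start g {q} {q′} e fix l
    with f , eq ← R-rev (Lay-desc l (e , refl))
    = rev-injective (trans (sym (act-rev g q′)) (subst (λ z → g · z ≡ z) eq
        (maps-end (fixes-walks-uniformly g (reverse-word q e) f Lay-refl back (maps-start back)))))
    where
    back : Fix g (rev (walk q e)) (reverse-word q e)
    back = fix-reverse q e fix

  fix-prefix : ∀ {g j m q} → j ≤ m → (e : Vec Bool m) → Fix g q e → ∃[ f ] Fix {j} g q f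
  fix-prefix z≤n       e       fix       = [] , [ maps-start fix ]
  fix-prefix (s≤s j≤m) (b ∷ e) (p ∷ fix) with f , fix′ ← fix-prefix j≤m e fix = b ∷ f , p ∷ fix′

  Lay-unwalk : ∀ m {x y u v} → Lay u v → R m x u → R m y v → Lay x y
  Lay-unwalk zero    l ([] , refl) ([] , refl) = l
  Lay-unwalk (suc m) l p q
    with _ , p₁ , p₂ ← R-unsnoc p | _ , q₁ , q₂ ← R-unsnoc q
    = Lay-unwalk m (Lay-in l p₂ q₂) p₁ q₁

  -- An ancestor `q′` of `w′` at distance `j` lies in the layer of `q`, hence is fixed; comparison
  -- with a prefix of `e` then fixes the walk from `q′` to `w′`.
  fixes-layer : ∀ g {q j w w′} (e : Vec Bool s) → Fix g q e → j ≤ s → R j q w → Lay w w′ →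
    g · w′ ≡ w′
  fixes-layer g {j = j} {w′ = w′} e fix j≤s r l
    with q′ , f , refl ← ancestor j w′
    with e′ , fix′ ← fix-prefix j≤s e fix
    with l′ ← Lay-unwalk j l r (f , refl)
    = maps-end (fixes-walks-uniformly g e′ f l′ fix′ (fixes-layer-start g e fix l′))

  -- Since `s < t`, arcs of length `s + 1` can be moved. Those used start at the reverse of a
  -- descendant of `q`, agree as far as `rev q`, and then go to `rev v` and `rev w`.
  swap-predecessors : ∀ {q v w} → v ⟶ q → w ⟶ q → ∃[ g ] ((∃[ e ] Fix {s} g q e) × g · v ≡ w)
  swap-predecessors {q} {v} {w} p p′
    with k , r ← descendant s q
    with e , eq ← R-rev r
    with b , pb ← ⟶-rev p | b′ , pb′ ← ⟶-rev p′
    with g , maps ← arcTransitive-≤ s<t AT (rev k) (rev k) (e ∷ʳ b) (e ∷ʳ b′)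
    = g , (reverse-word (rev k) e , subst (λ z → Fix g z (reverse-word (rev k) e))
            (trans (cong rev eq) (rev-rev q)) (fix-reverse (rev k) e (maps-init e e maps)))
    , rev-injective (trans (sym (act-rev g v)) (subst₂ (λ y z → g · y ≡ z) pb pb′
        (subst (λ z → g · out z b ≡ out z b′) eq (maps-last e e maps))))

  -- Induction on `m`: `g` matches the second vertices of the two walks, then `h` corrects the
  -- first. As `h` fixes an `s`-arc from `q′`, it fixes the layer of `w` by `fixes-layer`.
  move-ancestor : ∀ {m v v′ w} → m ≤ s → R m v w → R m v′ w →
    ∃[ g ] (g · v ≡ v′ × (∀ {u} → Lay w u → g · u ≡ u))
  move-ancestor {zero}  _   ([] , refl) ([] , refl) = ε , ε-act _ , λ _ → ε-act _
  move-ancestor {suc m} m≤s r r′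
    with q , p , r₁ ← R-uncons r | q′ , p′ , r₁′ ← R-uncons r′
    with g , gq , g-fixes ← move-ancestor (ℕ.<⇒≤ m≤s) r₁ r₁′
    with h , (e , fix) , hgv ← swap-predecessors (subst (_ ⟶_) gq (⟶-act g p)) p′
    = h ∙ g , trans (∙-act h g _) hgv
    , λ l → trans (∙-act h g _)
      (trans (cong (h ·_) (g-fixes l)) (fixes-layer h e fix (ℕ.<⇒≤ m≤s) r₁′ l))

  -- `u` lies in the layer of `w`, so it is fixed by an automorphism moving `v` to `v′`.
  same-descendants : ∀ {m v v′ w u} → m ≤ s → R m v w → R m v′ w → R m v u → R m v′ u
  same-descendants {m} {u = u} m≤s r r′ r″
    with g , gv , fixes ← move-ancestor m≤s r r′
    = subst₂ (R m) gv (fixes (Lay-walk m Lay-refl r r″)) (R-act g r″)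

-- Praeger-Xu coordinates

module Coordinates (S : System) (s′ t : ℕ) (s<t : suc s′ < t)
  (AT : Arcs.ArcTransitive S t) (reg : Arcs.Semiregular S t)
  (unique : Arcs.EndsDetermine S (suc s′)) (twin : Arcs.Twins S (suc (suc s′)))
  (a₀ : System.X S) where

  open System S
  open Arcs S
  open Rigidity S s′ t s<t AT reg unique twin
  open Cycle a₀

  s′≤s : s′ ≤ s
  s′≤s = ℕ.n≤1+n s′

  -- In the Praeger–Xu digraph, two vertices of the same layer are near when their first bits agree.
  Near : X → X → Set
  Near u v = ∃[ p ] (R s′ p u × R s′ p v)

  Near-sym : ∀ {u v} → Near u v → Near v u
  Near-sym (p , a , b) = p , b , a

  Near-desc : ∀ {p u v} → Near u v → R s′ p u → R s′ p v
  Near-desc (q , a , b) c = same-descendants s′≤s a c b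

  Near-trans : ∀ {u v w} → Near u v → Near v w → Near u w
  Near-trans (p , a , b) n = p , a , Near-desc n b

  Near⇒Lay : ∀ {u v} → Near u v → Lay u v
  Near⇒Lay (p , a , b) with q , c ← predecessor p = common-ancestor⇒Lay (R-cons c a) (R-cons c b)

  Near? : ∀ u v → Dec (Near u v)
  Near? u v with p , a ← ancestor s′ u = map′ (λ b → p , a , b) (λ n → Near-desc n a) (R? s′ p v)

  descendants-Near : ∀ {k v u w} → k ≤ s′ → R k v u → R k v w → Near u w
  descendants-Near {k} {v} k≤s′ a b with p , c ← ancestor (s′ ∸ k) v =
    p , extend c a , extend c b
    where
    extend : ∀ {p z} → R (s′ ∸ k) p v → R k v z → R s′ p z
    extend {p} {z} c a = subst (λ m → R m p z) (ℕ.m∸n+n≡m k≤s′) (R-trans c a)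

  -- Near vertices share a layer, so only the vertex of the cycle in the layer of `u` can be near
  -- `u`; its class is the half of that layer with first bit `true`.
  NearCycle : X → Set
  NearCycle u = ∃[ j ] Near (a (toℕ {r} j)) u

  nearCycle? : ∀ u → Dec (NearCycle u)
  nearCycle? u = Fin.any? λ j → Near? (a (toℕ j)) u

  abstract
    bit : X → Bool
    bit u = does (nearCycle? u)

    bit-true : ∀ {u} → NearCycle u → bit u ≡ true
    bit-true {u} = dec-true (nearCycle? u)

    bit-true⁻ : ∀ {u} → bit u ≡ true → NearCycle u
    bit-true⁻ {u} = does-true (nearCycle? u)

  bit-Near : ∀ {u v} → Near u v → bit u ≡ bit v
  bit-Near {u} {v} n = go (bit u) refl (bit v) refl
    where
    move : ∀ {u v} → Near u v → bit u ≡ true → bit v ≡ true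
    move n eq with j , n′ ← bit-true⁻ eq = bit-true (j , Near-trans n′ n)
    go : ∀ b → bit u ≡ b → ∀ c → bit v ≡ c → bit u ≡ bit v
    go true  eq c     eq′   = trans eq (sym (move n eq))
    go false eq true  eq′   = trans (move (Near-sym n) eq′) (sym eq′)
    go false eq false eq′   = trans eq (sym eq′)

  -- The vertex of the cycle in this layer is reached from `v` through `w`, say. It is then near
  -- `u`, and if it were near `u′` too, then `u` and `u′` would be near each other, against `apart`.
  bit-siblings : ∀ {v w w′ u u′} → Component v → v ⟶ w → v ⟶ w′ → w ≢ w′ →
    R s′ w u → R s′ w′ u′ → bit u ≢ bit u′
  bit-siblings {v} {w} {w′} {u} {u′} comp p p′ w≢w′ q q′ eq =
    case (layer comp′)
    where
    component-desc : ∀ m {x y} → R m x y → Component x → Component y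
    component-desc zero    ([] , refl)  c = c
    component-desc (suc m) (b ∷ e , eq) c = component-desc m (e , eq) (component-out (b , refl) c)
    comp′ : Component u
    comp′ = component-desc s′ q (component-out p comp)
    lay : Lay u u′
    lay = common-ancestor⇒Lay (R-cons p q) (R-cons p′ q′)
    -- otherwise u′ would be reached from v through both out-neighbours
    apart : ∀ {w w′ u u′} → v ⟶ w → v ⟶ w′ → w ≢ w′ → R s′ w u → R s′ w′ u′ → ¬ Near u u′
    apart (b , refl) (b′ , refl) ne q (f , eq′) n with e , eq ← Near-desc n q =
      ne (cong (out v) (cong head (unique v (b ∷ e) (b′ ∷ f) (trans eq (sym eq′)))))
    collide : ∀ {w w′ u u′ : X} (j : Fin r) → v ⟶ w → v ⟶ w′ → w ≢ w′ → R s′ w u → R s′ w′ u′ →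
      Lay (a (toℕ j)) u → Lay u u′ → R s′ w (a (toℕ j)) → bit u ≡ bit u′ → ⊥
    collide j p p′ ne q q′ l l′ q″ eq =
      close (bit-true⁻ (trans (sym eq) (bit-true (j , _ , q″ , q))))
      where
      close : NearCycle _ → ⊥
      close (k , n) = apart p p′ ne q q′ (Near-trans (Near-sym (_ , q″ , q))
        (subst (λ i → Near (a i) _) (Lay-a-unique (Fin.toℕ<n k) (Fin.toℕ<n j)
          (Lay-trans (Near⇒Lay n) (Lay-trans (Lay-sym l′) (Lay-sym l)))) n))
    case : ∃[ j ] Lay (a (toℕ {r} j)) u → ⊥
    case (j , l) = through (R-uncons (Lay-anc (Lay-sym l) (R-cons p q)))
      where
      through : ∃[ y ] (v ⟶ y × R s′ y (a (toℕ j))) → ⊥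
      through (y , p″ , q″) = pick (two-outs p p′ p″ w≢w′)
        where
        pick : y ≡ w ⊎ y ≡ w′ → ⊥
        pick (inj₁ refl) = collide j p p′ w≢w′ q q′ l lay q″ eq
        pick (inj₂ refl) =
          collide j p′ p (w≢w′ ∘ sym) q′ q (Lay-trans l lay) (Lay-sym lay) q″ (sym eq)

  -- Coordinate `i` is the first bit of a descendant at distance `i`. For `i < s` all these
  -- descendants have the same bit, by `bits-descendants`, and following `true` merely chooses one.
  bits : ∀ m → X → Vec Bool m
  bits zero    v = []
  bits (suc m) v = bit v ∷ bits m (out v true)

  ahead : ℕ → X → X
  ahead i v = walk v (replicate i true)

  R-ahead : ∀ i v → R i v (ahead i v)
  R-ahead i v = replicate i true , refl

  bits-∷ʳ : ∀ m v → bits (suc m) v ≡ bits m v ∷ʳ bit (ahead m v)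
  bits-∷ʳ zero    v = refl
  bits-∷ʳ (suc m) v = cong (bit v ∷_) (bits-∷ʳ m (out v true))

  bits-descendants : ∀ m k {v u w} → k + m ≤ s → R k v u → R k v w → bits m u ≡ bits m w
  bits-descendants zero    k _    a b = refl
  bits-descendants (suc m) k k+m≤s a b = cong₂ _∷_
    (bit-Near (descendants-Near (ℕ.≤-pred (ℕ.≤-trans (s≤s (ℕ.m≤m+n k m)) k+m≤s′)) a b))
    (bits-descendants m (suc k) k+m≤s′ (R-snoc a (true , refl)) (R-snoc b (true , refl)))
    where
    k+m≤s′ : suc k + m ≤ s
    k+m≤s′ = subst (_≤ s) (ℕ.+-suc k m) k+m≤s

  bits-ahead : ∀ m {v w} → bits m v ≡ bits m w → ∀ i → i < m → bit (ahead i v) ≡ bit (ahead i w)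
  bits-ahead (suc m) eq zero    _         = Vec.∷-injectiveˡ eq
  bits-ahead (suc m) eq (suc i) (s≤s i<m) = bits-ahead m (Vec.∷-injectiveʳ eq) i i<m

  component-ancestor : ∀ m {x y} → R m x y → Component y → Component x
  component-ancestor zero    ([] , refl)  c = c
  component-ancestor (suc m) (b ∷ e , eq) c =
    component-in (b , refl) (component-ancestor m (e , eq) c)

  -- Where the words first differ, the walks pass to distinct siblings. After the remaining letters
  -- and `k` more steps, both are `s - 1` steps beyond these, and `bit-siblings` tells them apart.
  words-determined : ∀ m k → m + k ≡ s → ∀ p → Component p → (e f : Vec Bool m) →
    (∀ i → i < s → bit (ahead i (walk p e)) ≡ bit (ahead i (walk p f))) → e ≡ f
  words-determined zero    k _   p c []      []       same = refl
  words-determined (suc m) k m+k p c (b ∷ e) (b′ ∷ f) same with b Bool.≟ b′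
  ... | yes refl = cong (b ∷_) (words-determined m (suc k) (trans (ℕ.+-suc m k) m+k)
                     (out p b) (component-out (b , refl) c) e f same)
  ... | no b≢b′ = contradiction (same k k<s)
        (bit-siblings c (b , refl) (b′ , refl) (b≢b′ ∘ out-injective p)
          (reach (out p b) e) (reach (out p b′) f))
    where
    k<s : k < s
    k<s = ℕ.≤-trans (s≤s (ℕ.m≤n+m k m)) (ℕ.≤-reflexive m+k)
    reach : ∀ q (e : Vec Bool m) → R s′ q (ahead k (walk q e))
    reach q e = subst (λ n → R n q (ahead k (walk q e))) (ℕ.suc-injective m+k)
      (R-trans (e , refl) (R-ahead k (walk q e)))

  bits-injective : ∀ {v w} → Component v → Lay v w → bits s v ≡ bits s w → v ≡ w
  bits-injective {v} {w} comp l eq = go (Lay⇒common-ancestor l)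
    where
    go : ∃[ p ] (R s p v × R s p w) → v ≡ w
    go (p , (e , refl) , (f , refl)) = cong (walk p)
      (words-determined s 0 (ℕ.+-identityʳ s) p (component-ancestor s (e , refl) comp) e f
        (bits-ahead s eq))

  bits-surjective : ∀ (j : Fin r) (w : Vec Bool s) → ∃[ v ] (Lay (a (toℕ j)) v × bits s v ≡ w)
  bits-surjective j w = go (ancestor s (a (toℕ j)))
    where
    go : ∃[ p ] R s p (a (toℕ j)) → ∃[ v ] (Lay (a (toℕ j)) v × bits s v ≡ w)
    go (p , q) = finish (injective⇒surjective-word label label-injective w)
      where
      label : Vec Bool s → Vec Bool s
      label e = bits s (walk p e)
      comp : Component p
      comp = component-ancestor s q (toℕ j , Lay-refl)
      label-injective : ∀ {e f} → label e ≡ label f → e ≡ f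
      label-injective {e} {f} eq =
        words-determined s 0 (ℕ.+-identityʳ s) p comp e f (bits-ahead s eq)
      finish : ∃[ e ] label e ≡ w → ∃[ v ] (Lay (a (toℕ j)) v × bits s v ≡ w)
      finish (e , eq) = walk p e , common-ancestor⇒Lay q (e , refl) , eq

  position : ∀ x → Component x → PXVertex r s
  position x c = proj₁ (layer c) , bits s x

  layer-unique : ∀ {i j : Fin r} {x y} → Lay (a (toℕ i)) x → Lay (a (toℕ j)) y → Lay x y → i ≡ j
  layer-unique {i} {j} l l′ l″ = Fin.toℕ-injective
    (Lay-a-unique (Fin.toℕ<n i) (Fin.toℕ<n j) (Lay-trans l (Lay-trans l″ (Lay-sym l′))))

  position-unique : ∀ {x} (c d : Component x) → position x c ≡ position x d
  position-unique c d = cong (_, _) (layer-unique (proj₂ (layer c)) (proj₂ (layer d)) Lay-refl)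

  position-injective : ∀ {x y} (c : Component x) (d : Component y) → position x c ≡ position y d →
    x ≡ y
  position-injective {x} {y} c d eq = bits-injective c
    (Lay-trans (Lay-sym (proj₂ (layer c)))
      (subst (λ j → Lay (a (toℕ j)) y) (sym (cong proj₁ eq)) (proj₂ (layer d))))
    (cong proj₂ eq)

  bits-⟶ : ∀ {u v} → u ⟶ v → bits s v ≡ bits s′ (out u true) ∷ʳ bit (ahead s′ v)
  bits-⟶ {u} {v} p = trans (bits-∷ʳ s′ v) (cong (_∷ʳ bit (ahead s′ v))
    (bits-descendants s′ 1 ℕ.≤-refl (R-cons p ([] , refl)) (R-cons (true , refl) ([] , refl))))

  ⟶⇒PXArc : ∀ {u v} (c : Component u) (d : Component v) → u ⟶ v →
    PXArc (position u c) (position v d)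
  ⟶⇒PXArc {u} {v} c d p =
    layer-unique (proj₂ (layer d)) (Lay-sucMod (proj₁ (layer c)) (proj₂ (layer c)) p) Lay-refl ,
    bit (ahead s′ v) , bits-⟶ p

  -- The out-neighbours of `u` have the same bits except for the last, where they differ; so one of
  -- them has the coordinates of `v`.
  PXArc⇒⟶ : ∀ {u v} (c : Component u) (d : Component v) → PXArc (position u c) (position v d) →
    u ⟶ v
  PXArc⇒⟶ {u} {v} c d (eq , b , eq′) = choose (bit (ahead s′ (out u true)) Bool.≟ b)
    where
    differ : bit (ahead s′ (out u true)) ≢ bit (ahead s′ (out u false))
    differ = bit-siblings c (true , refl) (false , refl) (out-distinct u)
      (R-ahead s′ (out u true)) (R-ahead s′ (out u false))
    reach : ∀ d′ → bit (ahead s′ (out u d′)) ≡ b → out u d′ ≡ v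
    reach d′ last = bits-injective (component-out (d′ , refl) c)
      (Lay-trans (Lay-sym (Lay-sucMod (proj₁ (layer c)) (proj₂ (layer c)) (d′ , refl)))
        (subst (λ j → Lay (a (toℕ j)) v) eq (proj₂ (layer d))))
      (trans (bits-⟶ (d′ , refl)) (trans (cong (bits s′ (out u true) ∷ʳ_) last) (sym eq′)))
    choose : Dec (bit (ahead s′ (out u true)) ≡ b) → u ⟶ v
    choose (yes last) = true , reach true last
    choose (no ne) = false , reach false
      (trans (Bool.¬-not (differ ∘ sym)) (sym (Bool.¬-not (ne ∘ sym))))

  -- The half containing `a₀` supplies the copies with sign `-`. A vertex of the other half is the
  -- `+` copy of its reverse, so `rev` exchanges the two copies of each vertex.
  place : ∀ {x} → Component x ⊎ Component (rev x) → SplitPXVertex r s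
  place {x} (inj₁ c) = position x c , Sign.-
  place {x} (inj₂ c) = position (rev x) c , Sign.+

  place-unique : ∀ {x} (c d : Component x ⊎ Component (rev x)) → place c ≡ place d
  place-unique (inj₁ c) (inj₁ d) = cong (_, Sign.-) (position-unique c d)
  place-unique (inj₁ c) (inj₂ d) = contradiction d (component-disjoint c)
  place-unique (inj₂ c) (inj₁ d) = contradiction c (component-disjoint d)
  place-unique (inj₂ c) (inj₂ d) = cong (_, Sign.+) (position-unique c d)

  place-injective : ∀ {x y}
    (c : Component x ⊎ Component (rev x)) (d : Component y ⊎ Component (rev y)) →
    place c ≡ place d → x ≡ y
  place-injective (inj₁ c) (inj₁ d) eq = position-injective c d (cong proj₁ eq)
  place-injective (inj₁ c) (inj₂ d) ()
  place-injective (inj₂ c) (inj₁ d) ()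
  place-injective (inj₂ c) (inj₂ d) eq = rev-injective (position-injective c d (cong proj₁ eq))

  place-surjective : ∀ w → Σ[ x ∈ X ] Σ[ c ∈ Component x ⊎ Component (rev x) ] place c ≡ w
  place-surjective ((j , w) , sign) = go sign (bits-surjective j w)
    where
    at : ∀ {v} → Lay (a (toℕ j)) v → bits s v ≡ w → (c : Component v) → position v c ≡ (j , w)
    at l eq c = cong₂ _,_ (layer-unique (proj₂ (layer c)) l Lay-refl) eq
    go : ∀ sign → ∃[ v ] (Lay (a (toℕ j)) v × bits s v ≡ w) →
      Σ[ x ∈ X ] Σ[ c ∈ Component x ⊎ Component (rev x) ] place c ≡ ((j , w) , sign)
    go Sign.- (v , l , eq) = v , inj₁ (toℕ j , l) , cong (_, Sign.-) (at l eq (toℕ j , l))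
    go Sign.+ (v , l , eq) = rev v , inj₂ (toℕ j , l′) ,
      cong (_, Sign.+) (at l′ (trans (cong (bits s) (rev-rev v)) eq) (toℕ j , l′))
      where
      l′ : Lay (a (toℕ j)) (rev (rev v))
      l′ = subst (Lay (a (toℕ j))) (sym (rev-rev v)) l

  coordinates : X ↔ SplitPXVertex r s
  coordinates = mk↔ₛ′ to from to∘from from∘to
    where
    to : X → SplitPXVertex r s
    to x = place (component-total x)
    from : SplitPXVertex r s → X
    from w = proj₁ (place-surjective w)
    to∘from : ∀ w → to (from w) ≡ w
    to∘from w = trans (place-unique (component-total (from w)) (proj₁ (proj₂ (place-surjective w))))
                      (proj₂ (proj₂ (place-surjective w)))
    from∘to : ∀ x → from (to x) ≡ x
    from∘to x = place-injective (component-total (from (to x))) (component-total x) (to∘from (to x))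

  -- The adjacency of the cubic graph, recovered from the digraph: `rev x` will be the mate of `x`,
  -- and the out-neighbours of `rev x` its other two neighbours.
  Adjacent : X → X → Set
  Adjacent x y = y ≡ rev x ⊎ rev x ⟶ y

  Adjacent-sym : ∀ {x y} → Adjacent x y → Adjacent y x
  Adjacent-sym {x} (inj₁ refl) = inj₁ (sym (rev-rev x))
  Adjacent-sym {x} {y} (inj₂ p) = inj₂ (subst (rev y ⟶_) (rev-rev x) (⟶-rev p))

  adjacent⇔ : ∀ x y → Adjacent x y ⇔ SplitPXAdj (Inverse.to coordinates x)
    (Inverse.to coordinates y)
  adjacent⇔ x y = placed (component-total x) (component-total y)
    where
    forth : ∀ {u v} (c : Component u) (d : Component v) → v ≡ u ⊎ u ⟶ v →
      position u c ≡ position v d ⊎ PXArc (position u c) (position v d)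
    forth c d (inj₁ refl) = inj₁ (position-unique c d)
    forth c d (inj₂ p)    = inj₂ (⟶⇒PXArc c d p)
    back : ∀ {u v} (c : Component u) (d : Component v) →
      position u c ≡ position v d ⊎ PXArc (position u c) (position v d) → v ≡ u ⊎ u ⟶ v
    back c d (inj₁ eq) = inj₁ (sym (position-injective c d eq))
    back c d (inj₂ p)  = inj₂ (PXArc⇒⟶ c d p)
    placed : ∀ {x y} (c : Component x ⊎ Component (rev x)) (d : Component y ⊎ Component (rev y)) →
      Adjacent x y ⇔ SplitPXAdj (place c) (place d)
    placed (inj₂ c) (inj₁ d) = mk⇔ (forth c d) (back c d)
    placed (inj₁ c) (inj₂ d) = mk⇔ (forth d c ∘ Adjacent-sym) (Adjacent-sym ∘ back d c)
    placed (inj₁ c) (inj₁ d) = mk⇔ absurd λ ()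
      where
      absurd : _ → _
      absurd (inj₁ refl) = component-disjoint c d
      absurd (inj₂ p)    = component-disjoint c (component-in p d)
    placed (inj₂ c) (inj₂ d) = mk⇔ absurd λ ()
      where
      absurd : _ → _
      absurd (inj₁ refl) = component-disjoint c d
      absurd (inj₂ p)    = component-disjoint (component-out p c) d

  parameters : 3 ≤ r × 1 ≤ s × s ≤ r ∸ 1
  parameters =
    ℕ.≤-trans (s≤s (s≤s (s≤s z≤n))) s+2≤r , s≤s z≤n , ℕ.≤-trans (ℕ.n≤1+n s) (ℕ.≤-pred s+2≤r)

-- Counting automorphisms by arcs, and collisions of walks

module ArcImages (S : System) where
  open System S
  open Arcs S

  arc-image : ∀ t → Semiregular t → X → Σ[ image ∈ (G → X × Vec Bool t) ]
    ((∀ {g h} → (∀ x → g · x ≡ h · x) → image g ≡ image h) ×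
     (∀ {g h} → image g ≡ image h → ∀ x → g · x ≡ h · x))
  arc-image t reg x₀ = image , image-cong , image-injective
    where
    base : Vec Bool t
    base = replicate t true
    maps : ∀ g → ∃[ f ] Maps g x₀ base (g · x₀) f
    maps g = maps-exists g base refl
    image : G → X × Vec Bool t
    image g = g · x₀ , proj₁ (maps g)
    image-cong : ∀ {g h} → (∀ x → g · x ≡ h · x) → image g ≡ image h
    image-cong {g} {h} eq = pair (eq x₀) (maps-resp eq (proj₂ (maps g))) (proj₂ (maps h))
      where
      pair : ∀ {y z f k} → y ≡ z → Maps h x₀ base y f → Maps h x₀ base z k → (y , f) ≡ (z , k)
      pair refl p q = cong (_ ,_) (maps-functional p q)
    image-injective : ∀ {g h} → image g ≡ image h → ∀ x → g · x ≡ h · x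
    image-injective {g} {h} eq x = act-injective (h ⁻¹) (trans (sym (∙-act (h ⁻¹) g x))
      (trans (reg ((h ⁻¹) ∙ g) x₀ base
        (maps-∙ (transport (cong proj₁ eq) (cong proj₂ eq) (proj₂ (maps g)))
                                               (maps-⁻¹ (proj₂ (maps h)))) x)
             (sym (⁻¹-act h x))))
      where
      transport : ∀ {y z f k} → y ≡ z → f ≡ k → Maps g x₀ base y f → Maps g x₀ base z k
      transport refl refl p = p

  -- With a single starting vertex, this is decided by a search over words; transitivity carries
  -- absence, and arc-transitivity presence, to all other vertices.
  Collision : X → ℕ → Set
  Collision x m = Σ[ e ∈ Vec Bool m ] Σ[ f ∈ Vec Bool m ] (e ≢ f × walk x e ≡ walk x f)

  collision? : ∀ x m → Dec (Collision x m)
  collision? x m = search-Vec search-Bool m λ e → search-Vec search-Bool m λ f →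
    ¬? (Vec.≡-dec Bool._≟_ e f) ×-dec (walk x e ≟ walk x f)

  collision-free : ∀ {x m} → ¬ Collision x m → EndsDetermine m
  collision-free {x} {m} none y e f eq = go (transitive y x)
    where
    go : ∃[ g ] g · y ≡ x → e ≡ f
    go (g , gy) = compare (maps-exists g e gy) (maps-exists g f gy)
      where
      compare : ∃[ e′ ] Maps g y e x e′ → ∃[ f′ ] Maps g y f x f′ → e ≡ f
      compare (e′ , p) (f′ , q) with Vec.≡-dec Bool._≟_ e′ f′
      ... | yes refl = maps-functional (maps-⁻¹ p) (maps-⁻¹ q)
      ... | no e′≢f′ = contradiction
        (e′ , f′ , e′≢f′ , trans (sym (maps-end p)) (trans (cong (g ·_) eq) (maps-end q))) none

  collision⇒twin : ∀ {x m} → ArcTransitive m → Collision x m → Twins m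
  collision⇒twin {x} AT (e₀ , f₀ , ne , eq) y e = go (AT x y e₀ e)
    where
    go : ∃[ g ] Maps g x e₀ y e → ∃[ f ] (f ≢ e × walk y f ≡ walk y e)
    go (g , p) = found (maps-exists g f₀ (maps-start p))
      where
      found : ∃[ f ] Maps g x f₀ y f → ∃[ f ] (f ≢ e × walk y f ≡ walk y e)
      found (f , q) = f
        , (λ { refl → ne (maps-functional (maps-⁻¹ p) (maps-⁻¹ q)) })
        , trans (sym (maps-end q)) (trans (cong (g ·_) (sym eq)) (maps-end p))

  -- The length is lowered from `t` while collisions persist, which ends before length 1 because
  -- `out` is injective.
  first-collision : ∀ x t → Collision x t →
    ∃[ s ] (suc s < t × ¬ Collision x (suc s) × Collision x (suc (suc s)))
  first-collision x zero    ([] , [] , ne , _) = contradiction refl ne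
  first-collision x (suc t) col = go t col
    where
    go : ∀ t → Collision x (suc t) →
      ∃[ s ] (suc s < suc t × ¬ Collision x (suc s) × Collision x (suc (suc s)))
    go zero (b ∷ [] , c ∷ [] , ne , eq) = contradiction (cong (_∷ []) (out-injective x eq)) ne
    go (suc t) col with collision? x (suc t)
    ... | no none = t , ℕ.n<1+n _ , none , col
    ... | yes col′ with s , s<t , rest ← go t col′ = s , ℕ.m≤n⇒m≤1+n s<t , rest

-- Cubic graphs and their automorphisms

module CubicGraph (Γ : Graph) (n : ℕ) (size : HasSize (Graph.vertices Γ) n) (cubic : Cubic Γ) where
  open Graph Γ renaming (Vertex to V)

  vertex# : V → Fin n
  vertex# = Inverse.to size

  vertex-at : Fin n → V
  vertex-at = Inverse.from size

  vertex-at-# : ∀ v → vertex-at (vertex# v) ≡ v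
  vertex-at-# = Inverse.strictlyInverseʳ size

  vertex#-injective : ∀ {u v} → vertex# u ≡ vertex# v → u ≡ v
  vertex#-injective {u} {v} eq =
    trans (sym (vertex-at-# u)) (trans (cong vertex-at eq) (vertex-at-# v))

  infix 4 _≟ᵛ_
  _≟ᵛ_ : (u v : V) → Dec (u ≡ v)
  u ≟ᵛ v = map′ vertex#-injective (cong vertex#) (vertex# u Fin.≟ vertex# v)

  search-V : Searchable V
  search-V = search-retract vertex-at vertex# vertex-at-# Fin.any?

  nb : V → Fin 3 → V
  nb v i = proj₁ (Inverse.from (cubic v) i)

  nb-adjacent : ∀ v i → v ~ nb v i
  nb-adjacent v i = proj₂ (Inverse.from (cubic v) i)

  slot : ∀ {v w} → v ~ w → Fin 3
  slot {v} {w} p = Inverse.to (cubic v) (w , p)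

  nb-slot : ∀ {v w} (p : v ~ w) → nb v (slot p) ≡ w
  nb-slot {v} {w} p = Inverse.strictlyInverseʳ (cubic v) (w , p)

  nb-injective : ∀ v {i j} → nb v i ≡ nb v j → i ≡ j
  nb-injective v {i} {j} eq = trans (sym (Inverse.strictlyInverseˡ (cubic v) i))
    (trans (Inverse.to-cong (cubic v) eq) (Inverse.strictlyInverseˡ (cubic v) j))

  _~?_ : ∀ u v → Dec (u ~ v)
  u ~? v = map′ (λ (i , eq) → subst (u ~_) eq (nb-adjacent u i)) (λ p → slot p , nb-slot p)
                (Fin.any? λ i → nb u i ≟ᵛ v)

  G : Set
  G = Γ ≅ Γ

  infixr 7 _·_
  _·_ : G → V → V
  g · v = _≅_.to g v

  automorphism : (f f′ : V → V) → (∀ v → f (f′ v) ≡ v) → (∀ v → f′ (f v) ≡ v) →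
    (∀ u v → u ~ v → f u ~ f v) → (∀ u v → f u ~ f v → u ~ v) → G
  automorphism f f′ ff′ f′f pres refl′ = record
    { bijection = mk↔ₛ′ f f′ ff′ f′f ; ~-⇔ = λ u v → mk⇔ (pres u v) (refl′ u v) }

  act-~ : ∀ g {u v} → u ~ v → (g · u) ~ (g · v)
  act-~ g {u} {v} = Equivalence.to (_≅_.~-⇔ g u v)

  unact-~ : ∀ g {u v} → (g · u) ~ (g · v) → u ~ v
  unact-~ g {u} {v} = Equivalence.from (_≅_.~-⇔ g u v)

  inverseˡ : ∀ g v → _≅_.from g (g · v) ≡ v
  inverseˡ g = Inverse.strictlyInverseʳ (_≅_.bijection g)

  inverseʳ : ∀ g v → g · _≅_.from g v ≡ v
  inverseʳ g = Inverse.strictlyInverseˡ (_≅_.bijection g)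

  identity : G
  identity = automorphism (λ v → v) (λ v → v) (λ _ → refl) (λ _ → refl) (λ _ _ p → p) (λ _ _ p → p)

  infixl 7 _∙_
  _∙_ : G → G → G
  g ∙ h = automorphism (λ v → g · (h · v)) (λ v → _≅_.from h (_≅_.from g v))
    (λ v → trans (cong (g ·_) (inverseʳ h _)) (inverseʳ g v))
    (λ v → trans (cong (_≅_.from h) (inverseˡ g _)) (inverseˡ h v))
    (λ u v p → act-~ g (act-~ h p)) (λ u v p → unact-~ h (unact-~ g p))

  infix 8 _⁻¹
  _⁻¹ : G → G
  g ⁻¹ = automorphism (_≅_.from g) (g ·_) (inverseˡ g) (inverseʳ g)
    (λ u v p → unact-~ g (subst₂ _~_ (sym (inverseʳ g u)) (sym (inverseʳ g v)) p))
    (λ u v p → subst₂ _~_ (inverseʳ g u) (inverseʳ g v) (act-~ g p))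

  act-injectiveᵛ : ∀ g {u v} → g · u ≡ g · v → u ≡ v
  act-injectiveᵛ g {u} {v} eq =
    trans (sym (inverseˡ g u)) (trans (cong (_≅_.from g) eq) (inverseˡ g v))

  abstract
    encode : G → Fin (n ^ n)
    encode g = funToFin λ i → vertex# (g · vertex-at i)

    encode-injective : ∀ {g h} → encode g ≡ encode h → ∀ v → g · v ≡ h · v
    encode-injective {g} {h} eq v = begin
      g · v                       ≡⟨ cong (g ·_) (vertex-at-# v) ⟨
      g · vertex-at (vertex# v)   ≡⟨ vertex#-injective pointwise ⟩
      h · vertex-at (vertex# v)   ≡⟨ cong (h ·_) (vertex-at-# v) ⟩
      h · v                       ∎
      where
      open ≡-Reasoning
      values : G → Fin n → Fin n
      values g i = vertex# (g · vertex-at i)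
      pointwise : values g (vertex# v) ≡ values h (vertex# v)
      pointwise = trans (sym (Fin.finToFun-funToFin (values g) (vertex# v)))
        (trans (cong (λ k → finToFun k (vertex# v)) eq)
          (Fin.finToFun-funToFin (values h) (vertex# v)))

    -- The search runs over pairs of tables of values, for a map and its inverse. As `P` respects
    -- pointwise equality, any proof that the tables give an automorphism will do.
    search-Aut : ∀ {P : G → Set} → (∀ {g h} → (∀ v → g · v ≡ h · v) → P g → P h) →
      (∀ g → Dec (P g)) → Dec (∃ P)
    search-Aut {P} resp P? = map′ (λ ((w , w′) , d , p) → toAut w w′ d , p) found
      (search-× (search-Vec Fin.any? n) (search-Vec Fin.any? n) λ (w , w′) → candidate? w w′)
      where
      Table : Set
      Table = Vec (Fin n) n
      apply : Table → V → V
      apply w v = vertex-at (lookup w (vertex# v))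
      IsAut : Table → Table → Set
      IsAut w w′ = (∀ v → apply w (apply w′ v) ≡ v) × (∀ v → apply w′ (apply w v) ≡ v) ×
        (∀ u v → u ~ v → apply w u ~ apply w v) × (∀ u v → apply w u ~ apply w v → u ~ v)
      isAut? : ∀ w w′ → Dec (IsAut w w′)
      isAut? w w′ =
        search-∀ search-V (λ v → apply w (apply w′ v) ≟ᵛ v) ×-dec
        search-∀ search-V (λ v → apply w′ (apply w v) ≟ᵛ v) ×-dec
        search-∀ search-V (λ u → search-∀ search-V λ v → (u ~? v) →-dec (apply w u ~? apply w v))
          ×-dec
        search-∀ search-V (λ u → search-∀ search-V λ v → (apply w u ~? apply w v) →-dec (u ~? v))
      toAut : ∀ w w′ → IsAut w w′ → G
      toAut w w′ (a , b , c , d) = automorphism (apply w) (apply w′) a b c d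
      candidate? : ∀ w w′ → Dec (Σ[ d ∈ IsAut w w′ ] P (toAut w w′ d))
      candidate? w w′ with isAut? w w′
      ... | no ¬d = no (¬d ∘ proj₁)
      ... | yes d = map′ (d ,_) (λ (d′ , p) → resp (λ _ → refl) p) (P? (toAut w w′ d))
      table : (V → V) → Table
      table f = tabulate λ i → vertex# (f (vertex-at i))
      apply-table : ∀ f v → apply (table f) v ≡ f v
      apply-table f v = trans (cong vertex-at (Vec.lookup∘tabulate _ (vertex# v)))
        (trans (vertex-at-# _) (cong f (vertex-at-# v)))
      found : ∃ P → Σ[ (w , w′) ∈ Table × Table ] Σ[ d ∈ IsAut w w′ ] P (toAut w w′ d)
      found (g , p) = (table (g ·_) , table (_≅_.from g)) ,
        ( (λ v → trans (apply-table to _) (trans (cong to (apply-table from v)) (inverseʳ g v)))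
        , (λ v → trans (apply-table from _) (trans (cong from (apply-table to v)) (inverseˡ g v)))
        , (λ u v q → subst₂ _~_ (sym (apply-table to u)) (sym (apply-table to v)) (act-~ g q))
        , (λ u v q → unact-~ g (subst₂ _~_ (apply-table to u) (apply-table to v) q)) )
        , resp (λ v → sym (apply-table to v)) p
        where
        to from : V → V
        to   = g ·_
        from = _≅_.from g

  Bounded : Set
  Bounded = ∃[ k ] (HasSize (Aut Γ) k × k ≤ 2 * n ^ 2)

  bounded : (f : G → V × V × Bool) → (∀ {g h} → (∀ v → g · v ≡ h · v) → f g ≡ f h) →
    (∀ {g h} → f g ≡ f h → ∀ v → g · v ≡ h · v) → Bounded
  bounded f f-cong f-inj = injection⇒HasSize (Aut Γ) (2 * n ^ 2) (code ∘ f)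
    (cong code ∘ f-cong) (f-inj ∘ code-injective _ _)
    (λ j → search-Aut (λ eq p → trans (cong code (sym (f-cong eq))) p) (λ g → code (f g) Fin.≟ j))
    where
    -- `n ^ 2` unfolds to `n * (n * 1)`; this is the index for the last factor.
    one : Fin 1
    one = zero
    code : V × V × Bool → Fin (2 * n ^ 2)
    code (u , v , b) = combine (bit→Fin b) (combine (vertex# u) (combine (vertex# v) one))
    code-injective : ∀ x y → code x ≡ code y → x ≡ y
    code-injective (u , v , b) (u′ , v′ , b′) eq
      with b≡ , eq ← Fin.combine-injective (bit→Fin b) _ (bit→Fin b′) _ eq
      with u≡ , eq ← Fin.combine-injective (vertex# u) _ (vertex# u′) _ eq
      with v≡ , _  ← Fin.combine-injective (vertex# v) one (vertex# v′) one eq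
      = cong₂ _,_ (vertex#-injective u≡) (cong₂ _,_ (vertex#-injective v≡) (bit→Fin-injective b≡))

-- Equivalence relations on three points

module Trichotomy {E : Fin 3 → Fin 3 → Set} (E? : ∀ i j → Dec (E i j))
  (E-refl : ∀ {i} → E i i) (E-sym : ∀ {i j} → E i j → E j i)
  (E-trans : ∀ {i j k} → E i j → E j k → E i k)
  where

  private
    0F 1F 2F : Fin 3
    0F = zero
    1F = suc zero
    2F = suc (suc zero)

    total : E 0F 1F → E 0F 2F → ∀ i j → E i j
    total a b i j = E-trans (E-sym (from-0 i)) (from-0 j)
      where
      from-0 : ∀ i → E 0F i
      from-0 zero             = E-refl
      from-0 (suc zero)       = a
      from-0 (suc (suc zero)) = b

    pair : ∀ k → E (punchIn k zero) (punchIn k (suc zero)) → ∀ (a b : Fin 2) →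
      E (punchIn k a) (punchIn k b)
    pair k p zero       zero       = E-refl
    pair k p zero       (suc zero) = p
    pair k p (suc zero) zero       = E-sym p
    pair k p (suc zero) (suc zero) = E-refl

  trichotomy : (∀ i j → E i j) ⊎ (∀ i j → E i j → i ≡ j) ⊎
    ∃[ k ] ((∀ j → E k j → k ≡ j) × (∀ (a b : Fin 2) → E (punchIn k a) (punchIn k b)))
  trichotomy with E? 0F 1F | E? 0F 2F | E? 1F 2F
  ... | yes a | yes b | _     = inj₁ (total a b)
  ... | yes a | no ¬b | yes c = contradiction (E-trans a c) ¬b
  ... | no ¬a | yes b | yes c = contradiction (E-trans b (E-sym c)) ¬a
  ... | yes a | no ¬b | no ¬c = inj₂ (inj₂ (2F , isolated , pair 2F a))
    where
    isolated : ∀ j → E 2F j → 2F ≡ j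
    isolated zero             p = contradiction (E-sym p) ¬b
    isolated (suc zero)       p = contradiction (E-sym p) ¬c
    isolated (suc (suc zero)) p = refl
  ... | no ¬a | yes b | no ¬c = inj₂ (inj₂ (1F , isolated , pair 1F b))
    where
    isolated : ∀ j → E 1F j → 1F ≡ j
    isolated zero             p = contradiction (E-sym p) ¬a
    isolated (suc zero)       p = refl
    isolated (suc (suc zero)) p = contradiction p ¬c
  ... | no ¬a | no ¬b | yes c = inj₂ (inj₂ (0F , isolated , pair 0F c))
    where
    isolated : ∀ j → E 0F j → 0F ≡ j
    isolated zero             p = refl
    isolated (suc zero)       p = contradiction p ¬a
    isolated (suc (suc zero)) p = contradiction p ¬b
  ... | no ¬a | no ¬b | no ¬c = inj₂ (inj₁ diagonal)
    where
    diagonal : ∀ i j → E i j → i ≡ j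
    diagonal zero             zero             p = refl
    diagonal zero             (suc zero)       p = contradiction p ¬a
    diagonal zero             (suc (suc zero)) p = contradiction p ¬b
    diagonal (suc zero)       zero             p = contradiction (E-sym p) ¬a
    diagonal (suc zero)       (suc zero)       p = refl
    diagonal (suc zero)       (suc (suc zero)) p = contradiction p ¬c
    diagonal (suc (suc zero)) zero             p = contradiction (E-sym p) ¬b
    diagonal (suc (suc zero)) (suc zero)       p = contradiction (E-sym p) ¬c
    diagonal (suc (suc zero)) (suc (suc zero)) p = refl

-- Vertex stabilisers: the rigid and the alternating case

module VertexTransitiveGraph (Γ : Graph) (n : ℕ) (size : HasSize (Graph.vertices Γ) n)
  (cubic : Cubic Γ)
  (connected-Γ : Connected Γ) (vertexTransitive : VertexTransitive Γ) where

  open CubicGraph Γ n size cubic public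
  open Graph Γ renaming (Vertex to V) public

  v₀ : V
  v₀ = proj₁ connected-Γ

  everywhere : {P : V → Set} → (∀ {u w} → u ~ w → P u → P w) → ∀ u v → P u → P v
  everywhere {P} step u v = along (proj₂ connected-Γ u v)
    where
    along : ∀ {u v} → Star _~_ u v → P u → P v
    along Star.ε   p = p
    along (e ◅ es) p = along es (step e p)

  Moves : Fin 3 → Fin 3 → Set
  Moves i j = ∃[ g ] (g · v₀ ≡ v₀ × g · nb v₀ i ≡ nb v₀ j)

  moves? : ∀ i j → Dec (Moves i j)
  moves? i j = search-Aut (λ eq (p , q) → trans (sym (eq _)) p , trans (sym (eq _)) q)
    (λ g → (g · v₀ ≟ᵛ v₀) ×-dec (g · nb v₀ i ≟ᵛ nb v₀ j))

  moves-refl : ∀ {i} → Moves i i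
  moves-refl = identity , refl , refl

  moves-sym : ∀ {i j} → Moves i j → Moves j i
  moves-sym (g , p , q) = g ⁻¹ , back p , back q
    where
    back : ∀ {u v} → g · u ≡ v → g ⁻¹ · v ≡ u
    back refl = inverseˡ g _

  moves-trans : ∀ {i j k} → Moves i j → Moves j k → Moves i k
  moves-trans (g , p , q) (h , p′ , q′) =
    h ∙ g , trans (cong (h ·_) p) p′ , trans (cong (h ·_) q) q′

  nb-index : ∀ {v w} → v ~ w → ∃[ i ] nb v i ≡ w
  nb-index p = slot p , nb-slot p

  stabiliser-moves : ∀ g → g · v₀ ≡ v₀ → ∀ i → ∃[ j ] (g · nb v₀ i ≡ nb v₀ j × Moves i j)
  stabiliser-moves g gv i with nb-index (subst (_~ (g · nb v₀ i)) gv (act-~ g (nb-adjacent v₀ i)))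
  ... | j , eq = j , sym eq , g , gv , sym eq

  -- A fixed choice of automorphisms, by which the numbering of the neighbours of `v₀` is used at
  -- every vertex.
  carry : V → G
  carry v = proj₁ (vertexTransitive v₀ v)

  carry-v₀ : ∀ v → carry v · v₀ ≡ v
  carry-v₀ v = proj₂ (vertexTransitive v₀ v)

  carry⁻¹ : ∀ v → carry v ⁻¹ · v ≡ v₀
  carry⁻¹ v = trans (cong (carry v ⁻¹ ·_) (sym (carry-v₀ v))) (inverseˡ (carry v) v₀)

  carried : ∀ {v w} → v ~ w → ∃[ i ] carry v · nb v₀ i ≡ w
  carried {v} {w} p with nb-index (subst (_~ (carry v ⁻¹ · w)) (carry⁻¹ v) (act-~ (carry v ⁻¹) p))
  ... | i , eq = i , trans (cong (carry v ·_) eq) (inverseʳ (carry v) w)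

  transport-stabiliser : ∀ h {v w} → h · v ≡ w → (carry w ⁻¹ ∙ h ∙ carry v) · v₀ ≡ v₀
  transport-stabiliser h {v} refl =
    trans (cong (λ u → carry (h · v) ⁻¹ · (h · u)) (carry-v₀ v)) (carry⁻¹ (h · v))

  uncarry : ∀ h {v w} i j → (carry w ⁻¹ ∙ h ∙ carry v) · nb v₀ i ≡ nb v₀ j →
    h · (carry v · nb v₀ i) ≡ carry w · nb v₀ j
  uncarry h {v} {w} i j eq = trans (sym (inverseʳ (carry w) _)) (cong (carry w ·_) eq)

  -- Stabilisers which fix all neighbours are trivial by connectedness, so `g · v₀` determines `g`;
  -- the rest of the code is constant.
  bounded-if-rigid : (∀ i j → Moves i j → i ≡ j) → Bounded
  bounded-if-rigid rigid = bounded (λ g → g · v₀ , v₀ , false) (λ eq → cong (_, v₀ , false) (eq v₀))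
    λ {g} {h} eq v → act-injectiveᵛ (h ⁻¹) (trans
      (all (h ⁻¹ ∙ g) (trans (cong (h ⁻¹ ·_) (cong proj₁ eq)) (inverseˡ h v₀)) v)
        (sym (inverseˡ h v)))
    where
    fixes-neighbour : ∀ g {v w} → v ~ w → g · v ≡ v → g · w ≡ w
    fixes-neighbour g {v} p gv with i , refl ← carried p
      with j , eq , m ← stabiliser-moves (carry v ⁻¹ ∙ g ∙ carry v) (transport-stabiliser g gv) i
      with refl ← rigid i j m = uncarry g i i eq
    all : ∀ g → g · v₀ ≡ v₀ → ∀ v → g · v ≡ v
    all g gv₀ v = everywhere (fixes-neighbour g) v₀ v gv₀

  -- The stabiliser of a vertex fixes one neighbour, its mate, and swaps the other two.
  -- Walks alternate between edges to the mate and other edges.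
  module Alternating (k : Fin 3) (isolated : ∀ j → Moves k j → k ≡ j)
    (swapped : ∀ (a b : Fin 2) → Moves (punchIn k a) (punchIn k b)) where

    mate : V → V
    mate v = carry v · nb v₀ k

    other : V → Bool → V
    other v b = carry v · nb v₀ (punchIn k (bit→Fin b))

    mate-adjacent : ∀ v → v ~ mate v
    mate-adjacent v = subst (_~ mate v) (carry-v₀ v) (act-~ (carry v) (nb-adjacent v₀ k))

    other-adjacent : ∀ v b → v ~ other v b
    other-adjacent v b = subst (_~ other v b) (carry-v₀ v) (act-~ (carry v) (nb-adjacent v₀ _))

    mate≢other : ∀ v b → mate v ≢ other v b
    mate≢other v b eq =
      Fin.punchInᵢ≢i k (bit→Fin b) (sym (nb-injective v₀ (act-injectiveᵛ (carry v) eq)))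

    other-distinct : ∀ v → other v true ≢ other v false
    other-distinct v eq with Fin.punchIn-injective k (suc zero) zero
      (nb-injective v₀ (act-injectiveᵛ (carry v) eq))
    ... | ()

    mate-or-other : ∀ {v w} → v ~ w → w ≡ mate v ⊎ ∃[ b ] other v b ≡ w
    mate-or-other {v} p with i , refl ← carried p with k Fin.≟ i
    ... | yes refl = inj₁ refl
    ... | no k≢i = inj₂ (unside (punchOut k≢i) (Fin.punchIn-punchOut k≢i))
      where
      unside : ∀ a → punchIn k a ≡ i → ∃[ b ] other v b ≡ carry v · nb v₀ i
      unside zero       eq = false , cong (λ j → carry v · nb v₀ j) eq
      unside (suc zero) eq = true  , cong (λ j → carry v · nb v₀ j) eq

    -- The maps `carry` turn `h` into an element of the stabiliser of `v₀`, which fixes the isolated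
    -- neighbour.
    act-mate : ∀ h v → h · mate v ≡ mate (h · v)
    act-mate h v
      with j , eq , m ← stabiliser-moves (carry (h · v) ⁻¹ ∙ h ∙ carry v)
        (transport-stabiliser h refl) k
      with refl ← isolated j m
      = uncarry h k k eq

    act-other : ∀ h v b → ∃[ c ] h · other v b ≡ other (h · v) c
    act-other h v b with mate-or-other (act-~ h (other-adjacent v b))
    ... | inj₁ eq =
      contradiction (act-injectiveᵛ h (trans (act-mate h v) (sym eq))) (mate≢other v b)
    ... | inj₂ (c , eq) = c , sym eq

    mate-surjective : ∀ w → ∃[ v ] mate v ≡ w
    mate-surjective w with g , eq ← vertexTransitive (mate v₀) w =
      g · v₀ , trans (sym (act-mate g v₀)) eq

    -- A choice of preimages under `mate` is injective, hence surjective by finiteness, so `mate` is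
    -- its two-sided inverse.
    mate-injective : ∀ {u v} → mate u ≡ mate v → u ≡ v
    mate-injective {u} {v} eq = compare (section-surjective u) (section-surjective v) eq
      where
      section : V → V
      section w = proj₁ (mate-surjective w)
      mate-section : ∀ w → mate (section w) ≡ w
      mate-section w = proj₂ (mate-surjective w)
      section-surjective : ∀ v → ∃[ w ] section w ≡ v
      section-surjective v = vertex-at (proj₁ found) , vertex#-injective (proj₂ found)
        where
        found : ∃[ i ] vertex# (section (vertex-at i)) ≡ vertex# v
        found = injective⇒surjective (λ i → vertex# (section (vertex-at i))) (λ {i} {j} eq →
          trans (sym (Inverse.strictlyInverseˡ size i))
            (trans (cong vertex# (trans (sym (mate-section _))
              (trans (cong mate (vertex#-injective eq)) (mate-section _))))
                   (Inverse.strictlyInverseˡ size j))) (vertex# v)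
      compare : ∀ {u v} → ∃[ x ] section x ≡ u → ∃[ y ] section y ≡ v → mate u ≡ mate v → u ≡ v
      compare (x , refl) (y , refl) eq =
        cong section (trans (sym (mate-section x)) (trans eq (mate-section y)))

    swap-others : ∀ v → ∃[ g ] (g · v ≡ v × g · other v true ≡ other v false)
    swap-others v with g , gv , gw ← swapped (suc zero) zero = carry v ∙ g ∙ carry v ⁻¹ ,
      trans (cong (λ u → carry v · (g · u)) (carry⁻¹ v))
        (trans (cong (carry v ·_) gv) (carry-v₀ v)) ,
      trans (cong (λ u → carry v · (g · u)) (inverseˡ (carry v) _)) (cong (carry v ·_) gw)

    mate-fixed : ∀ g {v} → g · mate v ≡ mate v → g · v ≡ v
    mate-fixed g {v} eq = mate-injective (trans (sym (act-mate g v)) eq)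

    -- Otherwise `v` is one of the other neighbours of `mate v`, and these are swapped by an
    -- automorphism fixing `mate v`; but such an automorphism fixes `v`.
    mate-mate : ∀ v → mate (mate v) ≡ v
    mate-mate v with mate-or-other (~-sym (mate-adjacent v))
    ... | inj₁ eq = sym eq
    ... | inj₂ (true , eq) with g , p , q ← swap-others (mate v) =
      contradiction (trans eq (trans (sym (mate-fixed g p)) (trans (cong (g ·_) (sym eq)) q)))
        (other-distinct (mate v))
    ... | inj₂ (false , eq) with g , p , q ← swap-others (mate v) =
      contradiction (act-injectiveᵛ g
        (trans q (trans eq (trans (sym (mate-fixed g p)) (cong (g ·_) (sym eq))))))
        (other-distinct (mate v))

    system : System
    system = record
      { X = V ; G = G
      ; out = λ v b → other (mate v) b
      ; rev = mate
      ; _·_ = _·_ ; ε = identity ; _∙_ = _∙_ ; _⁻¹ = _⁻¹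
      ; out-distinct = λ v → other-distinct (mate v)
      ; rev-rev = mate-mate
      ; rev-out = rev-out
      ; connected = λ {P} o r → everywhere λ {u} e p → walk-edge {P} o r u (mate-or-other e) p
      ; ε-act = λ _ → refl
      ; ∙-act = λ _ _ _ → refl
      ; ⁻¹-act = inverseˡ
      ; act-out = λ g v b →
        subst (λ w → ∃[ c ] g · other (mate v) b ≡ other w c) (act-mate g v)
          (act-other g (mate v) b)
      ; act-rev = act-mate
      ; transitive = vertexTransitive
      ; #X = n ; index = vertex# ; index-inj = vertex#-injective
      ; #G = n ^ n ; encode = encode ; encode-inj = λ {g} {h} → encode-injective {g} {h}
      ; search-G = search-Aut
      }
      where
      rev-out : ∀ v b → ∃[ c ] other (mate (mate (other (mate v) b))) c ≡ mate v
      rev-out v b with mate-or-other (~-sym (other-adjacent (mate v) b))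
      ... | inj₂ (c , eq) = c , trans (cong (λ w → other w c) (mate-mate _)) eq
      ... | inj₁ eq =
        contradiction (trans (mate-mate v) (mate-injective eq)) (mate≢other (mate v) b)
      walk-edge : ∀ {P : V → Set} → (∀ v b → P v → P (other (mate v) b)) →
        (∀ v → P v → P (mate v)) →
        ∀ u {w} → w ≡ mate u ⊎ ∃[ b ] other u b ≡ w → P u → P w
      walk-edge o r u (inj₁ refl) p = r u p
      walk-edge {P} o r u (inj₂ (b , refl)) p =
        subst (λ x → P (other x b)) (mate-mate u) (o (mate u) b (r u p))

    open Arcs system using (ArcTransitive; Semiregular; walk; arcRegular; arcTransitive-≤)
    open ArcImages system

    bounded-if-ends-determine : ∀ t → Semiregular t → ¬ Collision v₀ t → Bounded
    bounded-if-ends-determine t reg none = go (arc-image t reg v₀)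
      where
      label : V × Vec Bool t → V × V × Bool
      label (v , e) = v , walk v e , false
      label-injective : ∀ {x y} → label x ≡ label y → x ≡ y
      label-injective {u , e} {v , f} eq = same (cong proj₁ eq) (cong (proj₁ ∘ proj₂) eq)
        where
        same : u ≡ v → walk u e ≡ walk v f → (u , e) ≡ (v , f)
        same refl eq′ = cong (u ,_) (collision-free none u e f eq′)
      go : Σ[ image ∈ (G → V × Vec Bool t) ]
        ((∀ {g h} → (∀ x → g · x ≡ h · x) → image g ≡ image h) ×
         (∀ {g h} → image g ≡ image h → ∀ x → g · x ≡ h · x)) → Bounded
      go (image , image-cong , image-injective) = bounded (label ∘ image)
        (λ eq → cong label (image-cong eq)) (λ eq → image-injective (label-injective eq))

    splitPX-if-collision : ∀ t → ArcTransitive t → Semiregular t → Collision v₀ t →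
      IsSplitPraegerXu Γ
    splitPX-if-collision t AT reg col = go (first-collision v₀ t col)
      where
      go : ∃[ s ] (suc s < t × ¬ Collision v₀ (suc s) × Collision v₀ (suc (suc s))) →
        IsSplitPraegerXu Γ
      go (s , s<t , none , col′) =
        r , suc s , proj₁ parameters , proj₁ (proj₂ parameters) , proj₂ (proj₂ parameters) ,
        record { bijection = coordinates ; ~-⇔ = λ u v → adjacent⇔ u v ⇔-∘ adjacent u v }
        where
        unique : Arcs.EndsDetermine system (suc s)
        unique = collision-free none
        twin : Arcs.Twins system (suc (suc s))
        twin = collision⇒twin (arcTransitive-≤ s<t AT) col′
        open Coordinates system s t s<t AT reg unique twin v₀
        open Layers.Cycle system s t s<t AT unique twin v₀ using (r)
        adjacent : ∀ u v → u ~ v ⇔ Adjacent u v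
        adjacent u v = mk⇔ (forth ∘ mate-or-other) back
          where
          forth : v ≡ mate u ⊎ ∃[ b ] other u b ≡ v → Adjacent u v
          forth (inj₁ eq)       = inj₁ eq
          forth (inj₂ (b , eq)) = inj₂ (b , trans (cong (λ w → other w b) (mate-mate u)) eq)
          back : Adjacent u v → u ~ v
          back (inj₁ refl) = mate-adjacent u
          back (inj₂ (b , eq)) =
            subst (u ~_) (trans (cong (λ w → other w b) (sym (mate-mate u))) eq)
              (other-adjacent u b)

    conclusion : IsSplitPraegerXu Γ ⊎ Bounded
    conclusion = go (arcRegular v₀)
      where
      go : ∃[ t ] (ArcTransitive t × Semiregular t) → IsSplitPraegerXu Γ ⊎ Bounded
      go (t , AT , reg) = decide (collision? v₀ t)
        where
        decide : Dec (Collision v₀ t) → IsSplitPraegerXu Γ ⊎ Bounded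
        decide (yes col) = inj₁ (splitPX-if-collision t AT reg col)
        decide (no none) = inj₂ (bounded-if-ends-determine t reg none)

-- Arc-transitive cubic graphs

module ArcTransitiveGraph (Γ : Graph) (n : ℕ) (size : HasSize (Graph.vertices Γ) n)
  (cubic : Cubic Γ)
  (connected-Γ : Connected Γ) (vertexTransitive : VertexTransitive Γ)
  (total : ∀ i j → VertexTransitiveGraph.Moves Γ n size cubic connected-Γ vertexTransitive i j)
    where

  open VertexTransitiveGraph Γ n size cubic connected-Γ vertexTransitive

  Dart : Set
  Dart = V × Fin 3

  tl hd : Dart → V
  tl (v , i) = v
  hd (v , i) = nb v i

  tl~hd : ∀ d → tl d ~ hd d
  tl~hd (v , i) = nb-adjacent v i

  dart : ∀ {v w} → v ~ w → Dart
  dart {v} p = v , slot p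

  dart-ext : ∀ {d d′} → tl d ≡ tl d′ → hd d ≡ hd d′ → d ≡ d′
  dart-ext {v , i} {.v , j} refl eq = cong (v ,_) (nb-injective v eq)

  reverse : Dart → Dart
  reverse d = dart (~-sym (tl~hd d))

  hd-reverse : ∀ d → hd (reverse d) ≡ tl d
  hd-reverse d = nb-slot (~-sym (tl~hd d))

  -- `punchIn` skips the slot of the reversed dart, which excludes backtracking.
  next : Dart → Bool → Dart
  next d b = hd d , punchIn (proj₂ (reverse d)) (bit→Fin b)

  hd-next≢tl : ∀ d b → hd (next d b) ≢ tl d
  hd-next≢tl d b eq = Fin.punchInᵢ≢i (proj₂ (reverse d)) (bit→Fin b)
    (nb-injective (hd d) (trans eq (sym (hd-reverse d))))

  hd-next-injective : ∀ d {b c} → hd (next d b) ≡ hd (next d c) → b ≡ c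
  hd-next-injective d eq =
    bit→Fin-injective (Fin.punchIn-injective (proj₂ (reverse d)) _ _ (nb-injective (hd d) eq))

  next-reaches : ∀ d {w} → hd d ~ w → w ≢ tl d → ∃[ b ] hd (next d b) ≡ w
  next-reaches d {w} p w≢ = go (Fin→bit (punchOut j≢) , Fin→bit→Fin (punchOut j≢))
    where
    j≢ : proj₂ (reverse d) ≢ slot p
    j≢ eq = w≢ (trans (sym (nb-slot p)) (trans (cong (nb (hd d)) (sym eq)) (hd-reverse d)))
    go : ∃[ b ] bit→Fin b ≡ punchOut j≢ → ∃[ b ] hd (next d b) ≡ w
    go (b , eq) = b , trans (cong (nb (hd d)) (trans (cong (punchIn (proj₂ (reverse d))) eq)
      (Fin.punchIn-punchOut j≢))) (nb-slot p)

  infixr 7 _⊙_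
  _⊙_ : G → Dart → Dart
  g ⊙ d = dart (act-~ g (tl~hd d))

  hd-⊙ : ∀ g d → hd (g ⊙ d) ≡ g · hd d
  hd-⊙ g d = nb-slot (act-~ g (tl~hd d))

  ⊙-next : ∀ g d b → ∃[ c ] g ⊙ next d b ≡ next (g ⊙ d) c
  ⊙-next g d b = go (next-reaches (g ⊙ d)
      (subst (_~ (g · hd (next d b))) (sym (hd-⊙ g d)) (act-~ g (tl~hd (next d b))))
      (hd-next≢tl d b ∘ act-injectiveᵛ g))
    where
    go : ∃[ c ] hd (next (g ⊙ d) c) ≡ g · hd (next d b) → ∃[ c ] g ⊙ next d b ≡ next (g ⊙ d) c
    go (c , eq) = c , dart-ext (sym (hd-⊙ g d)) (trans (hd-⊙ g (next d b)) (sym eq))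

  reverse-next : ∀ d b → ∃[ c ] next (reverse (next d b)) c ≡ reverse d
  reverse-next d b = go (next-reaches (reverse (next d b))
      (subst (_~ tl d) (sym (hd-reverse (next d b))) (~-sym (tl~hd d)))
      (hd-next≢tl d b ∘ sym))
    where
    go : ∃[ c ] hd (next (reverse (next d b)) c) ≡ tl d →
      ∃[ c ] next (reverse (next d b)) c ≡ reverse d
    go (c , eq) = c , dart-ext (hd-reverse (next d b)) (trans eq (sym (hd-reverse d)))

  reverse-reverse : ∀ d → reverse (reverse d) ≡ d
  reverse-reverse d = dart-ext (hd-reverse d) (hd-reverse (reverse d))

  ⊙-transitive : ∀ d d′ → ∃[ g ] g ⊙ d ≡ d′
  ⊙-transitive (v , i) (w , j)
    with i′ , eq ← carried (nb-adjacent v i) | j′ , eq′ ← carried (nb-adjacent w j)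
    with g , gv , gw ← total i′ j′
    = carry w ∙ g ∙ carry v ⁻¹
    , dart-ext (trans (cong (λ u → carry w · (g · u)) (carry⁻¹ v))
      (trans (cong (carry w ·_) gv) (carry-v₀ w)))
        (trans (hd-⊙ (carry w ∙ g ∙ carry v ⁻¹) (v , i)) (trans (cong (λ u → carry w · (g · u))
          (trans (cong (carry v ⁻¹ ·_) (sym eq)) (inverseˡ (carry v) _)))
          (trans (cong (carry w ·_) gw) eq′)))

  -- Reversing a dart and then taking a next one leads to the other darts with the same tail;
  -- reversal alone passes to the adjacent vertex.
  darts-connected : ∀ {P : Dart → Set} → (∀ d b → P d → P (next d b)) →
    (∀ d → P d → P (reverse d)) →
    ∀ d d′ → P d → P d′
  darts-connected {P} o r (v , i) (w , j) p = everywhere {All} step v w (all (v , i) p) j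
    where
    All : V → Set
    All v = ∀ i → P (v , i)
    all : ∀ d → P d → All (tl d)
    all d p j with nb (tl d) j ≟ᵛ hd d
    ... | yes eq = subst P (sym (dart-ext refl eq)) p
    ... | no ne =
      turn (next-reaches (reverse d)
        (subst (_~ nb (tl d) j) (sym (hd-reverse d)) (nb-adjacent (tl d) j)) ne)
      where
      turn : ∃[ b ] hd (next (reverse d) b) ≡ nb (tl d) j → P (tl d , j)
      turn (b , eq) = subst P (dart-ext (hd-reverse d) eq) (o (reverse d) b (r d p))
    step : ∀ {u w} → u ~ w → All u → All w
    step e q = subst All (nb-slot e) (all (reverse (dart e)) (r (dart e) (q (slot e))))

  system : System
  system = record
    { X = Dart ; G = G ; out = next ; rev = reverse
    ; _·_ = _⊙_ ; ε = identity ; _∙_ = _∙_ ; _⁻¹ = _⁻¹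
    ; out-distinct = λ d eq → distinct (hd-next-injective d (cong hd eq))
    ; rev-rev = reverse-reverse
    ; rev-out = reverse-next
    ; connected = darts-connected
    ; ε-act = λ d → dart-ext refl (hd-⊙ identity d)
    ; ∙-act = λ g h d → dart-ext refl (trans (hd-⊙ (g ∙ h) d)
        (sym (trans (hd-⊙ g (h ⊙ d)) (cong (g ·_) (hd-⊙ h d)))))
    ; ⁻¹-act = λ g d → dart-ext (inverseˡ g (tl d)) (trans (hd-⊙ (g ⁻¹) (g ⊙ d))
        (trans (cong (g ⁻¹ ·_) (hd-⊙ g d)) (inverseˡ g (hd d))))
    ; act-out = ⊙-next
    ; act-rev = λ g d → dart-ext (sym (hd-⊙ g d)) (trans (hd-⊙ g (reverse d))
        (trans (cong (g ·_) (hd-reverse d)) (sym (hd-reverse (g ⊙ d)))))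
    ; transitive = ⊙-transitive
    ; #X = n * 3
    ; index = λ (v , i) → combine (vertex# v) i
    ; index-inj = λ { {v , i} {w , j} eq →
      pair (Fin.combine-injective (vertex# v) i (vertex# w) j eq) }
    ; #G = n ^ n ; encode = encode
    ; encode-inj = λ {g} {h} eq → ⊙-cong {g} {h} (encode-injective {g} {h} eq)
    ; search-G = λ resp → search-Aut λ {g} {h} eq → resp (⊙-cong {g} {h} eq)
    }
    where
    distinct : true ≢ false
    distinct ()
    pair : ∀ {v w} {i j : Fin 3} → vertex# v ≡ vertex# w × i ≡ j → (v , i) ≡ (w , j)
    pair (p , q) = cong₂ _,_ (vertex#-injective p) q
    ⊙-cong : ∀ {g h} → (∀ v → g · v ≡ h · v) → ∀ d → g ⊙ d ≡ h ⊙ d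
    ⊙-cong {g} {h} eq d =
      dart-ext (eq (tl d)) (trans (hd-⊙ g d) (trans (eq (hd d)) (sym (hd-⊙ h d))))

  open Arcs system hiding (_≟_)
  open ArcImages system using (arc-image)

  tail-fixed : ∀ g {d} → g ⊙ d ≡ d → g · tl d ≡ tl d
  tail-fixed g eq = cong tl eq

  head-fixed : ∀ g {d} → g ⊙ d ≡ d → g · hd d ≡ hd d
  head-fixed g {d} eq = trans (sym (hd-⊙ g d)) (cong hd eq)

  -- Non-backtracking walks of length m + 1 in the graph, from a given vertex
  Code : ℕ → Set
  Code m = Fin 3 × Vec Bool m

  last : ∀ {m} → V → Code m → Dart
  last v (i , e) = walk (v , i) e

  end : ∀ {m} → V → Code m → V
  end v c = hd (last v c)

  MapsCode : ∀ {m} → G → V → Code m → V → Code m → Set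
  MapsCode g v c w c′ = Maps g (v , proj₁ c) (proj₂ c) (w , proj₁ c′) (proj₂ c′)

  FixCode : ∀ {m} → G → V → Code m → Set
  FixCode g v c = MapsCode g v c v c

  code-image : ∀ {m} g {v w} (c : Code m) → g · v ≡ w →
    Σ[ c′ ∈ Code m ] MapsCode g v c w c′
  code-image g {v} (i , e) refl with f , p ← maps-exists g e refl =
    (slot (act-~ g (nb-adjacent v i)) , f) , p

  last-image : ∀ {m g v w} {c c′ : Code m} → MapsCode g v c w c′ →
    g ⊙ last v c ≡ last w c′
  last-image = maps-end

  end-image : ∀ {m g v w} {c c′ : Code m} → MapsCode g v c w c′ →
    g · end v c ≡ end w c′
  end-image {g = g} {v} {c = c} p = trans (sym (hd-⊙ g (last v c))) (cong hd (maps-end p))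

  Determined : ℕ → Set
  Determined m = ∀ v (c c′ : Code m) → end v c ≡ end v c′ → c ≡ c′

  Collide : ℕ → Set
  Collide m = Σ[ c ∈ Code m ] Σ[ c′ ∈ Code m ] (c ≢ c′ × end v₀ c ≡ end v₀ c′)

  code-≟ : ∀ {m} (c c′ : Code m) → Dec (c ≡ c′)
  code-≟ (i , e) (j , f) = map′ (λ (p , q) → cong₂ _,_ p q) (λ eq → cong proj₁ eq , cong proj₂ eq)
    ((i Fin.≟ j) ×-dec Vec.≡-dec Bool._≟_ e f)

  search-Code : ∀ m → Searchable (Code m)
  search-Code m = search-× Fin.any? (search-Vec search-Bool m)

  collide? : ∀ m → Dec (Collide m)
  collide? m =
    search-Code m λ c → search-Code m λ c′ → ¬? (code-≟ c c′) ×-dec (end v₀ c ≟ᵛ end v₀ c′)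

  image-injective : ∀ {m g v w} {c c′ k k′ : Code m} →
    MapsCode g v c w k →
    MapsCode g v c′ w k′ → k ≡ k′ → c ≡ c′
  image-injective {g =
    g} p q refl =
      same (cong proj₂ (trans (sym (maps-start (maps-⁻¹ p))) (maps-start (maps-⁻¹ q)))) p q
    where
    same : ∀ {m v w i j} {e f k : Vec Bool m} → i ≡ j → Maps g (v , i) e w k →
      Maps g (v , j) f w k →
      (i , e) ≡ (j , f)
    same refl p q = cong (_ ,_) (maps-functional (maps-⁻¹ p) (maps-⁻¹ q))

  collide-free : ∀ {m} → ¬ Collide m → Determined m
  collide-free {m} none v c c′ eq = go (vertexTransitive v v₀)
    where
    go : ∃[ g ] g · v ≡ v₀ → c ≡ c′
    go (g , gv) = compare (code-image g c gv) (code-image g c′ gv)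
      where
      compare : Σ[ k ∈ Code m ] MapsCode g v c v₀ k →
        Σ[ k ∈ Code m ] MapsCode g v c′ v₀ k → c ≡ c′
      compare (k , p) (k′ , q) with code-≟ k k′
      ... | yes eq′ = image-injective p q eq′
      ... | no ne = contradiction (k , k′ , ne ,
        trans (sym (end-image p)) (trans (cong (g ·_) eq) (end-image q))) none

  collide⇒twin : ∀ {m} → Collide m → ArcTransitive m → ∀ v (c : Code m) →
    Σ[ c′ ∈ Code m ] (c′ ≢ c × end v c′ ≡ end v c)
  collide⇒twin {m} (k , k′ , ne , eq) AT v c =
    go (AT (v₀ , proj₁ k) (v , proj₁ c) (proj₂ k) (proj₂ c))
    where
    go : ∃[ g ] MapsCode g v₀ k v c → Σ[ c′ ∈ Code m ] (c′ ≢ c × end v c′ ≡ end v c)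
    go (g , p) = found (code-image g k′ (cong tl (maps-start p)))
      where
      found : Σ[ c′ ∈ Code m ] MapsCode g v₀ k′ v c′ →
        Σ[ c′ ∈ Code m ] (c′ ≢ c × end v c′ ≡ end v c)
      found (c′ , q) = c′ , (λ eq′ → ne (image-injective p q (sym eq′))) ,
        trans (sym (end-image q)) (trans (cong (g ·_) (sym eq)) (end-image p))

  record Split {m} (v : V) (c : Code (suc m)) : Set where
    field
      front    : Code m
      bit      : Bool
      code≡    : c ≡ (proj₁ front , proj₂ front ∷ʳ bit)
    last≡ : last v c ≡ next (last v front) bit
    last≡ = trans (cong (last v) code≡) (walk-∷ʳ (v , proj₁ front) (proj₂ front) bit)
    end-front : end v front ≡ tl (last v c)
    end-front = cong tl (sym last≡)

  split : ∀ {m} v (c : Code (suc m)) → Split v c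
  split v (i , e) with f , b , refl ← snoc-view e =
    record { front = i , f ; bit = b ; code≡ = refl }

  -- The tail of the last dart is the end of the front, which determines the front; the head then
  -- determines the last letter.
  same-last : ∀ {m} → Determined m → ∀ v (c c′ : Code (suc m)) → last v c ≡ last v c′ → c ≡ c′
  same-last det v c c′ eq = go (split v c) (split v c′)
    where
    go : Split v c → Split v c′ → c ≡ c′
    go s s′ =
      trans S.code≡ (trans (cong₂ (λ k b → proj₁ k , proj₂ k ∷ʳ b) fronts bits) (sym S′.code≡))
      where
      module S  = Split s
      module S′ = Split s′
      fronts : S.front ≡ S′.front
      fronts = det v S.front S′.front (trans S.end-front (trans (cong tl eq) (sym S′.end-front)))
      bits : S.bit ≡ S′.bit
      bits = hd-next-injective (last v S.front) (cong hd (trans (sym S.last≡) (trans eq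
        (trans S′.last≡ (cong (λ k → next (last v k) S′.bit) (sym fronts))))))

  -- The walk `c` has two continuations, one of them to `p`, and arc-transitivity in length `k + 1`
  -- takes this one to the other.
  flip : ∀ {k} → ArcTransitive (suc k) → ∀ v (c : Code k) {p} → end v c ~ p → p ≢ tl (last v c) →
    ∃[ g ] (FixCode g v c × g · p ≢ p ×
            (∀ {q} → end v c ~ q → q ≢ tl (last v c) → q ≢ p → g · p ≡ q))
  flip AT v c {p} a p≢ = go (next-reaches (last v c) a p≢)
    where
    z : Dart
    z = last v c
    go : ∃[ b ] hd (next z b) ≡ p →
      ∃[ g ] (FixCode g v c × g · p ≢ p × (∀ {q} → end v c ~ q → q ≢ tl z → q ≢ p → g · p ≡ q))
    go (b , refl) = with-map (AT (v , proj₁ c) (v , proj₁ c) (proj₂ c ∷ʳ b) (proj₂ c ∷ʳ not b))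
      where
      with-map : ∃[ g ] Maps g (v , proj₁ c) (proj₂ c ∷ʳ b) (v , proj₁ c) (proj₂ c ∷ʳ not b) →
        ∃[ g ] (FixCode g v c × g · hd (next z b) ≢ hd (next z b) ×
          (∀ {q} → end v c ~ q → q ≢ tl z → q ≢ hd (next z b) → g · hd (next z b) ≡ q))
      with-map (g , maps) = g , maps-init (proj₂ c) (proj₂ c) maps ,
        (λ eq → Bool.not-¬ refl (hd-next-injective z (trans (sym eq) moved))) ,
        (λ a q≢ q≢p → reached (next-reaches z a q≢) q≢p)
        where
        moved : g · hd (next z b) ≡ hd (next z (not b))
        moved = trans (sym (hd-⊙ g (next z b))) (cong hd (maps-last (proj₂ c) (proj₂ c) maps))
        reached : ∀ {q} → ∃[ b′ ] hd (next z b′) ≡ q → q ≢ hd (next z b) → g · hd (next z b) ≡ q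
        reached (b′ , refl) q≢p = trans moved (cong (λ d → hd (next z d))
          (sym (Bool.¬-not (λ eq → q≢p (cong (λ d → hd (next z d)) eq)))))

  fixed-end : ∀ {g k v} (c : Code k) → FixCode g v c → g · end v c ≡ end v c
  fixed-end {g} c fix = head-fixed g (maps-end fix)

  -- By `same-last`, a twin of `c` arrives through a second neighbour of the end. An automorphism
  -- fixing `c` and moving that neighbour takes the twin to a walk arriving through the third.
  all-predecessors : ∀ {m} → Determined m → Collide (suc m) → ArcTransitive (suc (suc m)) →
    ∀ v (c : Code (suc m)) {w} → end v c ~ w →
    Σ[ c′ ∈ Code (suc m) ] (tl (last v c′) ≡ w × end v c′ ≡ end v c)
  all-predecessors {m} det col AT v c {w} a =
    go (w ≟ᵛ tl (last v c)) (collide⇒twin col (arcTransitive-pred AT) v c)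
    where
    Goal : Set
    Goal = Σ[ c′ ∈ Code (suc m) ] (tl (last v c′) ≡ w × end v c′ ≡ end v c)
    go : Dec (w ≡ tl (last v c)) → Σ[ c′ ∈ Code (suc m) ] (c′ ≢ c × end v c′ ≡ end v c) → Goal
    go (yes eq) _ = c , sym eq , refl
    go (no w≢) (k , k≢c , eq) = third (w ≟ᵛ tl (last v k))
      where
      k-differs : tl (last v k) ≢ tl (last v c)
      k-differs eq′ = k≢c (same-last det v k c (dart-ext eq′ eq))
      third : Dec (w ≡ tl (last v k)) → Goal
      third (yes eq′) = k , sym eq′ , eq
      third (no w≢k) =
        turn (flip AT v c (subst (_~ tl (last v k)) eq (~-sym (tl~hd (last v k)))) k-differs)
        where
        turn : ∃[ g ] (FixCode g v c × g · tl (last v k) ≢ tl (last v k) ×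
          (∀ {q} → end v c ~ q → q ≢ tl (last v c) → q ≢ tl (last v k) → g · tl (last v k) ≡ q)) →
            Goal
        turn (g , fix , _ , moves) = found (code-image g k (tail-fixed g (maps-start fix)))
          where
          found : Σ[ k′ ∈ Code (suc m) ] MapsCode g v k v k′ → Goal
          found (k′ , q) = k′ , trans (sym (cong tl (last-image q))) (moves a w≢ w≢k) ,
            trans (sym (end-image q)) (trans (cong (g ·_) eq) (fixed-end c fix))

  -- `c₂` prolongs `c₁` by an edge to a vertex `w`. By `all-predecessors`, some walk `c` ends like
  -- `c₁` but arrives through `w`; let `y` precede `w` on it. An automorphism fixing `c₂` and moving
  -- `y` would fix the last dart of `c`, hence `c` by `same-last`, and hence `y`.
  stabiliser-trivial : ∀ {m} → Determined m → Collide (suc m) → ¬ ArcTransitive (suc (suc (suc m)))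
  stabiliser-trivial {m} det col AT =
    go (all-predecessors det col (arcTransitive-pred AT) v₀ c₁ (tl~hd (next (last v₀ c₁) true)))
    where
    c₁ : Code (suc m)
    c₁ = zero , replicate (suc m) true
    c₂ : Code (suc (suc m))
    c₂ = zero , replicate (suc m) true ∷ʳ true
    z₂ : last v₀ c₂ ≡ next (last v₀ c₁) true
    z₂ = walk-∷ʳ (v₀ , zero) (replicate (suc m) true) true
    go : Σ[ c ∈ Code (suc m) ] (tl (last v₀ c) ≡ hd (next (last v₀ c₁) true) ×
      end v₀ c ≡ end v₀ c₁) → ⊥
    go (c , tl-c , hd-c) = turn (flip AT v₀ c₂ {y} y-adjacent y≢)
      where
      open Split (split v₀ c)
      y : V
      y = tl (last v₀ front)
      w≡ : end v₀ front ≡ end v₀ c₂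
      w≡ = trans end-front (trans tl-c (cong hd (sym z₂)))
      y-adjacent : end v₀ c₂ ~ y
      y-adjacent = subst (_~ y) w≡ (~-sym (tl~hd (last v₀ front)))
      y≢ : y ≢ tl (last v₀ c₂)
      y≢ eq = hd-next≢tl (last v₀ front) bit (trans (cong hd (sym last≡))
        (trans hd-c (trans (sym (cong tl z₂)) (sym eq))))
      turn : ∃[ g ] (Fix g (v₀ , zero) (proj₂ c₂) × g · y ≢ y ×
        (∀ {q} → end v₀ c₂ ~ q → q ≢ tl (last v₀ c₂) → q ≢ y → g · y ≡ q)) → ⊥
      turn (g , fix , moved , _) = found (code-image g c (tail-fixed g (maps-start fix)))
        where
        g-last : g ⊙ last v₀ c ≡ last v₀ c
        g-last = dart-ext
          (trans (cong (g ·_) (trans (sym end-front) w≡))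
            (trans (fixed-end c₂ fix) (sym (trans (sym end-front) w≡))))
          (trans (hd-⊙ g (last v₀ c)) (trans (cong (g ·_) hd-c)
            (trans (fixed-end c₁ (maps-init (proj₂ c₁) (proj₂ c₁) fix)) (sym hd-c))))
        found : Σ[ c′ ∈ Code (suc m) ] MapsCode g v₀ c v₀ c′ → ⊥
        found (c′ , q) = moved (tail-fixed g (maps-end (fix-front
            (subst (λ k → MapsCode g v₀ c v₀ k) c′≡c q) code≡)))
          where
          c′≡c : c′ ≡ c
          c′≡c = same-last det v₀ c′ c (trans (sym (last-image q)) g-last)
          fix-front : ∀ {c} → FixCode g v₀ c → c ≡ (proj₁ front , proj₂ front ∷ʳ bit) →
            FixCode g v₀ front
          fix-front fix refl = maps-init (proj₂ front) (proj₂ front) fix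

  -- If both walks arrive through the same neighbour, they are shortened, down to a loop at `v`.
  -- Otherwise an automorphism fixing `c` moves the last vertex but one of `c′`; yet it fixes both
  -- ends of `c′`, and so `c′` itself.
  no-odd-cycle : ∀ l → ArcTransitive (suc (suc l)) → (∀ k → k ≤ l → Determined k) →
    ∀ v (c : Code (suc l)) (c′ : Code l) → end v c ≢ end v c′
  no-odd-cycle l AT det v c c′ eq with tl (last v c) ≟ᵛ tl (last v c′)
  no-odd-cycle zero AT det v c (i , []) eq | yes same =
    ~-irrefl v (subst (v ~_) (trans end-front same) (adjacent-end front))
    where
    open Split (split v c)
    adjacent-end : ∀ (k : Code 0) → v ~ end v k
    adjacent-end (j , []) = nb-adjacent v j
  no-odd-cycle (suc l) AT det v c c′ eq | yes same =
    no-odd-cycle l (arcTransitive-pred AT) (λ k k≤l → det k (ℕ.m≤n⇒m≤1+n k≤l)) v S.front S′.front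
      (trans S.end-front (trans same (sym S′.end-front)))
    where
    module S  = Split (split v c)
    module S′ = Split (split v c′)
  ... | no differ =
    turn (flip AT v c (subst (_~ tl (last v c′)) (sym eq) (~-sym (tl~hd (last v c′))))
      (differ ∘ sym))
    where
    turn : ∃[ g ] (FixCode g v c × g · tl (last v c′) ≢ tl (last v c′) ×
      (∀ {q} → end v c ~ q → q ≢ tl (last v c) → q ≢ tl (last v c′) → g · tl (last v c′) ≡ q)) → ⊥
    turn (g , fix , moved , _) = found (code-image g c′ (tail-fixed g (maps-start fix)))
      where
      found : Σ[ k ∈ Code l ] MapsCode g v c′ v k → ⊥
      found (k , q) = moved (tail-fixed g (trans (last-image q) (cong (last v) k≡)))
        where
        k≡ : k ≡ c′
        k≡ = det l ℕ.≤-refl v k c′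
          (trans (sym (end-image q)) (trans (cong (g ·_) (sym eq)) (trans (fixed-end c fix) eq)))

  bounded-by-labels : ∀ t → Semiregular t → (label : Dart × Vec Bool t → V × V × Bool) →
    (∀ x y → label x ≡ label y → x ≡ y) → Bounded
  bounded-by-labels t reg label label-injective = go (arc-image t reg (v₀ , zero))
    where
    go : Σ[ image ∈ (G → Dart × Vec Bool t) ]
      ((∀ {g h} → (∀ d → g ⊙ d ≡ h ⊙ d) → image g ≡ image h) ×
       (∀ {g h} → image g ≡ image h → ∀ d → g ⊙ d ≡ h ⊙ d)) → Bounded
    go (image , image-cong , image-inj) = bounded (label ∘ image)
      (λ {g} {h} eq → cong label (image-cong {g} {h} λ d →
        dart-ext (eq (tl d)) (trans (hd-⊙ g d) (trans (eq (hd d)) (sym (hd-⊙ h d))))))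
      (λ {g} {h} eq v → cong tl (image-inj {g} {h} (label-injective (image g) (image h) eq) (v ,
        zero)))

  bounded-edge : Semiregular 0 → Bounded
  bounded-edge reg = bounded-by-labels 0 reg (λ (d , _) → tl d , hd d , false)
    λ { (d , []) (d′ , []) eq → cong (_, []) (dart-ext (cong proj₁ eq) (cong (proj₁ ∘ proj₂) eq)) }

  bounded-if-determined : ∀ t → Semiregular (suc t) → Determined t → Bounded
  bounded-if-determined t reg det = bounded-by-labels (suc t) reg label label-injective
    where
    -- The label need not follow the arc: `b` is stored, and the rest is reread as a walk of length
    -- `t + 1` from `v`.
    label : Dart × Vec Bool (suc t) → V × V × Bool
    label ((v , i) , b ∷ e) = v , end v (i , e) , b
    label-injective : ∀ x y → label x ≡ label y → x ≡ y
    label-injective ((v , i) , b ∷ e) ((w , j) , c ∷ f) eq =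
      same (cong proj₁ eq) (cong (proj₁ ∘ proj₂) eq) (cong (proj₂ ∘ proj₂) eq)
      where
      same : v ≡ w → end v (i , e) ≡ end w (j , f) → b ≡ c → ((v , i) , b ∷ e) ≡ ((w , j) , c ∷ f)
      same refl eq refl with refl ← det v (i , e) (j , f) eq = refl

  -- In the absence of short odd cycles, the walks of length m + 1 from v and from a given
  -- neighbour of v all have distinct ends; there are 3 · 2^(m+1) of them, hence 3 · 2^(m+1) ≤ n.
  bounded-if-no-odd-cycle : ∀ m → Semiregular (suc (suc m)) → ArcTransitive (suc (suc m)) →
    (∀ k → k ≤ m → Determined k) → Bounded
  bounded-if-no-odd-cycle m reg AT det = bounded-by-labels (suc (suc m)) reg label label-injective
    where
    pick : Bool → V → V
    pick true  v = nb v zero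
    pick false v = v
    label : Dart × Vec Bool (suc (suc m)) → V × V × Bool
    label ((v , i) , b ∷ c ∷ e) = v , end (pick b v) (i , e) , c
    -- A common end would give walks from `v` whose lengths differ by one: the walk from `nb v zero`
    -- is prolonged by the edge from `v` or, if it first returns to `v`, loses that edge.
    disjoint : ∀ v (c : Code m) (c′ : Code m) → end v c ≢ end (nb v zero) c′
    disjoint v c (k , f) eq with nb (nb v zero) k ≟ᵛ v
    ... | no ≢v = step (next-reaches (v , zero) (nb-adjacent (nb v zero) k) ≢v)
      where
      step : ∃[ b ] hd (next (v , zero) b) ≡ nb (nb v zero) k → ⊥
      step (b , eq′) = no-odd-cycle m AT det v (zero , b ∷ f) c
        (trans (cong (λ d → hd (walk d f)) (dart-ext refl eq′)) (sym eq))
    disjoint v (i , []) (k , []) eq | yes ≡v =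
      ~-irrefl v (subst (v ~_) (trans eq ≡v) (nb-adjacent v i))
    disjoint v c (k , b ∷ f) eq | yes ≡v = no-odd-cycle _ (arcTransitive-pred AT)
      (λ k k≤ → det k (ℕ.m≤n⇒m≤1+n k≤)) v c (proj₂ d , f) (trans eq (cong (λ d → hd (walk d f)) d≡))
      where
      d : Dart
      d = v , punchIn (proj₂ (reverse (nb v zero , k))) (bit→Fin b) 
      d≡ : next (nb v zero , k) b ≡ d
      d≡ = cong (_, proj₂ d) ≡v
    label-injective : ∀ x y → label x ≡ label y → x ≡ y
    label-injective ((v , i) , b ∷ c ∷ e) ((w , j) , b′ ∷ c′ ∷ f) eq =
      same b b′ (cong proj₁ eq) (cong (proj₁ ∘ proj₂) eq) (cong (proj₂ ∘ proj₂) eq)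
      where
      same : ∀ b b′ → v ≡ w → end (pick b v) (i , e) ≡ end (pick b′ w) (j , f) → c ≡ c′ →
        ((v , i) , b ∷ c ∷ e) ≡ ((w , j) , b′ ∷ c′ ∷ f)
      same true  true  refl eq refl with refl ← det m ℕ.≤-refl (nb v zero) (i , e) (j , f) eq = refl
      same false false refl eq refl with refl ← det m ℕ.≤-refl v (i , e) (j , f) eq = refl
      same true  false refl eq refl = contradiction (sym eq) (disjoint v (j , f) (i , e))
      same false true  refl eq refl = contradiction eq (disjoint v (i , e) (j , f))

  conclusion : Bounded
  conclusion = go (arcRegular (v₀ , zero))
    where
    go : ∃[ t ] (ArcTransitive t × Semiregular t) → Bounded
    go (zero  , AT , reg) = bounded-edge reg
    -- `Collide t` is about walks with `t + 1` edges, so their length equals the degree of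
    -- arc-transitivity.
    go (suc t , AT , reg) = decide (collide? t)
      where
      decide : Dec (Collide t) → Bounded
      decide (no none) = bounded-if-determined t reg (collide-free none)
      decide (yes col) = shortest (least collide? t col)
        where
        shortest : ∃[ m ] (Collide m × (∀ k → k < m → ¬ Collide k)) → Bounded
        shortest (zero , ((i , []) , (j , []) , ne , eq) , _) =
          contradiction (cong (_, []) (nb-injective v₀ eq)) ne
        shortest (suc m , col′ , below) = bounded-if-no-odd-cycle m
          (subst Semiregular t≡ reg) (subst ArcTransitive t≡ AT) (λ k k≤m → det k (s≤s k≤m))
          where
          det : ∀ k → k < suc m → Determined k
          det k k< = collide-free (below k k<)
          m<t : suc m ≤ t
          m<t = ℕ.≮⇒≥ λ t< → below t t< col
          t≤ : suc t ≤ suc (suc m)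
          t≤ = ℕ.≮⇒≥ λ m< → stabiliser-trivial (det m ℕ.≤-refl) col′ (arcTransitive-≤ m< AT)
          t≡ : suc t ≡ suc (suc m)
          t≡ = ℕ.≤-antisym t≤ (s≤s m<t)

corollary1p2 : (Γ : Graph) (n : ℕ) → HasSize (Graph.vertices Γ) n →
    Connected Γ → VertexTransitive Γ → Cubic Γ →
    IsSplitPraegerXu Γ ⊎ (∃[ k ] (HasSize (Aut Γ) k × k ≤ 2 * n ^ 2))
corollary1p2 Γ n size connected vertexTransitive cubic = local trichotomy
  where
  open VertexTransitiveGraph Γ n size cubic connected vertexTransitive
  open Trichotomy moves? moves-refl moves-sym moves-trans
  local : (∀ i j → Moves i j) ⊎ (∀ i j → Moves i j → i ≡ j) ⊎
    ∃[ k ] ((∀ j → Moves k j → k ≡ j) × (∀ (a b : Fin 2) → Moves (punchIn k a) (punchIn k b))) →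
    IsSplitPraegerXu Γ ⊎ Bounded
  local (inj₁ total) =
    inj₂ (ArcTransitiveGraph.conclusion Γ n size cubic connected vertexTransitive total)
  local (inj₂ (inj₁ rigid)) = inj₂ (bounded-if-rigid rigid)
  local (inj₂ (inj₂ (k , isolated , swapped))) = Alternating.conclusion k isolated swapped
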